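{- Let $G$ be a weakly connected oriented graph on $n\ge 2$ vertices $1,\dots,n$ with $m\ge 1$ edges $e_1,\dots,e_m$, with non-zero edge weights in $\mathbb{C}\setminus\mathbb{R}^-$ and complex signless Laplacian matrix $Q$. Suppose that $G$ contains cycles, that $wt(C)\in\mathbb{R}^-$ for all odd cycles $C$ of $G$ and that $wt(C)\in\mathbb{R}^+$ for all even cycles $C$ of $G$. Then the Moore--Penrose inverse $Q^+$ of $Q$ has entries $$(Q^+)_{ij}=\left[\frac{1}{\sum_{T\in\mathcal{T}(G)}|W_T|}\right]^2\sum_{k=1}^m\ \sum_{\substack{T_r,T_s\in\mathcal{T}(G)\\ e_k\in T_r\cap T_s}}|W_{T_r}||W_{T_s}|\,\overline{(N^+_{T_r})_{ki}}\,(N^+_{T_s})_{kj},$$ where $\mathcal{T}(G)$ is the set of all oriented spanning trees of $G$ and, for $T\in\mathcal{T}(G)$ and $e_k=(u,v)\in T$, $$(N_T^+)_{kj}=\frac{(-1)^{d(e_k,j)}}{n}\begin{cases}\dfrac{|T_h(e_k)|}{\sqrt{w_{uv}}}\,\dfrac{|wt(\gamma_{j\to u})|}{wt(\gamma_{j\to u})} & \text{if } j\in T_t(e_k),\\[2mm] \dfrac{|T_t(e_k)|}{\sqrt{\overline{w_{uv}}}}\,\dfrac{|wt(\gamma_{j\to v})|}{wt(\gamma_{j\to v})} & \text{if } j\in T_h(e_k).\end{cases}$$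
   Context: An oriented graph $G$ is obtained from a finite simple undirected graph $G_u$ (its underlying graph) by giving each edge exactly one direction; it is weakly connected if $G_u$ is connected. Write $V(G)=\{1,\dots,n\}$ and $E(G)=\{e_1,\dots,e_m\}$. Each directed edge $(u,v)$ (tail $u$, head $v$) has a non-zero complex weight $w_{uv}$. $\mathbb{R}^+$ and $\mathbb{R}^-$ denote the positive and the negative real numbers, and $\sqrt{\cdot}$ is the principal square root. The complex adjacency matrix is $A=(a_{ij})$ with $a_{ij}=w_{ij}$ if $(i,j)\in E(G)$, $a_{ij}=\overline{w_{ji}}$ if $(j,i)\in E(G)$, and $a_{ij}=0$ otherwise. The complex signless Laplacian matrix is $Q=D+A$, where $D$ is diagonal with $D_{ii}=\sum_{j\ne i}|a_{ij}|$. One has $Q=NN^*$, where $N=(n_{ij})$ is the $n\times m$ complex signless incidence matrix: for $e_j=(u,v)$, $n_{ij}=\sqrt{w_{uv}}$ if $i=u$, $n_{ij}=\sqrt{\overline{w_{uv}}}$ if $i=v$, and $n_{ij}=0$ otherwise. The weight of a walk $\gamma=(i_1,\dots,i_k)$ in $G_u$ is $wt(\gamma)=\prod_{s=1}^{k-1}a_{i_si_{s+1}}$ (so a trivial one-vertex walk has weight $1$). A cycle of $G$ means a cycle of $G_u$; $wt(C)$ is the weight of the closed walk going once around $C$ in either direction (the two directions give complex conjugate values, so the conditions $wt(C)\in\mathbb{R}^\pm$ do not depend on the choice). For an oriented graph $H$, $W_H$ is the product of all edge weights of $H$. For a spanning tree $T$ and an edge $e_k=(u,v)$ of $T$: $T_t(e_k)$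 and $T_h(e_k)$ are the connected components of $T-e_k$ containing the tail $u$ and the head $v$, respectively, and $|T_t(e_k)|,|T_h(e_k)|$ are their numbers of vertices; $d(e_k,j)=\min(d(u,j),d(v,j))$ with $d$ the distance in $T$; $\gamma_{j\to u}$ is the unique walk without repeated vertices from $j$ to $u$ in $T$. Here $N_T$ is the complex signless incidence matrix of $T$, and the rows of its Moore--Penrose inverse $N_T^+$ are labelled by the edges of $T$ (keeping the labels from $G$) and its columns by the vertices. -}

module Defs where

open import Algebra.Bundles using (CommutativeRing; RawRing)
import Algebra.Properties.Ring as RingProperties
import Algebra.Definitions.RawSemiring as RawSemiringDefinitions
open import Data.Fin.Base using (Fin; zero; suc)
open import Data.Fin.Properties using (_≟_; any?; all?; injective⇒≤)
open import Data.Fin.Subset using (Subset; _∈_; _-_; inside; outside)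
open import Data.Fin.Subset.Properties using (_∈?_)
open import Data.List.Base as List
  using (List; []; _∷_; _++_; _∷ʳ_; length; lookup; filter; allFin; takeWhile; upTo)
open import Data.List.Relation.Unary.All as All using ()
open import Data.List.Relation.Unary.AllPairs using ([]; _∷_)
open import Data.List.Relation.Unary.Linked using (Linked; linked?)
open import Data.List.Relation.Unary.Unique.Propositional using (Unique)
import Data.List.Relation.Unary.Unique.DecPropositional as DecUnique
open import Data.List.Membership.Propositional.Properties using (∈-lookup)
open import Data.Maybe.Base using (just; nothing)
open import Data.Maybe.Properties using (≡-dec)
open import Data.Nat.Base as ℕ using (ℕ; zero; suc; s≤s; _⊓_)
import Data.Nat.Properties as ℕ
open import Data.Product.Base using (∃; ∃-syntax; _×_; _,_; proj₁; proj₂)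
open import Data.Sum.Base using (_⊎_; inj₁; inj₂; [_,_]′)
import Data.Vec.Base as Vec
open import Function.Base using (_∘_; id)
open import Level using (0ℓ)
open import Relation.Binary.Structures using (IsDecTotalOrder)
open import Relation.Binary.PropositionalEquality as ≡ using (_≡_; _≢_)
open import Relation.Nullary using (¬_; Dec; yes; no; contradiction; ¬?; map′; _×-dec_; _⊎-dec_)
open import Relation.Unary using (Decidable)

private
  module Identities (CR : CommutativeRing 0ℓ 0ℓ) where
    open CommutativeRing CR using (_+_; _*_; _≈_; refl; commutativeSemiring)
    open import Algebra.Solver.Ring.NaturalCoefficients.Default commutativeSemiring
      using (solve; _:=_; _:+_; _:*_)

    rearrange : ∀ a p u v →
      (a * (p + v) + (a + u) * p) + u * v ≈ a * p + (a + u) * (p + v)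
    rearrange = solve 4 (λ a p u v →
      (a :* (p :+ v) :+ (a :+ u) :* p) :+ u :* v := a :* p :+ (a :+ u) :* (p :+ v)) refl

    factor : ∀ x y → (x + y) * x ≈ x * y + x * x
    factor = solve 2 (λ x y → (x :+ y) :* x := x :* y :+ x :* x) refl

    sum-shift : ∀ a b c → a + (b + c) ≈ b + (c + a)
    sum-shift = solve 3 (λ a b c → a :+ (b :+ c) := b :+ (c :+ a)) refl

    sum-swap : ∀ a b c → a + (b + c) ≈ b + (a + c)
    sum-swap = solve 3 (λ a b c → a :+ (b :+ c) := b :+ (a :+ c)) refl

    d[t-s] : ∀ s c x → s * c + x + s * s ≈ (s + c) * s + x
    d[t-s] = solve 3 (λ s c x → s :* c :+ x :+ s :* s := (s :+ c) :* s :+ x) refl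

    d²t² : ∀ d t → d * (d * (t * t)) ≈ (d * t) * (d * t)
    d²t² = solve 2 (λ d t → d :* (d :* (t :* t)) := (d :* t) :* (d :* t)) refl

    [sc+x]² : ∀ s c x → (s * c + x) * (s * c + x)
                      ≈ (s * c * x + s * c * x) + (s * s * (c * c) + x * x)
    [sc+x]² = solve 3 (λ s c x → (s :* c :+ x) :* (s :* c :+ x)
      := (s :* c :* x :+ s :* c :* x) :+ (s :* s :* (c :* c) :+ x :* x)) refl

    d²x : ∀ s c x → (s + c) * ((s + c) * x)
                  ≈ (s * c * x + s * c * x) + (s * s * x + x * (c * c))
    d²x = solve 3 (λ s c x → (s :+ c) :* ((s :+ c) :* x)
      := (s :* c :* x :+ s :* c :* x) :+ (s :* s :* x :+ x :* (c :* c))) refl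

-- The standard library has no real numbers, so they are characterised as a
-- complete ordered field.  The axioms are those of classical analysis: the
-- order is decidable and every inhabited bounded predicate has a supremum.
record Reals : Set₁ where
  infix 4 _≤_ _<_
  field
    commutativeRing : CommutativeRing 0ℓ 0ℓ

  open CommutativeRing commutativeRing public renaming (Carrier to ℝ) hiding (zero)

  field
    _≤_             : ℝ → ℝ → Set
    isDecTotalOrder : IsDecTotalOrder _≈_ _≤_
    1≉0             : 1# ≉ 0#
    inverse         : ∀ x → x ≉ 0# → ∃[ y ] x * y ≈ 1#
    +-monoʳ-≤       : ∀ z {x y} → x ≤ y → z + x ≤ z + y
    *-nonneg        : ∀ {x y} → 0# ≤ x → 0# ≤ y → 0# ≤ x * y
    supremum        : (P : ℝ → Set) → ∃ P → (∃[ b ] (∀ y → P y → y ≤ b)) →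
                      ∃[ s ] (∀ y → P y → y ≤ s) ×
                             (∀ b → (∀ y → P y → y ≤ b) → s ≤ b)

  module Order = IsDecTotalOrder isDecTotalOrder

  _<_ : ℝ → ℝ → Set
  x < y = x ≤ y × x ≉ y

  infix 8 _⁻¹
  -- The value at 0 is arbitrary.
  _⁻¹ : ℝ → ℝ
  x ⁻¹ with x Order.≟ 0#
  ... | yes _   = 0#
  ... | no x≉0 = proj₁ (inverse x x≉0)

  private module I = Identities commutativeRing

  ≤-resp : ∀ {x x′ y y′} → x ≈ x′ → y ≈ y′ → x ≤ y → x′ ≤ y′
  ≤-resp p q = proj₁ Order.≤-resp-≈ q ∘ proj₂ Order.≤-resp-≈ p

  difference : ∀ {x y} → x ≤ y → ∃[ u ] 0# ≤ u × x + u ≈ y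
  difference {x} {y} p =
    - x + y , ≤-resp (-‿inverseˡ x) refl (+-monoʳ-≤ (- x) p) ,
    trans (sym (+-assoc x (- x) y)) (trans (+-congʳ (-‿inverseʳ x)) (+-identityˡ y))

  from-difference : ∀ {x y u} → 0# ≤ u → x + u ≈ y → x ≤ y
  from-difference {x} p e = ≤-resp (+-identityʳ x) e (+-monoʳ-≤ x p)

  +-cancelˡ-≤ : ∀ z {x y} → z + x ≤ z + y → x ≤ y
  +-cancelˡ-≤ z p = ≤-resp (lem _) (lem _) (+-monoʳ-≤ (- z) p)
    where
    lem : ∀ x → - z + (z + x) ≈ x
    lem x = trans (sym (+-assoc (- z) z x)) (trans (+-congʳ (-‿inverseˡ z)) (+-identityˡ x))

  +-nonneg : ∀ {x y} → 0# ≤ x → 0# ≤ y → 0# ≤ x + y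
  +-nonneg {x} p q = Order.trans p (from-difference q refl)

  *-monoʳ-≤ : ∀ {a x y} → 0# ≤ a → x ≤ y → a * x ≤ a * y
  *-monoʳ-≤ {a} 0≤a p with difference p
  ... | u , 0≤u , e =
    from-difference (*-nonneg 0≤a 0≤u) (trans (sym (distribˡ a _ u)) (*-congˡ e))

  *-cancelˡ-≤ : ∀ {d x y} → 0# ≤ d → d ≉ 0# → d * x ≤ d * y → x ≤ y
  *-cancelˡ-≤ {d} {x} {y} 0≤d d≉0 p with Order.total x y
  ... | inj₁ x≤y = x≤y
  ... | inj₂ y≤x with inverse d d≉0
  ...   | e , de≈1 = Order.reflexive (trans (sym (lem x))
                       (trans (*-congˡ (Order.antisym p (*-monoʳ-≤ 0≤d y≤x))) (lem y)))
    where
    lem : ∀ z → e * (d * z) ≈ z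
    lem z = trans (sym (*-assoc e d z))
              (trans (*-congʳ (trans (*-comm e d) de≈1)) (*-identityˡ z))

  0≤1 : 0# ≤ 1#
  0≤1 with Order.total 0# 1#
  ... | inj₁ p = p
  ... | inj₂ p = ≤-resp refl (trans (-1*x≈-x (- 1#)) (-‿involutive 1#)) (*-nonneg 0≤-1 0≤-1)
    where
    open RingProperties ring using (-1*x≈-x; -‿involutive)
    0≤-1 : 0# ≤ - 1#
    0≤-1 = ≤-resp (-‿inverseˡ 1#) (+-identityʳ (- 1#)) (+-monoʳ-≤ (- 1#) p)

  square-cancel-≤ : ∀ {y t} → 0# ≤ y → 0# ≤ t → y * y ≤ t * t → y ≤ t
  square-cancel-≤ {y} {t} 0≤y 0≤t p with (y + t) Order.≟ 0#
  ... | yes y+t≈0 = Order.trans (from-difference 0≤t y+t≈0) 0≤t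
  ... | no y+t≉0  = *-cancelˡ-≤ (+-nonneg 0≤y 0≤t) y+t≉0
    (≤-resp (sym (I.factor y t))
            (trans (+-congʳ (*-comm y t)) (trans (sym (I.factor t y)) (*-congʳ (+-comm t y))))
            (+-monoʳ-≤ (y * t) p))

  rearrangement : ∀ {a b p q} → a ≤ b → p ≤ q → a * q + b * p ≤ a * p + b * q
  rearrangement {a} {b} {p} {q} a≤b p≤q with difference a≤b | difference p≤q
  ... | u , 0≤u , a+u≈b | v , 0≤v , p+v≈q =
    ≤-resp (+-cong (*-congˡ p+v≈q) (*-congʳ a+u≈b)) (+-congˡ (*-cong a+u≈b p+v≈q))
           (from-difference (*-nonneg 0≤u 0≤v) (I.rearrange a p u v))

  abstract
    sqrt-exists : ∀ x → 0# ≤ x → ∃[ r ] 0# ≤ r × r * r ≈ x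
    sqrt-exists x 0≤x = s , 0≤s , Order.antisym ss≤x x≤ss
      where
      c : ℝ
      c = x + 1#

      0≤c : 0# ≤ c
      0≤c = +-nonneg 0≤x 0≤1

      x≤cc : x ≤ c * c
      x≤cc = from-difference (+-nonneg (*-nonneg 0≤x 0≤c) 0≤1)
        (trans (I.sum-swap x (x * c) 1#)
          (trans (+-congˡ (sym (*-identityˡ c))) (sym (distribʳ c x 1#))))

      P : ℝ → Set
      P y = 0# ≤ y × y * y ≤ x

      P0 : P 0#
      P0 = Order.refl , ≤-resp (sym (zeroˡ 0#)) refl 0≤x

      sup : ∃[ s ] (∀ y → P y → y ≤ s) × (∀ b → (∀ y → P y → y ≤ b) → s ≤ b)
      sup = supremum P (0# , P0)
              (c , λ y (0≤y , yy≤x) → square-cancel-≤ 0≤y 0≤c (Order.trans yy≤x x≤cc))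

      s : ℝ
      s = proj₁ sup

      0≤s : 0# ≤ s
      0≤s = proj₁ (proj₂ sup) 0# P0

      d : ℝ
      d = s + c

      0≤d : 0# ≤ d
      0≤d = +-nonneg 0≤s 0≤c

      d≉0 : d ≉ 0#
      d≉0 d≈0 = 1≉0 (Order.antisym 1≤0 0≤1)
        where
        1≤0 : 1# ≤ 0#
        1≤0 = from-difference (+-nonneg 0≤s 0≤x) (trans (I.sum-shift 1# s x) d≈0)

      -- t = (s c + x) / (s + c) lies between s and √x.
      t : ℝ
      t = proj₁ (inverse d d≉0) * (s * c + x)

      dt : d * t ≈ s * c + x
      dt = trans (sym (*-assoc _ _ _))
             (trans (*-congʳ (proj₂ (inverse d d≉0))) (*-identityˡ _))

      0≤t : 0# ≤ t
      0≤t = *-cancelˡ-≤ 0≤d d≉0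
        (≤-resp (sym (zeroʳ d)) (sym dt) (+-nonneg (*-nonneg 0≤s 0≤c) 0≤x))

      dt+ss : d * t + s * s ≈ d * s + x
      dt+ss = trans (+-congʳ dt) (I.d[t-s] s c x)

      ddtt : d * (d * (t * t)) ≈ (s * c * x + s * c * x) + (s * s * (c * c) + x * x)
      ddtt = trans (I.d²t² d t) (trans (*-cong dt dt) (I.[sc+x]² s c x))

      cancel-dd : ∀ {y z} → d * (d * y) ≤ d * (d * z) → y ≤ z
      cancel-dd = *-cancelˡ-≤ 0≤d d≉0 ∘ *-cancelˡ-≤ 0≤d d≉0

      ss≤x⇒x≤ss : s * s ≤ x → x ≤ s * s
      ss≤x⇒x≤ss p = +-cancelˡ-≤ (d * s)
        (≤-resp (trans (+-comm _ _) dt+ss) (+-comm _ _)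
          (+-monoʳ-≤ (s * s) (*-monoʳ-≤ 0≤d t≤s)))
        where
        tt≤x : t * t ≤ x
        tt≤x = cancel-dd (≤-resp (sym ddtt) (sym (I.d²x s c x))
          (+-monoʳ-≤ (s * c * x + s * c * x) (rearrangement p x≤cc)))
        t≤s : t ≤ s
        t≤s = proj₁ (proj₂ sup) t (0≤t , tt≤x)

      x≤ss⇒ss≤x : x ≤ s * s → s * s ≤ x
      x≤ss⇒ss≤x p = +-cancelˡ-≤ (d * s)
        (≤-resp (+-comm _ _) (trans (+-comm _ _) dt+ss)
          (+-monoʳ-≤ (s * s) (*-monoʳ-≤ 0≤d s≤t)))
        where
        x≤tt : x ≤ t * t
        x≤tt = cancel-dd (≤-resp (sym (I.d²x s c x)) (sym ddtt)
          (+-monoʳ-≤ (s * c * x + s * c * x)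
            (≤-resp (+-comm _ _) (+-comm _ _) (rearrangement p x≤cc))))
        s≤t : s ≤ t
        s≤t = proj₂ (proj₂ sup) t
          (λ y (0≤y , yy≤x) → square-cancel-≤ 0≤y 0≤t (Order.trans yy≤x x≤tt))

      ss≤x : s * s ≤ x
      ss≤x = [ id , x≤ss⇒ss≤x ]′ (Order.total (s * s) x)

      x≤ss : x ≤ s * s
      x≤ss = [ ss≤x⇒x≤ss , id ]′ (Order.total (s * s) x)

  -- The value at negative numbers is arbitrary.
  sqrt : ℝ → ℝ
  sqrt x with 0# Order.≤? x
  ... | yes 0≤x = proj₁ (sqrt-exists x 0≤x)
  ... | no _    = 0#

------------------------------------------------------------------------
-- Graphs

-- Exhaustive search over the lists of bounded length.

ofLength? : ∀ {n} {P : List (Fin n) → Set} → Decidable P →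
            ∀ k → Dec (∃[ xs ] length xs ≡ k × P xs)
ofLength? P? zero = map′ (λ p → [] , ≡.refl , p) (λ { ([] , _ , p) → p }) (P? [])
ofLength? P? (suc k) =
  map′ (λ { (x , xs , e , p) → x ∷ xs , ≡.cong suc e , p })
       (λ { (x ∷ xs , e , p) → x , xs , ℕ.suc-injective e , p })
       (any? (λ x → ofLength? (P? ∘ (x ∷_)) k))

unique-lookup : ∀ {n} {xs : List (Fin n)} → Unique xs →
                ∀ {i j} → lookup xs i ≡ lookup xs j → i ≡ j
unique-lookup (_ ∷ _)  {zero}  {zero}  _ = ≡.refl
unique-lookup (d ∷ _)  {zero}  {suc j} e = contradiction e (All.lookup d (∈-lookup j))
unique-lookup (d ∷ _)  {suc i} {zero}  e =
  contradiction (≡.sym e) (All.lookup d (∈-lookup i))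
unique-lookup (_ ∷ u)  {suc i} {suc j} e = ≡.cong suc (unique-lookup u e)

unique-length : ∀ {n} {xs : List (Fin n)} → Unique xs → length xs ℕ.≤ n
unique-length u = injective⇒≤ (unique-lookup u)

search? : ∀ {n} {P : List (Fin n) → Set} → Decidable P →
          (∀ {xs} → P xs → Unique xs) → Dec (∃ P)
search? {n} P? uniq =
  map′ (λ { (_ , _ , xs , _ , p) → xs , p })
       (λ { (xs , p) → length xs , s≤s (unique-length (uniq p)) , xs , ≡.refl , p })
       (ℕ.anyUpTo? (ofLength? P?) (suc n))

-- A finite oriented graph on the vertices Fin n with edges labelled by Fin m.
record OrientedGraph (n m : ℕ) : Set where
  field
    tail head : Fin m → Fin n

  Joins : Fin m → Fin n → Fin n → Set
  Joins k i j = (tail k ≡ i × head k ≡ j) ⊎ (tail k ≡ j × head k ≡ i)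

  field
    loopless : ∀ {k i} → ¬ Joins k i i
    simple   : ∀ {k l i j} → Joins k i j → Joins l i j → k ≡ l

  joins? : ∀ k i j → Dec (Joins k i j)
  joins? k i j = (tail k ≟ i ×-dec head k ≟ j) ⊎-dec (tail k ≟ j ×-dec head k ≟ i)

subsets : ∀ m → List (Subset m)
subsets zero    = Vec.[] ∷ []
subsets (suc m) =
  List.map (inside Vec.∷_) (subsets m) ++ List.map (outside Vec.∷_) (subsets m)

edges : ∀ {m} → Subset m → List (Fin m)
edges {m} S = filter (_∈? S) (allFin m)

-- A set S of edge labels stands for the spanning subgraph (V(G), S); the graph
-- itself is S = ⊤.  Walks and cycles live in the underlying undirected graph
-- and are given by their lists of vertices.
module _ {n m : ℕ} (G : OrientedGraph n m) where
  open OrientedGraph G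

  Adjacent : Subset m → Fin n → Fin n → Set
  Adjacent S i j = ∃[ k ] k ∈ S × Joins k i j

  adjacent? : ∀ S i j → Dec (Adjacent S i j)
  adjacent? S i j = any? (λ k → (k ∈? S) ×-dec joins? k i j)

  IsPath : Subset m → Fin n → Fin n → List (Fin n) → Set
  IsPath S i j γ =
    Unique γ × Linked (Adjacent S) γ × List.head γ ≡ just i × List.last γ ≡ just j

  isPath? : ∀ S i j → Decidable (IsPath S i j)
  isPath? S i j γ = DecUnique.unique? _≟_ γ ×-dec linked? (adjacent? S) γ ×-dec
    ≡-dec _≟_ (List.head γ) (just i) ×-dec ≡-dec _≟_ (List.last γ) (just j)

  path? : ∀ S i j → Dec (∃ (IsPath S i j))
  path? S i j = search? (isPath? S i j) proj₁

  Connected : Subset m → Set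
  Connected S = ∀ i j → ∃ (IsPath S i j)

  connected? : Decidable Connected
  connected? S = all? (λ i → all? (λ j → path? S i j))

  closedWalk : List (Fin n) → List (Fin n)
  closedWalk []      = []
  closedWalk (i ∷ c) = (i ∷ c) ∷ʳ i

  -- The vertices of a cycle are listed once each, so that length c is the
  -- length of the cycle.
  IsCycle : Subset m → List (Fin n) → Set
  IsCycle S c = Unique c × 3 ℕ.≤ length c × Linked (Adjacent S) (closedWalk c)

  isCycle? : ∀ S → Decidable (IsCycle S)
  isCycle? S c =
    DecUnique.unique? _≟_ c ×-dec 3 ℕ.≤? length c ×-dec linked? (adjacent? S) (closedWalk c)

  IsSpanningTree : Subset m → Set
  IsSpanningTree S = Connected S × ¬ ∃ (IsCycle S)

  isSpanningTree? : Decidable IsSpanningTree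
  isSpanningTree? S = connected? S ×-dec ¬? (search? (isCycle? S) proj₁)

  spanningTrees : List (Subset m)
  spanningTrees = filter isSpanningTree? (subsets m)

  spanningTreesThrough : Fin m → List (Subset m)
  spanningTreesThrough k = filter (k ∈?_) spanningTrees

  -- The path from i to j if there is one; unique if S is a spanning tree.
  path : Subset m → Fin n → Fin n → List (Fin n)
  path S i j with path? S i j
  ... | yes (γ , _) = γ
  ... | no _        = []

  pathOfLength? : ∀ S i j ℓ → Dec (∃[ γ ] length γ ≡ suc ℓ × IsPath S i j γ)
  pathOfLength? S i j ℓ = ofLength? (isPath? S i j) (suc ℓ)

  -- The least ℓ such that there is a path with ℓ edges from i to j: the number
  -- of initial ℓ = 0, 1, 2, … for which there is none.  (It is n if i and j lie
  -- in different components.)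
  distance : Subset m → Fin n → Fin n → ℕ
  distance S i j = length (takeWhile (¬? ∘ pathOfLength? S i j) (upTo n))

  edgeDistance : Subset m → Fin m → Fin n → ℕ
  edgeDistance S k j = distance S (tail k) j ⊓ distance S (head k) j

  componentSize : Subset m → Fin n → ℕ
  componentSize S i = length (filter (path? S i) (allFin n))

------------------------------------------------------------------------
-- Complex numbers, matrices and weighted graphs

module Complex (ℛ : Reals) where
  private module ℝ = Reals ℛ
  open ℝ using (ℝ)

  infix 3 _+i_
  record ℂ : Set where
    constructor _+i_
    field
      re im : ℝ
  open ℂ public

  ℂ-rawRing : RawRing 0ℓ 0ℓ
  ℂ-rawRing = record
    { Carrier = ℂ
    ; _≈_     = λ z z′ → (re z ℝ.≈ re z′) × (im z ℝ.≈ im z′)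
    ; _+_     = λ z z′ → (re z ℝ.+ re z′) +i (im z ℝ.+ im z′)
    ; _*_     = λ z z′ → ((re z ℝ.* re z′) ℝ.- (im z ℝ.* im z′))
                      +i ((re z ℝ.* im z′) ℝ.+ (im z ℝ.* re z′))
    ; -_      = λ z → (ℝ.- re z) +i (ℝ.- im z)
    ; 0#      = ℝ.0# +i ℝ.0#
    ; 1#      = ℝ.1# +i ℝ.0#
    }

  open RawRing ℂ-rawRing public using (_≈_; _≉_; _+_; _*_; -_; 0#; 1#)
  open RawSemiringDefinitions (RawRing.rawSemiring ℂ-rawRing) public
    using (sum; product; _^_)
    renaming (_×_ to _×ₙ_)

  ↑ : ℝ → ℂ
  ↑ x = x +i ℝ.0#

  conj : ℂ → ℂ
  conj z = re z +i (ℝ.- im z)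

  normSq : ℂ → ℝ
  normSq z = (re z ℝ.* re z) ℝ.+ (im z ℝ.* im z)

  ∣_∣ : ℂ → ℂ
  ∣ z ∣ = ↑ (ℝ.sqrt (normSq z))

  infix 8 _⁻¹
  _⁻¹ : ℂ → ℂ
  z ⁻¹ = (re z ℝ.* normSq z ℝ.⁻¹) +i ((ℝ.- im z) ℝ.* normSq z ℝ.⁻¹)

  infixl 7 _/_
  _/_ : ℂ → ℂ → ℂ
  z / z′ = z * z′ ⁻¹

  ℝ⁺ ℝ⁻ : ℂ → Set
  ℝ⁺ z = (ℝ.0# ℝ.< re z) × (im z ℝ.≈ ℝ.0#)
  ℝ⁻ z = (re z ℝ.< ℝ.0#) × (im z ℝ.≈ ℝ.0#)

  half : ℝ → ℝ
  half x = x ℝ.* (ℝ.1# ℝ.+ ℝ.1#) ℝ.⁻¹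

  sign : ℝ → ℝ
  sign y with ℝ.0# ℝ.Order.≤? y
  ... | yes _ = ℝ.1#
  ... | no _  = ℝ.- ℝ.1#

  -- Principal square root: √((|z| + re z)/2) ± i √((|z| − re z)/2), with the
  -- sign + for im z ≥ 0 and − for im z < 0.
  √ : ℂ → ℂ
  √ z = ℝ.sqrt (half (re ∣ z ∣ ℝ.+ re z)) +i
        (sign (im z) ℝ.* ℝ.sqrt (half (re ∣ z ∣ ℝ.- re z)))

  ∑-syntax : ∀ {A : Set} → List A → (A → ℂ) → ℂ
  ∑-syntax xs f = sum (f ∘ lookup xs)

  infix 5 ∑-syntax
  syntax ∑-syntax xs (λ x → e) = ∑[ x ∈ xs ] e

  Matrix : ℕ → ℕ → Set
  Matrix r c = Fin r → Fin c → ℂ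

  infix 4 _≋_
  _≋_ : ∀ {r c} → Matrix r c → Matrix r c → Set
  M ≋ N = ∀ i j → M i j ≈ N i j

  infixl 7 _·_
  _·_ : ∀ {r s c} → Matrix r s → Matrix s c → Matrix r c
  (M · N) i j = sum (λ l → M i l * N l j)

  infix 8 _ᴴ
  _ᴴ : ∀ {r c} → Matrix r c → Matrix c r
  (M ᴴ) i j = conj (M j i)

  -- The four Penrose equations, which determine X.
  record IsMoorePenroseInverse {r c} (M : Matrix r c) (X : Matrix c r) : Set where
    field
      MXM≋M        : M · X · M ≋ M
      XMX≋X        : X · M · X ≋ X
      MX-hermitian : (M · X) ᴴ ≋ M · X
      XM-hermitian : (X · M) ᴴ ≋ X · M

  module _ {n m : ℕ} (G : OrientedGraph n m) (w : Fin m → ℂ) where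
    open OrientedGraph G

    adjacency : Matrix n n
    adjacency i j with any? (λ k → tail k ≟ i ×-dec head k ≟ j)
    ... | yes (k , _) = w k
    ... | no _ with any? (λ k → tail k ≟ j ×-dec head k ≟ i)
    ...   | yes (k , _) = conj (w k)
    ...   | no _        = 0#

    degree : Matrix n n
    degree i j with i ≟ j
    ... | yes _ = ∑[ l ∈ filter (λ l → ¬? (l ≟ i)) (allFin n) ] ∣ adjacency i l ∣
    ... | no _  = 0#

    signlessLaplacian : Matrix n n
    signlessLaplacian i j = degree i j + adjacency i j

    incidenceEntry : Fin n → Fin m → ℂ
    incidenceEntry i k with i ≟ tail k | i ≟ head k
    ... | yes _ | _     = √ (w k)
    ... | no _  | yes _ = √ (conj (w k))
    ... | no _  | no _  = 0#

    -- The columns of the incidence matrix of a subgraph are numbered by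
    -- position in the list of its edges.
    incidence : (S : Subset m) → Matrix n (length (edges S))
    incidence S i r = incidenceEntry i (lookup (edges S) r)

    wt : List (Fin n) → ℂ
    wt []          = 1#
    wt (i ∷ [])    = 1#
    wt (i ∷ j ∷ γ) = adjacency i j * wt (j ∷ γ)

    W : Subset m → ℂ
    W S = product (w ∘ lookup (edges S))

    -- The explicit expression for (N_T⁺)ₖⱼ, for a spanning tree T and an edge
    -- k of T; the two cases are j ∈ T_t(e_k) and j ∈ T_h(e_k).
    treeInverse : Subset m → Fin m → Fin n → ℂ
    treeInverse T k j with path? G (T - k) (tail k) j
    ... | yes _ = (- 1#) ^ edgeDistance G T k j / (n ×ₙ 1#)
      * ((componentSize G (T - k) (head k) ×ₙ 1#) / √ (w k))
      * (∣ wt (path G T j (tail k)) ∣ / wt (path G T j (tail k)))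
    ... | no _  = (- 1#) ^ edgeDistance G T k j / (n ×ₙ 1#)
      * ((componentSize G (T - k) (tail k) ×ₙ 1#) / √ (conj (w k)))
      * (∣ wt (path G T j (head k)) ∣ / wt (path G T j (head k)))

{-# OPTIONS --safe #-}

-- The cycle condition says that, up to sign, the edge weights are a potential
-- difference: there are units x_v with w_uv = −|w_uv| x_u x̄_v on every edge.
-- Such an x exists on a spanning tree T, and an edge outside T closes a cycle
-- with a path of T.  Conjugating by diag(x) turns Q into the ordinary Laplacian
-- with weights |w_uv|, and the entries of (N_T)⁺ into the currents y_T(k, j)
-- through the edges k of T when a unit current enters at j and leaves evenly
-- through all vertices.
--
-- Let Y be the mean of the y_T with weights |W_T|.  Kirchhoff's current law holds
-- for each T, hence for Y.  Deleting k from the trees through k, and collecting the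
-- terms by the resulting forest F with two components, exhibits Y(k, j) as |w_k|
-- times the potential difference along k of a symmetric potential Z; this is
-- Kirchhoff's voltage law.  The two laws are the Penrose equations for the mean M
-- of the (N_T)⁺ as an inverse of N, and (N N*)⁺ = M* M.
module Submission where

open import Defs
open import Algebra.Bundles using (CommutativeMonoid; CommutativeRing; Semiring)
import Algebra.Definitions.RawSemiring as RawSemiringDefinitions
import Algebra.Properties.AbelianGroup as GroupProperties
import Algebra.Properties.CommutativeMonoid.Sum
import Algebra.Properties.CommutativeSemigroup as SemigroupProperties
import Algebra.Properties.Ring as RingProperties
import Algebra.Properties.Semiring.Mult as Multiples
import Algebra.Properties.Semiring.Sum as SemiringSum
import Algebra.Solver.Ring
open import Algebra.Solver.Ring.AlmostCommutativeRing
  using (fromCommutativeRing; _-Raw-AlmostCommutative⟶_)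
open import Data.Bool.Base using (if_then_else_; true; false)
open import Data.Empty using (⊥-elim)
open import Data.Fin.Base using (Fin; zero; suc)
open import Data.Fin.Properties using (_≟_; any?; suc-injective)
open import Data.Fin.Subset using (Subset; _∈_; _∉_; _⊆_; ⊤; inside; outside)
  renaming (_-_ to _∖_; ∣_∣ to card)
open import Data.Fin.Subset.Properties
  using (_∈?_; ∈⊤; ⊆-antisym; p─⊥≡p; x∈p∧x≢y⇒x∈p-y; x∈p⇒∣p-x∣<∣p∣)
import Data.Integer.Base as ℤ
import Data.Integer.Properties as ℤ
open import Data.List.Base as List
  using (List; []; _∷_; _++_; _∷ʳ_; length; lookup; filter; tabulate; allFin; takeWhile; applyUpTo)
import Data.List.Membership.DecPropositional as DecMembership
import Data.List.Membership.Propositional as List∈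
open import Data.List.Membership.Propositional.Properties
  using (∈-lookup; ∈-filter⁺; ∈-filter⁻; ∈-++⁺ˡ; ∈-++⁺ʳ; ∈-map⁺)
open import Data.List.Relation.Unary.All as All using (All; []; _∷_)
open import Data.List.Relation.Unary.All.Properties using (¬Any⇒All¬)
open import Data.List.Relation.Unary.AllPairs using ([]; _∷_)
open import Data.List.Relation.Unary.Any using (here; there; index)
open import Data.List.Relation.Unary.Any.Properties using (lookup-index)
open import Data.List.Relation.Unary.Linked using (Linked; []; [-]; _∷_)
import Data.List.Relation.Unary.Unique.Propositional.Properties as Unique
import Data.Maybe.Base as Maybe
open import Data.Maybe.Base using (just)
open import Data.Maybe.Properties using (just-injective)
open import Data.Nat.Base as ℕ using (ℕ; zero; suc; z≤n; s≤s)
open import Data.Nat.Divisibility using (_∣_; _∣0; ∣-refl; ∣m∣n⇒∣m+n; ∣m+n∣m⇒∣n; ∣1⇒≡1)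
import Data.Nat.Properties as ℕ
open import Data.Product.Base using (∃; ∃-syntax; _×_; _,_; proj₁; proj₂)
open import Data.Sign.Base as Sign using ()
open import Data.Sum.Base as Sum using (_⊎_; inj₁; inj₂; [_,_]′)
open import Data.Vec.Base using ([]; _∷_; _[_]≔_; here; there)
open import Data.Vec.Properties
  using ([]≔-updates; []≔-minimal; []=⇒lookup; lookup⇒[]=; lookup∘update′)
open import Function.Base using (_∘_; id)
open import Level using (0ℓ)
open import Relation.Binary.PropositionalEquality.Core as ≡ using (_≡_; _≢_)
import Relation.Binary.Reasoning.Setoid as SetoidReasoning
open import Relation.Nullary using (¬_; Dec; yes; no; does; contradiction; ¬?; map′; _×-dec_)
open import Relation.Nullary.Decidable.Core using (dec⇒maybe)
open import Relation.Unary using (Decidable)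

-- Why the unit current leaves evenly: after switching, the kernel of N* is spanned by x, so N M has
-- to be the projection I - x x*/n, and the net outflow at i for a source at j is δ_ij - 1/n.
-- Averaging over trees preserves this, so N M is the easy product.
--
-- The obstacle is that M N must be Hermitian: for an edge l outside T, the number y_T(k, tail l) -
-- y_T(k, head l) has no symmetry in k and l. The symmetry appears only after regrouping by F = T -
-- k, for two reasons. Whether an edge completes F to a tree depends only on its ends lying in
-- different components of F, so all edges see one family of forests. And the current in F + k is
-- the difference along k of a potential that depends on F alone and can be chosen symmetric in its
-- two vertices.
--
-- The sign (-1)^d is the 2-colouring of a tree. On a tree the minus sign of the potential
-- difference can be absorbed into the colours; around a cycle of length l it leaves the factor
-- (-1)^l, which is why odd and even cycles need opposite signs.

-- Adding and removing one edge label

infixl 6 _⊕_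
_⊕_ : ∀ {m} → Subset m → Fin m → Subset m
S ⊕ k = S [ k ]≔ inside

x∈p∖y⇒x≢y : ∀ {m} {p : Subset m} {x y} → x ∈ p ∖ y → x ≢ y
x∈p∖y⇒x≢y {p = _ ∷ p} {suc x} {suc .x} (there x∈) ≡.refl = x∈p∖y⇒x≢y {p = p} x∈ ≡.refl

x∈p∖y⇒x∈p : ∀ {m} {p : Subset m} {x y} → x ∈ p ∖ y → x ∈ p
x∈p∖y⇒x∈p {p = inside  ∷ p} {zero}  {suc y} here       = here
x∈p∖y⇒x∈p {p = _ ∷ p} {suc x} {zero}  (there x∈) = there (≡.subst (x ∈_) (p─⊥≡p p) x∈)
x∈p∖y⇒x∈p {p = s ∷ p} {suc x} {suc y} (there x∈) = there (x∈p∖y⇒x∈p x∈)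

∈-⊕ : ∀ {m} (S : Subset m) k → k ∈ S ⊕ k
∈-⊕ S k = []≔-updates S k

⊆-⊕ : ∀ {m} {S : Subset m} {k l} → l ∈ S → l ∈ S ⊕ k
⊆-⊕ {S = S} {k} {l} l∈S with l ≟ k
... | yes ≡.refl = ∈-⊕ S k
... | no l≢k   = []≔-minimal S l k l≢k l∈S

∈-⊕⁻ : ∀ {m} {S : Subset m} {k l} → l ≢ k → l ∈ S ⊕ k → l ∈ S
∈-⊕⁻ {S = S} {k} {l} l≢k l∈ =
  lookup⇒[]= l S (≡.trans (≡.sym (lookup∘update′ l≢k S inside)) ([]=⇒lookup l∈))

⊕-cancel : ∀ {m} {S : Subset m} {k} → k ∉ S → (S ⊕ k) ∖ k ≡ S
⊕-cancel k∉S = ⊆-antisym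
  (λ l∈ → ∈-⊕⁻ (x∈p∖y⇒x≢y l∈) (x∈p∖y⇒x∈p l∈))
  (λ l∈S → x∈p∧x≢y⇒x∈p-y (⊆-⊕ l∈S) (λ { ≡.refl → k∉S l∈S }))

-- `distance` counts the failures before the first success. The enumeration `f` is arbitrary because
-- the recursion continues with `f ∘ suc`; `distance-spec` takes `f = id`.
takeWhile-least : ∀ {P : ℕ → Set} (P? : Decidable P) f n {ℓ} → P (f ℓ) → ℓ ℕ.< n →
  P (f (length (takeWhile (¬? ∘ P?) (applyUpTo f n)))) ×
  length (takeWhile (¬? ∘ P?) (applyUpTo f n)) ℕ.≤ ℓ
takeWhile-least P? f (suc n) {ℓ} p ℓ<n with P? (f 0)
... | yes p₀ = p₀ , z≤n
takeWhile-least P? f (suc n) {zero}  p ℓ<n       | no ¬p₀ = contradiction p ¬p₀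
takeWhile-least P? f (suc n) {suc ℓ} p (s≤s ℓ<n) | no ¬p₀ with takeWhile-least P? (f ∘ suc) n p ℓ<n
... | q , d≤ℓ = q , s≤s d≤ℓ

-- Walks, paths and spanning trees

module Graph {n m : ℕ} (G : OrientedGraph n m) where
  open OrientedGraph G

  -- Walks may repeat vertices, unlike the paths of the statement, so they can be joined and
  -- reversed freely. The length is an index because distances and signs depend on it.
  data Walk (S : Subset m) : Fin n → Fin n → ℕ → Set where
    ε   : ∀ {i} → Walk S i i 0
    _◅_ : ∀ {i j k ℓ} → Adjacent G S i j → Walk S j k ℓ → Walk S i k (suc ℓ)

  Reach : Subset m → Fin n → Fin n → Set
  Reach S i j = ∃[ ℓ ] Walk S i j ℓ

  Joins-functional : ∀ {k i j a b} → Joins k i j → Joins k a b → (i ≡ a × j ≡ b) ⊎ (i ≡ b × j ≡ a)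
  Joins-functional (inj₁ (≡.refl , ≡.refl)) (inj₁ (≡.refl , ≡.refl)) = inj₁ (≡.refl , ≡.refl)
  Joins-functional (inj₁ (≡.refl , ≡.refl)) (inj₂ (≡.refl , ≡.refl)) = inj₂ (≡.refl , ≡.refl)
  Joins-functional (inj₂ (≡.refl , ≡.refl)) (inj₁ (≡.refl , ≡.refl)) = inj₂ (≡.refl , ≡.refl)
  Joins-functional (inj₂ (≡.refl , ≡.refl)) (inj₂ (≡.refl , ≡.refl)) = inj₁ (≡.refl , ≡.refl)

  joins-ends : ∀ k → Joins k (tail k) (head k)
  joins-ends k = inj₁ (≡.refl , ≡.refl)

  Adjacent-sym : ∀ {S i j} → Adjacent G S i j → Adjacent G S j i
  Adjacent-sym (k , k∈S , J) = k , k∈S , Sum.swap J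

  Reach-refl : ∀ {S i} → Reach S i i
  Reach-refl = 0 , ε

  cons : ∀ {S i j k} → Adjacent G S i j → Reach S j k → Reach S i k
  cons a (ℓ , w) = suc ℓ , a ◅ w

  Reach-trans : ∀ {S i j k} → Reach S i j → Reach S j k → Reach S i k
  Reach-trans (_ , ε)     r = r
  Reach-trans (_ , a ◅ w) r = cons a (Reach-trans (_ , w) r)

  Reach-sym : ∀ {S i j} → Reach S i j → Reach S j i
  Reach-sym (_ , ε)     = Reach-refl
  Reach-sym (_ , a ◅ w) = Reach-trans (Reach-sym (_ , w)) (cons (Adjacent-sym a) Reach-refl)

  Reach-mono : ∀ {S S′} → S ⊆ S′ → ∀ {i j} → Reach S i j → Reach S′ i j
  Reach-mono S⊆S′ (_ , ε)                   = Reach-refl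
  Reach-mono S⊆S′ (_ , (k , k∈S , J) ◅ w) = cons (k , S⊆S′ k∈S , J) (Reach-mono S⊆S′ (_ , w))

  Reach-edge : ∀ {S k i j} → k ∈ S → Joins k i j → Reach S i j
  Reach-edge k∈S J = cons (_ , k∈S , J) Reach-refl

  Reach-ends : ∀ {S k a b} → Joins k a b → Reach S a b → Reach S (tail k) (head k)
  Reach-ends (inj₁ (≡.refl , ≡.refl)) r = r
  Reach-ends (inj₂ (≡.refl , ≡.refl)) r = Reach-sym r

  linked⇒walk : ∀ {S i j γ ℓ} → Linked (Adjacent G S) γ → List.head γ ≡ just i →
                List.last γ ≡ just j → length γ ≡ suc ℓ → Walk S i j ℓ
  linked⇒walk [-]     ≡.refl ≡.refl ≡.refl = ε
  linked⇒walk (a ∷ l) ≡.refl p    ≡.refl = a ◅ linked⇒walk l ≡.refl p ≡.refl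

  path⇒walk : ∀ {S i j γ ℓ} → IsPath G S i j γ → length γ ≡ suc ℓ → Walk S i j ℓ
  path⇒walk (_ , l , h , t) = linked⇒walk l h t

  path-length : ∀ {S i j γ} → IsPath G S i j γ → ∃[ ℓ ] length γ ≡ suc ℓ
  path-length {γ = _ ∷ γ} _ = length γ , ≡.refl

  path⇒reach : ∀ {S i j} → ∃ (IsPath G S i j) → Reach S i j
  path⇒reach (_ , p) = _ , path⇒walk p (proj₂ (path-length p))

  PathOfLength≤ : Subset m → Fin n → Fin n → ℕ → Set
  PathOfLength≤ S i j ℓ = ∃[ ℓ′ ] ℓ′ ℕ.≤ ℓ × ∃[ γ ] length γ ≡ suc ℓ′ × IsPath G S i j γ

  suffix : ∀ {S i j k γ ℓ} → IsPath G S k j γ → length γ ≡ suc ℓ → i List∈.∈ γ → PathOfLength≤ S i j ℓ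
  suffix (u , l , ≡.refl , t) ≡.refl (here ≡.refl) = _ , ℕ.≤-refl , _ , ≡.refl , u , l , ≡.refl , t
  suffix {γ = _ ∷ _ ∷ _} (_ ∷ u , _ ∷ l , ≡.refl , t) ≡.refl (there i∈) with suffix (u , l , ≡.refl , t) ≡.refl i∈
  ... | ℓ′ , ℓ′≤ , p = ℓ′ , ℕ.m≤n⇒m≤1+n ℓ′≤ , p

  -- Loop erasure: if the new first vertex already lies on the path, the suffix starting there is
  -- taken instead. Because the length does not grow, a shortest path is also a shortest walk.
  walk⇒path : ∀ {S i j ℓ} → Walk S i j ℓ → PathOfLength≤ S i j ℓ
  walk⇒path {i = i} ε = 0 , z≤n , i ∷ [] , ≡.refl , [] ∷ [] , [-] , ≡.refl , ≡.refl
  walk⇒path {i = i} (a ◅ w) with walk⇒path w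
  ... | ℓ′ , ℓ′≤ , γ , e , p with DecMembership._∈?_ _≟_ i γ
  ...   | yes i∈γ with suffix p e i∈γ
  ...     | ℓ″ , ℓ″≤ , q = ℓ″ , ℕ.m≤n⇒m≤1+n (ℕ.≤-trans ℓ″≤ ℓ′≤) , q
  walk⇒path {i = i} (a ◅ w) | ℓ′ , ℓ′≤ , γ@(_ ∷ _) , e , u , l , ≡.refl , t | no i∉γ =
    suc ℓ′ , s≤s ℓ′≤ , i ∷ γ , ≡.cong suc e , ¬Any⇒All¬ γ i∉γ ∷ u , a ∷ l , ≡.refl , t

  reach⇒path : ∀ {S i j} → Reach S i j → ∃ (IsPath G S i j)
  reach⇒path (_ , w) with walk⇒path w
  ... | _ , _ , γ , _ , p = γ , p

  reach? : ∀ S i j → Dec (Reach S i j)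
  reach? S i j = map′ path⇒reach reach⇒path (path? G S i j)

  path-isPath : ∀ {S i j} → Reach S i j → IsPath G S i j (path G S i j)
  path-isPath {S} {i} {j} r with path? G S i j
  ... | yes (_ , p) = p
  ... | no ¬p       = contradiction (reach⇒path r) ¬p

  distance-spec : ∀ {S i j ℓ} → Walk S i j ℓ → Walk S i j (distance G S i j) × distance G S i j ℕ.≤ ℓ
  distance-spec {S} {i} {j} w with walk⇒path w
  ... | ℓ′ , ℓ′≤ℓ , γ , e , p
      -- The search covers the lengths below `n`; a path without repeated vertices has at most `n`
      -- vertices, hence fewer than `n` edges.
      with takeWhile-least (pathOfLength? G S i j) id n (γ , e , p)
             (≡.subst (ℕ._≤ n) e (unique-length (proj₁ p)))
  ...   | (γ′ , e′ , p′) , d≤ℓ′ = path⇒walk p′ e′ , ℕ.≤-trans d≤ℓ′ ℓ′≤ℓ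

  -- Spanning trees are the minimal connected edge sets.
  record Tree (T : Subset m) : Set where
    constructor tree
    field
      connected : ∀ i j → Reach T i j
      bridge    : ∀ {k} → k ∈ T → ¬ Reach (T ∖ k) (tail k) (head k)

  linked-∷ʳ : ∀ {R : Fin n → Fin n → Set} {i j} γ → Linked R γ → List.last γ ≡ just j → R j i →
              Linked R (γ ∷ʳ i)
  linked-∷ʳ (_ ∷ [])    [-]     ≡.refl r = r ∷ [-]
  linked-∷ʳ (_ ∷ _ ∷ γ) (s ∷ l) t    r = s ∷ linked-∷ʳ (_ ∷ γ) l t r

  linked-mono : ∀ {S S′ γ} → S ⊆ S′ → Linked (Adjacent G S) γ → Linked (Adjacent G S′) γ
  linked-mono S⊆S′ []      = []
  linked-mono S⊆S′ [-]     = [-]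
  linked-mono S⊆S′ ((k , k∈S , J) ∷ l) = (k , S⊆S′ k∈S , J) ∷ linked-mono S⊆S′ l

  -- A path with one vertex would make `k` a loop; one with two vertices would use an edge parallel
  -- to `k`, which by simplicity is `k` itself and so is not in `S`. Hence the path has at least the
  -- three vertices that `IsCycle` demands.
  close-path : ∀ {S S′ k γ} → S ⊆ S′ → k ∉ S → k ∈ S′ → IsPath G S (tail k) (head k) γ → IsCycle G S′ γ
  close-path {γ = _ ∷ []} S⊆S′ k∉S k∈S′ (u , l , ≡.refl , t) =
    ⊥-elim (loopless (inj₁ (≡.refl , ≡.sym (just-injective t))))
  close-path {γ = _ ∷ _ ∷ []} S⊆S′ k∉S k∈S′ (u , (e , e∈S , J) ∷ l , ≡.refl , ≡.refl) =
    contradiction (≡.subst (_∈ _) (simple J (joins-ends _)) e∈S) k∉S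
  close-path {k = k} {γ = γ@(_ ∷ _ ∷ _ ∷ _)} S⊆S′ k∉S k∈S′ (u , l , ≡.refl , t) =
    u , s≤s (s≤s (s≤s z≤n)) ,
    linked-∷ʳ γ (linked-mono S⊆S′ l) t (k , k∈S′ , inj₂ (≡.refl , ≡.refl))

  spanningTree⇒tree : ∀ {T} → IsSpanningTree G T → Tree T
  spanningTree⇒tree (conn , acyclic) = tree
    (λ i j → path⇒reach (conn i j))
    (λ k∈T r → acyclic (_ , close-path x∈p∖y⇒x∈p (λ k∈ → x∈p∖y⇒x≢y k∈ ≡.refl) k∈T
                                (proj₂ (reach⇒path r))))

  -- Every step starts at a vertex that is neither end of `e`, so its edge is not `e`.
  avoiding : ∀ {T e i j} → Joins e i j → ∀ k c → All (λ a → a ≢ i × a ≢ j) (k ∷ c) →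
             Linked (Adjacent G T) ((k ∷ c) ∷ʳ i) → Reach (T ∖ e) k i
  avoiding {T} {e} {i} {j} J k c (k≢ ∷ c≢) l = go c c≢ l
    where
    step : ∀ {k k′} → k ≢ i × k ≢ j → Adjacent G T k k′ → Adjacent G (T ∖ e) k k′
    step (k≢i , k≢j) (f , f∈T , J′) =
      f , x∈p∧x≢y⇒x∈p-y f∈T
            (λ { ≡.refl → [ k≢i ∘ proj₁ , k≢j ∘ proj₁ ]′ (Joins-functional J′ J) }) , J′
    go : ∀ c → All (λ a → a ≢ i × a ≢ j) c → Linked (Adjacent G T) ((k ∷ c) ∷ʳ i) → Reach (T ∖ e) k i
    go []       _          (a ∷ [-]) = cons (step k≢ a) Reach-refl
    go (k′ ∷ c) (p ∷ ps)   (a ∷ l)   = cons (step k≢ a) (avoiding J k′ c (p ∷ ps) l)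

  -- A cycle `i`, `j`, `k`, ... without its first edge `e` still joins the ends of `e`: its second
  -- edge goes from `j` to `k`, and `avoiding` returns to `i`. So `e` would not be a bridge.
  tree⇒spanningTree : ∀ {T} → Tree T → IsSpanningTree G T
  tree⇒spanningTree {T} (tree conn bridge) = (λ i j → reach⇒path (conn i j)) , acyclic
    where
    acyclic : ¬ ∃ (IsCycle G T)
    acyclic ([] , _ , () , _)
    acyclic (_ ∷ [] , _ , s≤s () , _)
    acyclic (_ ∷ _ ∷ [] , _ , s≤s (s≤s ()) , _)
    acyclic (i ∷ j ∷ k ∷ c , ((i≢j ∷ i≢) ∷ j≢ ∷ _) , _ , (e , e∈T , J) ∷ (f , f∈T , J′) ∷ l)
      with All.zipWith (λ { (p , q) → p ∘ ≡.sym , q ∘ ≡.sym }) (i≢ , j≢)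
    ... | ks@((k≢i , k≢j) ∷ _) = bridge e∈T
      (Reach-ends (Sum.swap J) (cons
        (f , x∈p∧x≢y⇒x∈p-y f∈T
               (λ { ≡.refl → [ k≢j ∘ proj₂ , k≢i ∘ proj₂ ]′ (Joins-functional J′ J) }) , J′)
        (avoiding J k c ks l)))

  -- The walk is shortened until it crosses `l` at most once: two crossings in the same direction
  -- lose the stretch between them, and two in opposite directions cancel.
  Reach-⊕⁻ : ∀ {S l i j} → Reach (S ⊕ l) i j →
             Reach S i j ⊎ (∃[ a ] ∃[ b ] Joins l a b × Reach S i a × Reach S b j)
  Reach-⊕⁻ (_ , ε) = inj₁ Reach-refl
  Reach-⊕⁻ {l = l} (_ , (e , e∈ , J) ◅ w) with e ≟ l | Reach-⊕⁻ (_ , w)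
  ... | no e≢l   | inj₁ r                = inj₁ (cons (e , ∈-⊕⁻ e≢l e∈ , J) r)
  ... | no e≢l   | inj₂ (a , b , K , r , s) = inj₂ (a , b , K , cons (e , ∈-⊕⁻ e≢l e∈ , J) r , s)
  ... | yes ≡.refl | inj₁ r                = inj₂ (_ , _ , J , Reach-refl , r)
  ... | yes ≡.refl | inj₂ (a , b , K , r , s) with Joins-functional J K
  ...   | inj₁ (≡.refl , ≡.refl) = inj₂ (_ , _ , J , Reach-refl , s)
  ...   | inj₂ (≡.refl , ≡.refl) = inj₁ s

  -- Removing an edge of a tree: components and distances

  module _ {T : Subset m} (isTree : Tree T) where
    open Tree isTree

    component : ∀ {k} → k ∈ T → ∀ v → Reach (T ∖ k) (tail k) v ⊎ Reach (T ∖ k) (head k) v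
    component {k} k∈T v with Reach-⊕⁻ {S = T ∖ k} {l = k} (Reach-mono T⊆ (connected (tail k) v))
      where
      T⊆ : T ⊆ (T ∖ k) ⊕ k
      T⊆ {l} l∈T with l ≟ k
      ... | yes ≡.refl = ∈-⊕ _ k
      ... | no l≢k   = ⊆-⊕ (x∈p∧x≢y⇒x∈p-y l∈T l≢k)
    ... | inj₁ r = inj₁ r
    ... | inj₂ (_ , _ , inj₁ (_ , ≡.refl) , _ , r) = inj₂ r
    ... | inj₂ (_ , _ , inj₂ (≡.refl , _) , _ , r) = inj₁ r

    -- The walk starts on the side of `b` and ends on the side of `a`, so it crosses `k` from `b` to
    -- `a`. What remains after the first crossing starts at `a` and is strictly shorter.
    shortcut : ∀ {k a b} → Joins k a b → ¬ Reach (T ∖ k) a b → ∀ {v j ℓ} → Walk T v j ℓ →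
               Reach (T ∖ k) b v → Reach (T ∖ k) a j → ∃[ ℓ′ ] ℓ′ ℕ.< ℓ × Walk T a j ℓ′
    shortcut J a≁b ε r s = contradiction (Reach-trans s (Reach-sym r)) a≁b
    shortcut {k} J a≁b ((e , e∈T , K) ◅ w) r s with e ≟ k
    ... | no e≢k with shortcut J a≁b w
                        (Reach-trans r (Reach-edge (x∈p∧x≢y⇒x∈p-y e∈T e≢k) K)) s
    ...   | ℓ′ , ℓ′< , w′ = ℓ′ , ℕ.m<n⇒m<1+n ℓ′< , w′
    shortcut J a≁b ((e , e∈T , K) ◅ w) r s | yes ≡.refl with Joins-functional K J
    ...   | inj₁ (≡.refl , ≡.refl) = contradiction (Reach-sym r) a≁b
    ...   | inj₂ (≡.refl , ≡.refl) = _ , ℕ.≤-refl , w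

    distance-< : ∀ {k a b j} → Joins k a b → ¬ Reach (T ∖ k) a b → Reach (T ∖ k) a j →
                 distance G T a j ℕ.< distance G T b j
    distance-< {k} {a} {b} {j} J a≁b r
      with shortcut J a≁b (proj₁ (distance-spec (proj₂ (connected b j)))) Reach-refl r
    ... | ℓ′ , ℓ′< , w = ℕ.≤-<-trans (proj₂ (distance-spec w)) ℓ′<

    -- The minimum in `edgeDistance` is attained at the end of `k` on the side of `j`. The
    -- conclusion is a walk because only the sign belonging to this distance matters, and
    -- `sign-walk` reads it off any walk.
    edgeDistance-tail : ∀ {k j} → k ∈ T → Reach (T ∖ k) (tail k) j →
                        Walk T (tail k) j (edgeDistance G T k j)
    edgeDistance-tail {k} {j} k∈T r =
      ≡.subst (Walk T (tail k) j)
        (≡.sym (ℕ.m≤n⇒m⊓n≡m (ℕ.<⇒≤ (distance-< (joins-ends k) (bridge k∈T) r))))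
        (proj₁ (distance-spec (proj₂ (connected (tail k) j))))

    edgeDistance-head : ∀ {k j} → k ∈ T → Reach (T ∖ k) (head k) j →
                        Walk T (head k) j (edgeDistance G T k j)
    edgeDistance-head {k} {j} k∈T r =
      ≡.subst (Walk T (head k) j)
        (≡.sym (ℕ.m≥n⇒m⊓n≡n (ℕ.<⇒≤ (distance-< (inj₂ (≡.refl , ≡.refl)) (bridge k∈T ∘ Reach-sym) r))))
        (proj₁ (distance-spec (proj₂ (connected (head k) j))))

  -- Basis exchange. `F` has exactly two components, and the ends of `l` lie in different ones, so
  -- `l` reconnects them just as `k` does. This makes being a forest independent of the edge that
  -- witnesses it.
  exchange : ∀ {F k l} → k ∉ F → Tree (F ⊕ k) → ¬ Reach F (tail l) (head l) →
             l ∉ F × Tree (F ⊕ l)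
  exchange {F} {k} {l} k∉F t@(tree conn bridge) t≁h =
    (λ l∈F → t≁h (Reach-edge l∈F (joins-ends l))) ,
    tree (λ i j → Reach-trans (Reach-sym (hub i)) (hub j)) bridge′
    where
    component′ : ∀ v → Reach F (tail k) v ⊎ Reach F (head k) v
    component′ = ≡.subst (λ S → ∀ v → Reach S (tail k) v ⊎ Reach S (head k) v)
                       (⊕-cancel k∉F) (component t (∈-⊕ F k))
    near : ∀ v → Reach F (tail l) v ⊎ Reach F (head l) v
    near v with component′ (tail l) | component′ (head l) | component′ v
    ... | inj₁ p | inj₁ q | _      = contradiction (Reach-trans (Reach-sym p) q) t≁h
    ... | inj₂ p | inj₂ q | _      = contradiction (Reach-trans (Reach-sym p) q) t≁h
    ... | inj₁ p | inj₂ q | inj₁ r = inj₁ (Reach-trans (Reach-sym p) r)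
    ... | inj₁ p | inj₂ q | inj₂ r = inj₂ (Reach-trans (Reach-sym q) r)
    ... | inj₂ p | inj₁ q | inj₁ r = inj₂ (Reach-trans (Reach-sym q) r)
    ... | inj₂ p | inj₁ q | inj₂ r = inj₁ (Reach-trans (Reach-sym p) r)
    hub : ∀ v → Reach (F ⊕ l) (tail l) v
    hub v with near v
    ... | inj₁ r = Reach-mono ⊆-⊕ r
    ... | inj₂ r = cons (l , ∈-⊕ F l , joins-ends l) (Reach-mono ⊆-⊕ r)
    bridge′ : ∀ {e} → e ∈ F ⊕ l → ¬ Reach ((F ⊕ l) ∖ e) (tail e) (head e)
    bridge′ {e} e∈ r with e ≟ l
    ... | yes ≡.refl = t≁h (Reach-mono (λ f∈ → ∈-⊕⁻ (x∈p∖y⇒x≢y f∈) (x∈p∖y⇒x∈p f∈)) r)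
    -- A detour around `e` that avoids `l` contradicts that `e` is a bridge of `F ⊕ k`. A detour
    -- through `l` consists of two pieces in `F`, and together with `e` they connect the ends of `l`
    -- within `F`.
    ... | no e≢l with Reach-⊕⁻ (Reach-mono F+l-e⊆ r)
      where
      F+l-e⊆ : (F ⊕ l) ∖ e ⊆ (F ∖ e) ⊕ l
      F+l-e⊆ {f} f∈ with f ≟ l
      ... | yes ≡.refl = ∈-⊕ _ l
      ... | no f≢l   = ⊆-⊕ (x∈p∧x≢y⇒x∈p-y (∈-⊕⁻ f≢l (x∈p∖y⇒x∈p f∈)) (x∈p∖y⇒x≢y f∈))
    ...   | inj₁ s = bridge (⊆-⊕ (∈-⊕⁻ e≢l e∈))
      (Reach-mono (λ f∈ → x∈p∧x≢y⇒x∈p-y (⊆-⊕ (x∈p∖y⇒x∈p f∈)) (x∈p∖y⇒x≢y f∈)) s)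
    ...   | inj₂ (_ , _ , J , s , s′) = t≁h (Reach-ends J
      (Reach-trans (Reach-sym (Reach-mono x∈p∖y⇒x∈p s))
        (cons (e , ∈-⊕⁻ e≢l e∈ , joins-ends e)
          (Reach-sym (Reach-mono x∈p∖y⇒x∈p s′)))))

  -- Edges whose ends stay connected without them are deleted until none is left; `N` bounds the
  -- number of edges, for termination. The tree serves twice: to construct `x`, and to show that the
  -- total weight of the trees is not zero.
  tree-exists : Connected G ⊤ → ∃ Tree
  tree-exists conn = shrink _ ⊤ ℕ.≤-refl (λ i j → path⇒reach (conn i j))
    where
    shrink : ∀ N S → card S ℕ.≤ N → (∀ i j → Reach S i j) → ∃ Tree
    shrink N S S≤N conn with any? (λ k → (k ∈? S) ×-dec reach? (S ∖ k) (tail k) (head k))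
    ... | no ¬p = S , tree conn (λ k∈S r → ¬p (_ , k∈S , r))
    shrink zero    S S≤N conn | yes (k , k∈S , r) =
      contradiction (ℕ.<-≤-trans (x∈p⇒∣p-x∣<∣p∣ k∈S) S≤N) λ ()
    shrink (suc N) S S≤N conn | yes (k , k∈S , r) =
      shrink N (S ∖ k) (ℕ.≤-pred (ℕ.<-≤-trans (x∈p⇒∣p-x∣<∣p∣ k∈S) S≤N))
        (λ i j → reroute (conn i j))
      where
      step : ∀ {i j} → Adjacent G S i j → Reach (S ∖ k) i j
      step (e , e∈S , J) with e ≟ k
      ... | no e≢k   = Reach-edge (x∈p∧x≢y⇒x∈p-y e∈S e≢k) J
      ... | yes ≡.refl with J
      ...   | inj₁ (≡.refl , ≡.refl) = r
      ...   | inj₂ (≡.refl , ≡.refl) = Reach-sym r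
      reroute : ∀ {i j} → Reach S i j → Reach (S ∖ k) i j
      reroute (_ , ε)     = Reach-refl
      reroute (_ , a ◅ w) = Reach-trans (step a) (reroute (_ , w))

-- A ring solver with integer coefficients, which unlike the one with natural
-- coefficients can cancel terms of opposite sign.
module IntegerSolver (K : CommutativeRing 0ℓ 0ℓ) where
  open CommutativeRing K
  open import Data.Integer.Base using (ℤ; +_; -[1+_]; _⊖_; _◃_)
  open RingProperties ring using (-‿distribˡ-*; -‿distribʳ-*; -0#≈0#; -‿involutive)
  open GroupProperties +-abelianGroup using (⁻¹-∙-comm)
  open Multiples semiring using (×-homo-+; ×1-homo-*) renaming (_×_ to _×ₙ_)
  open import Relation.Binary.Reasoning.Setoid setoid

  private
    ⟦_⟧ : ℤ → Carrier
    ⟦ + n ⟧      = n ×ₙ 1#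
    ⟦ -[1+ n ] ⟧ = - (suc n ×ₙ 1#)

    cancel-1 : ∀ x y → x - y ≈ (1# + x) - (1# + y)
    cancel-1 x y = begin
      x - y                      ≈⟨ +-congʳ (+-identityˡ x) ⟨
      0# + x - y                 ≈⟨ +-congʳ (+-congʳ (-‿inverseˡ 1#)) ⟨
      - 1# + 1# + x - y          ≈⟨ +-congʳ (+-assoc _ _ _) ⟩
      - 1# + (1# + x) - y        ≈⟨ +-congʳ (+-comm _ _) ⟩
      (1# + x) + - 1# - y        ≈⟨ +-assoc _ _ _ ⟩
      (1# + x) + (- 1# - y)      ≈⟨ +-congˡ (⁻¹-∙-comm 1# y) ⟩
      (1# + x) - (1# + y)        ∎

    ⊖-homo : ∀ m n → ⟦ m ⊖ n ⟧ ≈ m ×ₙ 1# - n ×ₙ 1#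
    ⊖-homo m       zero    = sym (trans (+-congˡ -0#≈0#) (+-identityʳ _))
    ⊖-homo zero    (suc n) = sym (+-identityˡ _)
    ⊖-homo (suc m) (suc n) = begin
      ⟦ suc m ⊖ suc n ⟧            ≡⟨ ≡.cong ⟦_⟧ (ℤ.[1+m]⊖[1+n]≡m⊖n m n) ⟩
      ⟦ m ⊖ n ⟧                    ≈⟨ ⊖-homo m n ⟩
      m ×ₙ 1# - n ×ₙ 1#            ≈⟨ cancel-1 _ _ ⟩
      suc m ×ₙ 1# - suc n ×ₙ 1#    ∎

    +-homo : ∀ i j → ⟦ i ℤ.+ j ⟧ ≈ ⟦ i ⟧ + ⟦ j ⟧
    +-homo (+ m)    (+ n)    = ×-homo-+ 1# m n
    +-homo (+ m)    -[1+ n ] = ⊖-homo m (suc n)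
    +-homo -[1+ m ] (+ n)    = trans (⊖-homo n (suc m)) (+-comm _ _)
    +-homo -[1+ m ] -[1+ n ] = begin
      - (1# + (1# + (m ℕ.+ n) ×ₙ 1#))          ≈⟨ -‿cong (+-congˡ (+-congˡ (×-homo-+ 1# m n))) ⟩
      - (1# + (1# + (m ×ₙ 1# + n ×ₙ 1#)))      ≈⟨ -‿cong (+-congˡ (+-assoc _ _ _)) ⟨
      - (1# + ((1# + m ×ₙ 1#) + n ×ₙ 1#))      ≈⟨ -‿cong (+-congˡ (+-comm _ _)) ⟩
      - (1# + (n ×ₙ 1# + suc m ×ₙ 1#))         ≈⟨ -‿cong (+-assoc _ _ _) ⟨
      - (suc n ×ₙ 1# + suc m ×ₙ 1#)            ≈⟨ -‿cong (+-comm _ _) ⟩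
      - (suc m ×ₙ 1# + suc n ×ₙ 1#)            ≈⟨ ⁻¹-∙-comm _ _ ⟨
      - (suc m ×ₙ 1#) - suc n ×ₙ 1#            ∎

    +◃-homo : ∀ n → ⟦ Sign.+ ◃ n ⟧ ≈ n ×ₙ 1#
    +◃-homo zero    = refl
    +◃-homo (suc n) = refl

    -◃-homo : ∀ n → ⟦ Sign.- ◃ n ⟧ ≈ - (n ×ₙ 1#)
    -◃-homo zero    = sym -0#≈0#
    -◃-homo (suc n) = refl

    *-homo : ∀ i j → ⟦ i ℤ.* j ⟧ ≈ ⟦ i ⟧ * ⟦ j ⟧
    *-homo (+ m) (+ n) = trans (+◃-homo (m ℕ.* n)) (×1-homo-* m n)
    *-homo (+ m) -[1+ n ] = trans (-◃-homo (m ℕ.* suc n))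
      (trans (-‿cong (×1-homo-* m (suc n))) (-‿distribʳ-* _ _))
    *-homo -[1+ m ] (+ n) = trans (-◃-homo (suc m ℕ.* n))
      (trans (-‿cong (×1-homo-* (suc m) n)) (-‿distribˡ-* _ _))
    *-homo -[1+ m ] -[1+ n ] = trans (+◃-homo (suc m ℕ.* suc n)) (trans (×1-homo-* (suc m) (suc n))
      (sym (trans (sym (-‿distribˡ-* _ _)) (trans (-‿cong (sym (-‿distribʳ-* _ _))) (-‿involutive _)))))

    -‿homo : ∀ i → ⟦ ℤ.- i ⟧ ≈ - ⟦ i ⟧
    -‿homo (+ zero)  = sym -0#≈0#
    -‿homo (+ suc n) = refl
    -‿homo -[1+ n ]  = sym (-‿involutive _)

    -- Agrees with ⟦_⟧, but makes the constant 1 of the solver equal to 1# by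
    -- definition.
    ⟦_⟧′ : ℤ → Carrier
    ⟦ + 1 ⟧′ = 1#
    ⟦ i ⟧′   = ⟦ i ⟧

    ⟦⟧′≈⟦⟧ : ∀ i → ⟦ i ⟧′ ≈ ⟦ i ⟧
    ⟦⟧′≈⟦⟧ (+ 0)           = refl
    ⟦⟧′≈⟦⟧ (+ 1)           = sym (+-identityʳ 1#)
    ⟦⟧′≈⟦⟧ (+ suc (suc _)) = refl
    ⟦⟧′≈⟦⟧ -[1+ _ ]        = refl

    homomorphism : ℤ.+-*-rawRing -Raw-AlmostCommutative⟶ fromCommutativeRing K
    homomorphism = record
      { ⟦_⟧    = ⟦_⟧′
      ; +-homo = λ i j → trans (⟦⟧′≈⟦⟧ (i ℤ.+ j)) (trans (+-homo i j) (sym (+-cong (⟦⟧′≈⟦⟧ i) (⟦⟧′≈⟦⟧ j))))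
      ; *-homo = λ i j → trans (⟦⟧′≈⟦⟧ (i ℤ.* j)) (trans (*-homo i j) (sym (*-cong (⟦⟧′≈⟦⟧ i) (⟦⟧′≈⟦⟧ j))))
      ; -‿homo = λ i → trans (⟦⟧′≈⟦⟧ (ℤ.- i)) (trans (-‿homo i) (sym (-‿cong (⟦⟧′≈⟦⟧ i))))
      ; 0-homo = refl
      ; 1-homo = refl
      }

  open Algebra.Solver.Ring ℤ.+-*-rawRing (fromCommutativeRing K) homomorphism
    (λ i j → Maybe.map (reflexive ∘ ≡.cong ⟦_⟧′) (dec⇒maybe (i ℤ.≟ j))) public
    using (solve; _:=_; _:+_; _:*_; _:-_; :-_; con)

-- Finite sums and products with guards

module FiniteSum (M : CommutativeMonoid 0ℓ 0ℓ) where
  open CommutativeMonoid M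
  open Algebra.Properties.CommutativeMonoid.Sum M public
  open SemigroupProperties commutativeSemigroup using (x∙yz≈y∙xz)
  open import Relation.Binary.Reasoning.Setoid setoid

  when : {P : Set} → Dec P → Carrier → Carrier
  when d x = if does d then x else ε

  when-yes : ∀ {P x} (d : Dec P) → P → when d x ≈ x
  when-yes (yes _) p = refl
  when-yes (no ¬p) p = contradiction p ¬p

  when-no : ∀ {P x} (d : Dec P) → ¬ P → when d x ≈ ε
  when-no (yes p) ¬p = contradiction p ¬p
  when-no (no _)  ¬p = refl

  when-cong : ∀ {P x y} (d : Dec P) → (P → x ≈ y) → when d x ≈ when d y
  when-cong (yes p) x≈y = x≈y p
  when-cong (no _)  x≈y = refl

  when-⇔ : ∀ {P Q x} (d : Dec P) (e : Dec Q) → (P → Q) → (Q → P) → when d x ≈ when e x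
  when-⇔ (yes p) e f g = sym (when-yes e (f p))
  when-⇔ (no ¬p) e f g = sym (when-no e (¬p ∘ g))

  when-comm : ∀ {P Q x} (d : Dec P) (e : Dec Q) → when d (when e x) ≈ when e (when d x)
  when-comm (yes _) e       = refl
  when-comm (no _)  (yes _) = refl
  when-comm (no _)  (no _)  = refl

  ∑ : {A : Set} → List A → (A → Carrier) → Carrier
  ∑ xs f = sum (f ∘ lookup xs)

  ∑-cong : {A : Set} (xs : List A) {f g : A → Carrier} → (∀ x → f x ≈ g x) → ∑ xs f ≈ ∑ xs g
  ∑-cong xs f≈g = sum-cong-≋ (f≈g ∘ lookup xs)

  ∑-filter : {A : Set} {P : A → Set} (P? : Decidable P) (f : A → Carrier) (xs : List A) →
             ∑ (filter P? xs) f ≈ ∑ xs (λ x → when (P? x) (f x))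
  ∑-filter P? f []       = refl
  ∑-filter P? f (x ∷ xs) with does (P? x)
  ... | true  = ∙-congˡ (∑-filter P? f xs)
  ... | false = trans (∑-filter P? f xs) (sym (identityˡ _))

  ∑-tabulate : ∀ {A : Set} {n} (g : Fin n → A) f → ∑ (tabulate g) f ≈ sum (f ∘ g)
  ∑-tabulate {n = zero}  g f = refl
  ∑-tabulate {n = suc n} g f = ∙-congˡ (∑-tabulate (g ∘ suc) f)

  ∑-filter-allFin : ∀ {n} {P : Fin n → Set} (P? : Decidable P) f →
                    ∑ (filter P? (allFin n)) f ≈ sum (λ k → when (P? k) (f k))
  ∑-filter-allFin {n} P? f = trans (∑-filter P? f (allFin n)) (∑-tabulate {n = n} id (λ k → when (P? k) (f k)))

  ∑-++ : ∀ {A : Set} (xs ys : List A) f → ∑ (xs ++ ys) f ≈ ∑ xs f ∙ ∑ ys f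
  ∑-++ []       ys f = sym (identityˡ _)
  ∑-++ (x ∷ xs) ys f = trans (∙-congˡ (∑-++ xs ys f)) (sym (assoc _ _ _))

  ∑-map : ∀ {A B : Set} (g : A → B) xs f → ∑ (List.map g xs) f ≈ ∑ xs (f ∘ g)
  ∑-map g []       f = refl
  ∑-map g (x ∷ xs) f = ∙-congˡ (∑-map g xs f)

  sum-zero : ∀ {n} {f : Fin n → Carrier} → (∀ k → f k ≈ ε) → sum f ≈ ε
  sum-zero {n} f≈ε = trans (sum-cong-≋ f≈ε) (sum-replicate-zero n)

  -- Needed multiplicatively, as `Π.sum-scale`, for two products that differ in one factor: it
  -- yields the weight of a forest with an added edge, and the jump of a `treePotential` across an
  -- edge.
  sum-scale : ∀ {n} {f g : Fin n → Carrier} l {a} → f l ≈ a ∙ g l →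
              (∀ k → k ≢ l → f k ≈ g k) → sum f ≈ a ∙ sum g
  sum-scale zero    p q =
    trans (∙-cong p (sum-cong-≋ (λ k → q (suc k) λ ()))) (assoc _ _ _)
  sum-scale (suc l) p q =
    trans (∙-cong (q zero λ ()) (sum-scale l p (λ k k≢l → q (suc k) (k≢l ∘ suc-injective))))
      (x∙yz≈y∙xz _ _ _)

  sum-single : ∀ {n} {f : Fin n → Carrier} l → (∀ k → k ≢ l → f k ≈ ε) → sum f ≈ f l
  sum-single {n} l q =
    trans (sum-scale {n} {g = λ _ → ε} l (sym (identityʳ _)) q)
      (trans (∙-congˡ (sum-replicate-zero n)) (identityʳ _))

  ∑-subsets : ∀ {m} f → ∑ (subsets (suc m)) f ≈
              ∑ (subsets m) (f ∘ (inside ∷_)) ∙ ∑ (subsets m) (f ∘ (outside ∷_))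
  ∑-subsets {m} f = trans (∑-++ (List.map (inside ∷_) (subsets m)) (List.map (outside ∷_) (subsets m)) f)
    (∙-cong (∑-map (inside ∷_) (subsets m) f) (∑-map (outside ∷_) (subsets m) f))

  -- Inserting `k` is a bijection from the sets without `k` onto those with `k`; at position zero it
  -- exchanges the two halves of `subsets`. It reindexes the trees through `k` by forests.
  ∑-insert : ∀ {m} k (f : Subset m → Carrier) →
             ∑ (subsets m) (λ S → when (k ∈? S) (f S)) ≈
             ∑ (subsets m) (λ S → when (¬? (k ∈? S)) (f (S ⊕ k)))
  ∑-insert {suc m} zero f = begin
    _                                                ≈⟨ ∑-subsets (λ S → when (zero ∈? S) (f S)) ⟩
    ∑ (subsets m) (f ∘ (inside ∷_)) ∙ ∑ (subsets m) (λ _ → ε)  ≈⟨ comm _ _ ⟩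
    ∑ (subsets m) (λ _ → ε) ∙ ∑ (subsets m) (f ∘ (inside ∷_))  ≈⟨ ∑-subsets (λ S → when (¬? (zero ∈? S)) (f (S ⊕ zero))) ⟨
    _                                                ∎
  ∑-insert {suc m} (suc k) f = begin
    _  ≈⟨ ∑-subsets (λ S → when (suc k ∈? S) (f S)) ⟩
    _  ≈⟨ ∙-cong (∑-insert k (f ∘ (inside ∷_))) (∑-insert k (f ∘ (outside ∷_))) ⟩
    _  ≈⟨ ∑-subsets (λ S → when (¬? (suc k ∈? S)) (f (S ⊕ suc k))) ⟨
    _  ∎

-- Matrices over a commutative ring with involution

record Involution (K : CommutativeRing 0ℓ 0ℓ) : Set where
  open CommutativeRing K
  field
    conj        : Carrier → Carrier
    conj-cong   : ∀ {a b} → a ≈ b → conj a ≈ conj b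
    conj-+      : ∀ a b → conj (a + b) ≈ conj a + conj b
    conj-*      : ∀ a b → conj (a * b) ≈ conj a * conj b
    conj-conj   : ∀ a → conj (conj a) ≈ a

module InvolutiveRing (K : CommutativeRing 0ℓ 0ℓ) (J : Involution K) where
  open CommutativeRing K hiding (zero)
  open Involution J
  open RingProperties ring using (-0#≈0#)
  open GroupProperties +-abelianGroup using (inverseˡ-unique; identityˡ-unique)
  open IntegerSolver K
  open FiniteSum +-commutativeMonoid public
  open Multiples semiring using (×-assoc-*; ×-congʳ) renaming (_×_ to _×ₙ_) public
  open SemiringSum semiring using (*-distribˡ-sum; *-distribʳ-sum) public
  open SetoidReasoning setoid

  module Π = FiniteSum *-commutativeMonoid

  -- The Iverson bracket: as a factor, a guard can be moved about by the ring solver.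
  ⟦_⟧ : {P : Set} → Dec P → Carrier
  ⟦ d ⟧ = when d 1#

  when-⟦⟧ : ∀ {P : Set} (d : Dec P) x → when d x ≈ ⟦ d ⟧ * x
  when-⟦⟧ (yes _) x = sym (*-identityˡ x)
  when-⟦⟧ (no _)  x = sym (zeroˡ x)

  sum-neg : ∀ {n} (f : Fin n → Carrier) → sum (λ i → - f i) ≈ - sum f
  sum-neg {zero}  f = sym -0#≈0#
  sum-neg {suc n} f = trans (+-congˡ (sum-neg (f ∘ suc))) (GroupProperties.⁻¹-∙-comm +-abelianGroup _ _)

  sum-minus : ∀ {n} (f g : Fin n → Carrier) → sum (λ i → f i - g i) ≈ sum f - sum g
  sum-minus f g = trans (∑-distrib-+ f (λ i → - g i)) (+-congˡ (sum-neg g))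

  sum-⟦≟⟧ : ∀ {n} (f : Fin n → Carrier) j → sum (λ i → f i * ⟦ j ≟ i ⟧) ≈ f j
  sum-⟦≟⟧ {n} f j = trans
    (sum-single j (λ k k≢j → trans (*-congˡ (when-no (j ≟ k) (k≢j ∘ ≡.sym))) (zeroʳ _)))
    (trans (*-congˡ (when-yes (j ≟ j) ≡.refl)) (*-identityʳ _))

  ∑-filter-cong : ∀ {A : Set} {P : A → Set} (P? : Decidable P) xs {f g} →
    (∀ x → P x → f x ≈ g x) → ∑ (filter P? xs) f ≈ ∑ (filter P? xs) g
  ∑-filter-cong P? xs {f} {g} f≈g = begin
    ∑ (filter P? xs) f              ≈⟨ ∑-filter P? f xs ⟩
    ∑ xs (λ x → when (P? x) (f x))  ≈⟨ ∑-cong xs {f = λ x → when (P? x) (f x)} (λ x → when-cong (P? x) (f≈g x)) ⟩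
    ∑ xs (λ x → when (P? x) (g x))  ≈⟨ ∑-filter P? g xs ⟨
    ∑ (filter P? xs) g              ∎

  Real : Carrier → Set
  Real a = conj a ≈ a

  real-0 : Real 0#
  real-0 = identityˡ-unique (conj 0#) (conj 0#) (trans (sym (conj-+ 0# 0#)) (conj-cong (+-identityˡ 0#)))

  real-1 : Real 1#
  real-1 = begin
    conj 1#                  ≈⟨ *-identityʳ _ ⟨
    conj 1# * 1#             ≈⟨ *-congˡ (conj-conj 1#) ⟨
    conj 1# * conj (conj 1#) ≈⟨ conj-* 1# (conj 1#) ⟨
    conj (1# * conj 1#)      ≈⟨ conj-cong (*-identityˡ _) ⟩
    conj (conj 1#)           ≈⟨ conj-conj 1# ⟩
    1#                       ∎

  conj-neg : ∀ a → conj (- a) ≈ - conj a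
  conj-neg a = inverseˡ-unique _ _
    (trans (sym (conj-+ (- a) a)) (trans (conj-cong (-‿inverseˡ a)) real-0))

  real-+ : ∀ {a b} → Real a → Real b → Real (a + b)
  real-+ p q = trans (conj-+ _ _) (+-cong p q)

  real-* : ∀ {a b} → Real a → Real b → Real (a * b)
  real-* p q = trans (conj-* _ _) (*-cong p q)

  real-neg : ∀ {a} → Real a → Real (- a)
  real-neg p = trans (conj-neg _) (-‿cong p)

  real-minus : ∀ {a b} → Real a → Real b → Real (a - b)
  real-minus p q = real-+ p (real-neg q)

  real-resp : ∀ {a b} → a ≈ b → Real a → Real b
  real-resp a≈b p = trans (conj-cong (sym a≈b)) (trans p a≈b)

  conj-sum : ∀ {n} (f : Fin n → Carrier) → conj (sum f) ≈ sum (conj ∘ f)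
  conj-sum {zero}  f = real-0
  conj-sum {suc n} f = trans (conj-+ _ _) (+-congˡ (conj-sum (f ∘ suc)))

  real-sum : ∀ {n} (f : Fin n → Carrier) → (∀ i → Real (f i)) → Real (sum f)
  real-sum f p = trans (conj-sum f) (sum-cong-≋ p)

  real-when : ∀ {P : Set} {a} (d : Dec P) → Real a → Real (when d a)
  real-when (yes _) p = p
  real-when (no _)  p = real-0

  real-× : ∀ k → Real (k ×ₙ 1#)
  real-× zero    = real-0
  real-× (suc k) = real-+ real-1 (real-× k)

  real-Π : ∀ {k} (f : Fin k → Carrier) → (∀ i → Real (f i)) → Real (Π.sum f)
  real-Π {zero}  f p = real-1
  real-Π {suc k} f p = real-* (p zero) (real-Π (f ∘ suc) (p ∘ suc))

  real-inverse : ∀ {a b} → Real a → a * b ≈ 1# → Real b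
  real-inverse {a} {b} p ab = begin
    conj b              ≈⟨ *-identityʳ _ ⟨
    conj b * 1#         ≈⟨ *-congˡ ab ⟨
    conj b * (a * b)    ≈⟨ *-assoc _ _ _ ⟨
    conj b * a * b      ≈⟨ *-congʳ (*-congˡ p) ⟨
    conj b * conj a * b ≈⟨ *-congʳ (trans (sym (conj-* b a)) (conj-cong (trans (*-comm b a) ab))) ⟩
    conj 1# * b         ≈⟨ *-congʳ real-1 ⟩
    1# * b              ≈⟨ *-identityˡ b ⟩
    b                   ∎

  Matrix : ℕ → ℕ → Set
  Matrix r c = Fin r → Fin c → Carrier

  infix 4 _≋_
  _≋_ : ∀ {r c} → Matrix r c → Matrix r c → Set
  A ≋ B = ∀ i j → A i j ≈ B i j

  infixl 7 _·_
  _·_ : ∀ {r s c} → Matrix r s → Matrix s c → Matrix r c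
  (A · B) i j = sum (λ l → A i l * B l j)

  infix 8 _ᴴ
  _ᴴ : ∀ {r c} → Matrix r c → Matrix c r
  (A ᴴ) i j = conj (A j i)

  ≋-sym : ∀ {r c} {A B : Matrix r c} → A ≋ B → B ≋ A
  ≋-sym p i j = sym (p i j)

  ≋-trans : ∀ {r c} {A B C : Matrix r c} → A ≋ B → B ≋ C → A ≋ C
  ≋-trans p q i j = trans (p i j) (q i j)

  ·-cong : ∀ {r s c} {A A′ : Matrix r s} {B B′ : Matrix s c} → A ≋ A′ → B ≋ B′ → A · B ≋ A′ · B′
  ·-cong p q i j = sum-cong-≋ (λ l → *-cong (p i l) (q l j))

  ·-congˡ : ∀ {r s c} (A : Matrix r s) {B B′ : Matrix s c} → B ≋ B′ → A · B ≋ A · B′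
  ·-congˡ A q i j = sum-cong-≋ (λ l → *-congˡ (q l j))

  ·-congʳ : ∀ {r s c} {A A′ : Matrix r s} (B : Matrix s c) → A ≋ A′ → A · B ≋ A′ · B
  ·-congʳ B p i j = sum-cong-≋ (λ l → *-congʳ (p i l))

  ·-assoc : ∀ {r s t c} (A : Matrix r s) (B : Matrix s t) (C : Matrix t c) → (A · B) · C ≋ A · (B · C)
  ·-assoc {s = s} {t} A B C i j = begin
    sum (λ l → sum (λ k → A i k * B k l) * C l j)    ≈⟨ sum-cong-≋ (λ l → *-distribʳ-sum (C l j) (λ k → A i k * B k l)) ⟩
    sum (λ l → sum (λ k → A i k * B k l * C l j))    ≈⟨ ∑-comm (λ l k → A i k * B k l * C l j) ⟩
    sum (λ k → sum (λ l → A i k * B k l * C l j))    ≈⟨ sum-cong-≋ {s} (λ k → sum-cong-≋ {t} (λ l → *-assoc _ _ _)) ⟩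
    sum (λ k → sum (λ l → A i k * (B k l * C l j)))  ≈⟨ sum-cong-≋ (λ k → *-distribˡ-sum (A i k) (λ l → B k l * C l j)) ⟨
    sum (λ k → A i k * sum (λ l → B k l * C l j))    ∎

  ᴴ-cong : ∀ {r c} {A B : Matrix r c} → A ≋ B → A ᴴ ≋ B ᴴ
  ᴴ-cong p i j = conj-cong (p j i)

  ᴴ-involutive : ∀ {r c} (A : Matrix r c) → A ᴴ ᴴ ≋ A
  ᴴ-involutive A i j = conj-conj (A i j)

  ᴴ-· : ∀ {r s c} (A : Matrix r s) (B : Matrix s c) → (A · B) ᴴ ≋ B ᴴ · A ᴴ
  ᴴ-· {s = s} A B i j = trans (conj-sum {s} _) (sum-cong-≋ {s} (λ l → trans (conj-* _ _) (*-comm _ _)))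

  record Penrose {r c} (M : Matrix r c) (X : Matrix c r) : Set where
    field
      MXM≋M        : M · X · M ≋ M
      XMX≋X        : X · M · X ≋ X
      MX-hermitian : (M · X) ᴴ ≋ M · X
      XM-hermitian : (X · M) ᴴ ≋ X · M

  Penrose-cong : ∀ {r c} {M M′ : Matrix r c} {X X′ : Matrix c r} → M ≋ M′ → X ≋ X′ →
                 Penrose M X → Penrose M′ X′
  Penrose-cong {M = M} {M′} {X} {X′} p q P = record
    { MXM≋M        = ≋-trans (·-cong (·-cong (≋-sym p) (≋-sym q)) (≋-sym p)) (≋-trans MXM≋M p)
    ; XMX≋X        = ≋-trans (·-cong (·-cong (≋-sym q) (≋-sym p)) (≋-sym q)) (≋-trans XMX≋X q)
    ; MX-hermitian = ≋-trans (ᴴ-cong (·-cong (≋-sym p) (≋-sym q))) (≋-trans MX-hermitian (·-cong p q))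
    ; XM-hermitian = ≋-trans (ᴴ-cong (·-cong (≋-sym q) (≋-sym p))) (≋-trans XM-hermitian (·-cong q p))
    }
    where open Penrose P

  module _ {r c} (N : Matrix r c) (M : Matrix c r) (E : Matrix r r)
           (NM≋E : N · M ≋ E) (E-hermitian : E ᴴ ≋ E) (EN≋N : E · N ≋ N) where

    -- `E` is the projection onto the range of `N`, and `I` the one onto the range of `M`. For a
    -- tree `I` is the identity, since the columns of its incidence matrix are independent.
    leftInverse-penrose : (I : Matrix c c) → M · N ≋ I → (I ᴴ ≋ I) → I · M ≋ M → Penrose N M
    leftInverse-penrose I MN≋I I-hermitian IM≋M = record
      { MXM≋M        = ≋-trans (·-congʳ N NM≋E) EN≋N
      ; XMX≋X        = ≋-trans (·-congʳ M MN≋I) IM≋M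
      ; MX-hermitian = ≋-trans (ᴴ-cong NM≋E) (≋-trans E-hermitian (≋-sym NM≋E))
      ; XM-hermitian = ≋-trans (ᴴ-cong MN≋I) (≋-trans I-hermitian (≋-sym MN≋I))
      }

    -- As M N is Hermitian, N* X = (M N)* M = M N M = M E = M. Hence Q X = N M = E, and X Q = E
    -- follows by taking adjoints, Q and X being Hermitian.
    gram-penrose : M · E ≋ M → (M · N) ᴴ ≋ M · N → Penrose (N · N ᴴ) (M ᴴ · M)
    gram-penrose ME≋M MN-hermitian = record
      { MXM≋M        = ≋-trans (·-congʳ Q QX≋E) EQ≋Q
      ; XMX≋X        = ≋-trans (·-congʳ X XQ≋E) EX≋X
      ; MX-hermitian = ≋-trans (ᴴ-cong QX≋E) (≋-trans E-hermitian (≋-sym QX≋E))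
      ; XM-hermitian = ≋-trans (ᴴ-cong XQ≋E) (≋-trans E-hermitian (≋-sym XQ≋E))
      }
      where
      Q X : Matrix r r
      Q = N · N ᴴ
      X = M ᴴ · M
      EQ≋Q : E · Q ≋ Q
      EQ≋Q = ≋-trans (≋-sym (·-assoc E N (N ᴴ))) (·-congʳ (N ᴴ) EN≋N)
      EMᴴ≋Mᴴ : E · M ᴴ ≋ M ᴴ
      EMᴴ≋Mᴴ = ≋-trans (·-congʳ (M ᴴ) (≋-sym E-hermitian))
        (≋-trans (≋-sym (ᴴ-· M E)) (ᴴ-cong ME≋M))
      EX≋X : E · X ≋ X
      EX≋X = ≋-trans (≋-sym (·-assoc E (M ᴴ) M)) (·-congʳ M EMᴴ≋Mᴴ)
      NᴴX≋M : N ᴴ · X ≋ M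
      NᴴX≋M = ≋-trans (≋-sym (·-assoc (N ᴴ) (M ᴴ) M))
        (≋-trans (·-congʳ M (≋-trans (≋-sym (ᴴ-· M N)) MN-hermitian))
          (≋-trans (·-assoc M N M) (≋-trans (·-congˡ M NM≋E) ME≋M)))
      QX≋E : Q · X ≋ E
      QX≋E = ≋-trans (·-assoc N (N ᴴ) X) (≋-trans (·-congˡ N NᴴX≋M) NM≋E)
      gram-hermitian : ∀ {s t} (A : Matrix s t) → (A · A ᴴ) ᴴ ≋ A · A ᴴ
      gram-hermitian A = ≋-trans (ᴴ-· A (A ᴴ)) (·-congʳ (A ᴴ) (ᴴ-involutive A))
      X-hermitian : X ᴴ ≋ X
      X-hermitian = ≋-trans (ᴴ-· (M ᴴ) M) (·-congˡ (M ᴴ) (ᴴ-involutive M))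
      XQ≋E : X · Q ≋ E
      XQ≋E = ≋-trans (·-cong (≋-sym X-hermitian) (≋-sym (gram-hermitian N)))
        (≋-trans (≋-sym (ᴴ-· Q X)) (≋-trans (ᴴ-cong QX≋E) E-hermitian))

-- Currents in a single tree

module TreeCurrents (K : CommutativeRing 0ℓ 0ℓ) (J : Involution K) {n m : ℕ} (G : OrientedGraph n m)
  where
  open CommutativeRing K hiding (zero)
  open Involution J
  open OrientedGraph G
  open Graph G
  open InvolutiveRing K J
  open IntegerSolver K
  open SetoidReasoning setoid

  tree? : Decidable (IsSpanningTree G)
  tree? = isSpanningTree? G

  -- The signed incidence matrix of the unweighted oriented graph: 1 at the tail and -1 at the head.
  B : Fin n → Fin m → Carrier
  B i k = ⟦ tail k ≟ i ⟧ - ⟦ head k ≟ i ⟧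

  sum-B : ∀ (f : Fin n → Carrier) k → sum (λ i → f i * B i k) ≈ f (tail k) - f (head k)
  sum-B f k = begin
    sum (λ i → f i * B i k)
      ≈⟨ sum-cong-≋ {n} (λ i → solve 3 (λ a b c → a :* (b :- c) := a :* b :- a :* c) refl
                                 (f i) ⟦ tail k ≟ i ⟧ ⟦ head k ≟ i ⟧) ⟩
    sum (λ i → f i * ⟦ tail k ≟ i ⟧ - f i * ⟦ head k ≟ i ⟧)
      ≈⟨ sum-minus {n} (λ i → f i * ⟦ tail k ≟ i ⟧) (λ i → f i * ⟦ head k ≟ i ⟧) ⟩
    sum (λ i → f i * ⟦ tail k ≟ i ⟧) - sum (λ i → f i * ⟦ head k ≟ i ⟧)
      ≈⟨ +-cong (sum-⟦≟⟧ f (tail k)) (-‿cong (sum-⟦≟⟧ f (head k))) ⟩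
    f (tail k) - f (head k) ∎

  ⟦≟⟧-sym : ∀ {n} (i j : Fin n) → ⟦ i ≟ j ⟧ ≈ ⟦ j ≟ i ⟧
  ⟦≟⟧-sym i j = when-⇔ (i ≟ j) (j ≟ i) ≡.sym ≡.sym

  ρ : Subset m → Fin n → Fin n → Carrier
  ρ S a b = ⟦ reach? S a b ⟧

  ρ-congˡ : ∀ {S a b} → Reach S a b → ∀ v → ρ S a v ≈ ρ S b v
  ρ-congˡ {S} {a} {b} r v =
    when-⇔ (reach? S a v) (reach? S b v) (Reach-trans (Reach-sym r)) (Reach-trans r)

  ρ-sym : ∀ S a b → ρ S a b ≈ ρ S b a
  ρ-sym S a b = when-⇔ (reach? S a b) (reach? S b a) Reach-sym Reach-sym

  ρ-complement : ∀ {S a b} → ¬ Reach S a b → (∀ v → Reach S a v ⊎ Reach S b v) →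
                 ∀ v → ρ S b v ≈ 1# - ρ S a v
  ρ-complement {S} {a} {b} a≁b cover v with cover v
  ... | inj₁ r = begin
    ρ S b v       ≈⟨ when-no (reach? S b v) (λ s → a≁b (Reach-trans r (Reach-sym s))) ⟩
    0#            ≈⟨ -‿inverseʳ 1# ⟨
    1# - 1#       ≈⟨ +-congˡ (-‿cong (when-yes (reach? S a v) r)) ⟨
    1# - ρ S a v  ∎
  ... | inj₂ r = begin
    ρ S b v       ≈⟨ when-yes (reach? S b v) r ⟩
    1#            ≈⟨ solve 1 (λ o → o := o :- con ℤ.0ℤ) refl 1# ⟩
    1# - 0#       ≈⟨ +-congˡ (-‿cong (when-no (reach? S a v) (λ s → a≁b (Reach-trans s (Reach-sym r))))) ⟨
    1# - ρ S a v  ∎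

  module Normalised (ν : Carrier) (n*ν≈1 : (n ×ₙ 1#) * ν ≈ 1#) where

    ν-average : ∀ a → ν * sum {n} (λ _ → a) ≈ a
    ν-average a = begin
      ν * sum {n} (λ _ → a)  ≈⟨ *-congˡ (trans (sum-replicate n) (sym (trans (×-assoc-* n 1# a) (×-congʳ n (*-identityˡ a))))) ⟩
      ν * ((n ×ₙ 1#) * a)    ≈⟨ solve 3 (λ u k a → u :* (k :* a) := k :* u :* a) refl ν (n ×ₙ 1#) a ⟩
      (n ×ₙ 1#) * ν * a      ≈⟨ *-congʳ n*ν≈1 ⟩
      1# * a                 ≈⟨ *-identityˡ a ⟩
      a                      ∎

    -- With ν = 1/n, the fraction of all vertices that lie in the component of `a`.
    share : Subset m → Fin n → Carrier
    share S a = ν * sum (ρ S a)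

    share-cong : ∀ {S a b} → Reach S a b → share S a ≈ share S b
    share-cong r = *-congˡ (sum-cong-≋ {n} (ρ-congˡ r))

    share-complement : ∀ {S a b} → ¬ Reach S a b → (∀ v → Reach S a v ⊎ Reach S b v) →
                       share S b ≈ 1# - share S a
    share-complement {S} {a} {b} a≁b cover = begin
      ν * sum (ρ S b)                       ≈⟨ *-congˡ (sum-cong-≋ {n} (ρ-complement a≁b cover)) ⟩
      ν * sum (λ v → 1# - ρ S a v)          ≈⟨ *-congˡ (sum-minus {n} (λ _ → 1#) (ρ S a)) ⟩
      ν * (sum {n} (λ _ → 1#) - sum (ρ S a))  ≈⟨ solve 3 (λ a b c → a :* (b :- c) := a :* b :- a :* c) refl ν (sum {n} (λ _ → 1#)) (sum (ρ S a)) ⟩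
      ν * sum {n} (λ _ → 1#) - share S a    ≈⟨ +-congʳ (ν-average 1#) ⟩
      1# - share S a                        ∎

    -- The current through edge k of the tree T when a unit current enters at j
    -- and leaves evenly through all vertices.
    current : Subset m → Fin m → Fin n → Carrier
    current T k j = ρ (T ∖ k) (tail k) j - share (T ∖ k) (tail k)

    sum-current : ∀ T k → sum (current T k) ≈ 0#
    sum-current T k = begin
      sum (λ j → r j - ν * sum r)            ≈⟨ sum-minus {n} r (λ _ → ν * sum r) ⟩
      sum r - sum {n} (λ _ → ν * sum r)      ≈⟨ +-congˡ (-‿cong (*-distribˡ-sum {n} ν (λ _ → sum r))) ⟨
      sum r - ν * sum {n} (λ _ → sum r)      ≈⟨ +-congˡ (-‿cong (ν-average (sum r))) ⟩
      sum r - sum r                          ≈⟨ -‿inverseʳ _ ⟩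
      0#                                     ∎
      where
      r : Fin n → Carrier
      r = ρ (T ∖ k) (tail k)

    -- Deleting `k` separates the ends of `k` and of no other edge of `T`, and the constant share
    -- drops out of the difference. Up to phases this is the left-inverse property of the tree
    -- matrix.
    current-edge : ∀ {T k l} → Tree T → k ∈ T → l ∈ T →
                   current T k (tail l) - current T k (head l) ≈ ⟦ k ≟ l ⟧
    current-edge {T} {k} {l} (tree _ bridge) k∈T l∈T = begin
      current T k (tail l) - current T k (head l)
        ≈⟨ solve 3 (λ a b s → (a :- s) :- (b :- s) := a :- b) refl (r (tail l)) (r (head l)) (share (T ∖ k) (tail k)) ⟩
      r (tail l) - r (head l)
        ≈⟨ difference ⟩
      ⟦ k ≟ l ⟧ ∎
      where
      r : Fin n → Carrier
      r = ρ (T ∖ k) (tail k)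
      difference : r (tail l) - r (head l) ≈ ⟦ k ≟ l ⟧
      difference with k ≟ l
      ... | yes ≡.refl = begin
        r (tail k) - r (head k)
          ≈⟨ +-cong (when-yes (reach? _ _ _) Reach-refl) (-‿cong (when-no (reach? _ _ _) (bridge k∈T))) ⟩
        1# - 0#   ≈⟨ solve 1 (λ o → o :- con ℤ.0ℤ := o) refl 1# ⟩
        1#        ∎
      ... | no k≢l = begin
        r (tail l) - r (head l)  ≈⟨ +-congʳ (trans (ρ-sym _ _ _) (trans (ρ-congˡ edge (tail k)) (ρ-sym _ _ _))) ⟩
        r (head l) - r (head l)  ≈⟨ -‿inverseʳ _ ⟩
        0#                       ∎
        where
        edge : Reach (T ∖ k) (tail l) (head l)
        edge = Reach-edge (x∈p∧x≢y⇒x∈p-y l∈T (k≢l ∘ ≡.sym)) (joins-ends l)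

    -- Kirchhoff's current law.
    current-balance : ∀ {T} → Tree T → ∀ i j →
      sum (λ k → ⟦ k ∈? T ⟧ * (B i k * current T k j)) ≈ ⟦ i ≟ j ⟧ - ν
    current-balance {T} isTree@(tree connected _) i j = begin
      -- Φ - δ does not change along the edges of the tree, so it is constant and equals its mean.
      -- The mean is -ν because Φ sums to 0 and δ to 1.
      Φ j                                   ≈⟨ solve 2 (λ a b → a := b :+ (a :- b)) refl (Φ j) (δ j) ⟩
      δ j + (Φ j - δ j)                     ≈⟨ +-congˡ (ν-average _) ⟨
      δ j + ν * sum {n} (λ v → Φ j - δ j)   ≈⟨ +-congˡ (*-congˡ (sum-cong-≋ {n} (λ v → constant (connected j v)))) ⟩
      δ j + ν * sum (λ v → Φ v - δ v)       ≈⟨ +-congˡ (*-congˡ (sum-minus {n} Φ δ)) ⟩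
      δ j + ν * (sum Φ - sum δ)             ≈⟨ +-congˡ (*-congˡ (+-cong ∑Φ≈0 (-‿cong ∑δ≈1))) ⟩
      δ j + ν * (0# - 1#)                   ≈⟨ solve 2 (λ d u → d :+ u :* (con ℤ.0ℤ :- con ℤ.1ℤ) := d :- u) refl (δ j) ν ⟩
      δ j - ν                               ∎
      where
      δ Φ : Fin n → Carrier
      δ v = ⟦ i ≟ v ⟧
      Φ v = sum (λ k → ⟦ k ∈? T ⟧ * (B i k * current T k v))

      ∑δ≈1 : sum δ ≈ 1#
      ∑δ≈1 = trans (sum-single i (λ v v≢i → when-no (i ≟ v) (v≢i ∘ ≡.sym))) (when-yes (i ≟ i) ≡.refl)

      ∑Φ≈0 : sum Φ ≈ 0#
      ∑Φ≈0 = trans (∑-comm {n} {m} (λ v k → ⟦ k ∈? T ⟧ * (B i k * current T k v))) (sum-zero {m} λ k → begin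
        sum (λ v → ⟦ k ∈? T ⟧ * (B i k * current T k v))  ≈⟨ *-distribˡ-sum {n} _ (λ v → B i k * current T k v) ⟨
        ⟦ k ∈? T ⟧ * sum (λ v → B i k * current T k v)    ≈⟨ *-congˡ (*-distribˡ-sum {n} _ (current T k)) ⟨
        ⟦ k ∈? T ⟧ * (B i k * sum (current T k))          ≈⟨ *-congˡ (trans (*-congˡ (sum-current T k)) (zeroʳ _)) ⟩
        ⟦ k ∈? T ⟧ * 0#                                   ≈⟨ zeroʳ _ ⟩
        0#                                                ∎)

      edge : ∀ {l} → l ∈ T → Φ (tail l) - Φ (head l) ≈ δ (tail l) - δ (head l)
      edge {l} l∈T = begin
        Φ (tail l) - Φ (head l)
          ≈⟨ sum-minus {m} (λ k → ⟦ k ∈? T ⟧ * (B i k * current T k (tail l))) (λ k → ⟦ k ∈? T ⟧ * (B i k * current T k (head l))) ⟨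
        sum (λ k → ⟦ k ∈? T ⟧ * (B i k * current T k (tail l)) - ⟦ k ∈? T ⟧ * (B i k * current T k (head l)))
          ≈⟨ sum-cong-≋ {m} (λ k → trans
               (solve 4 (λ t b p q → t :* (b :* p) :- t :* (b :* q) := b :* (t :* (p :- q))) refl
                      ⟦ k ∈? T ⟧ (B i k) (current T k (tail l)) (current T k (head l)))
               (*-congˡ (inTree k))) ⟩
        sum (λ k → B i k * ⟦ l ≟ k ⟧)  ≈⟨ sum-⟦≟⟧ {m} (B i) l ⟩
        B i l                          ≈⟨ +-cong (⟦≟⟧-sym (tail l) i) (-‿cong (⟦≟⟧-sym (head l) i)) ⟩
        δ (tail l) - δ (head l)        ∎
        where
        inTree : ∀ k → ⟦ k ∈? T ⟧ * (current T k (tail l) - current T k (head l)) ≈ ⟦ l ≟ k ⟧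
        inTree k with k ∈? T
        ... | yes k∈T = trans (*-identityˡ _) (trans (current-edge isTree k∈T l∈T) (⟦≟⟧-sym k l))
        ... | no k∉T  = trans (zeroˡ _) (sym (when-no (l ≟ k) (λ { ≡.refl → k∉T l∈T })))

      rearrange : ∀ {p q d e} → p - q ≈ d - e → p - d ≈ q - e
      rearrange {p} {q} {d} {e} h = begin
        p - d              ≈⟨ solve 3 (λ p q d → p :- d := (p :- q) :+ (q :- d)) refl p q d ⟩
        (p - q) + (q - d)  ≈⟨ +-congʳ h ⟩
        (d - e) + (q - d)  ≈⟨ solve 3 (λ d e q → (d :- e) :+ (q :- d) := q :- e) refl d e q ⟩
        q - e              ∎

      constant : ∀ {a b} → Reach T a b → Φ a - δ a ≈ Φ b - δ b
      constant (_ , ε) = refl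
      constant (_ , (l , l∈T , inj₁ (≡.refl , ≡.refl)) ◅ w) =
        trans (rearrange (edge l∈T)) (constant (_ , w))
      constant (_ , (l , l∈T , inj₂ (≡.refl , ≡.refl)) ◅ w) =
        trans (sym (rearrange (edge l∈T))) (constant (_ , w))

lookup-edges : ∀ {m} (S : Subset m) r → lookup (edges S) r ∈ S
lookup-edges {m} S r = proj₂ (∈-filter⁻ (_∈? S) {xs = allFin m} (∈-lookup r))

-- Mean currents and forest potentials

module WeightedTrees (K : CommutativeRing 0ℓ 0ℓ) (J : Involution K) {n m : ℕ} (G : OrientedGraph n m)
  where
  open CommutativeRing K hiding (zero)
  open Involution J
  open OrientedGraph G
  open Graph G
  open InvolutiveRing K J
  open IntegerSolver K
  open TreeCurrents K J G
  open SetoidReasoning setoid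

  -- A guarded product over all labels, so that inserting an edge changes a single factor;
  -- `absWeight` compares it with the product over the list `edges S`.
  treeWeight : (Fin m → Carrier) → Subset m → Carrier
  treeWeight ω S = Π.sum (λ k → Π.when (k ∈? S) (ω k))

  ∑-spanningTreesThrough : ∀ k f →
    ∑ (spanningTreesThrough G k) f ≈ ∑ (spanningTrees G) (λ T → ⟦ k ∈? T ⟧ * f T)
  ∑-spanningTreesThrough k f = trans (∑-filter (k ∈?_) f (spanningTrees G))
    (∑-cong (spanningTrees G) {f = λ T → when (k ∈? T) (f T)} (λ T → when-⟦⟧ (k ∈? T) (f T)))

  module MeanCurrents
    (ν : Carrier) (n*ν≈1 : (n ×ₙ 1#) * ν ≈ 1#)
    (ω : Fin m → Carrier) (ω-real : ∀ k → Real (ω k))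
    (τ : Carrier) (τ*∑μ≈1 : τ * ∑ (spanningTrees G) (treeWeight ω) ≈ 1#)
    where
    open Normalised ν n*ν≈1

    μ : Subset m → Carrier
    μ = treeWeight ω

    meanCurrent : Fin m → Fin n → Carrier
    meanCurrent k j = τ * ∑ (spanningTreesThrough G k) (λ T → μ T * current T k j)

    sum-meanCurrent : ∀ k → sum (meanCurrent k) ≈ 0#
    sum-meanCurrent k = begin
      sum (meanCurrent k)
        ≈⟨ *-distribˡ-sum {n} τ (λ j → ∑ Ts (λ T → μ T * current T k j)) ⟨
      τ * sum (λ j → ∑ Ts (λ T → μ T * current T k j))
        ≈⟨ *-congˡ (∑-comm {n} {length Ts} (λ j r → μ (lookup Ts r) * current (lookup Ts r) k j)) ⟩
      τ * ∑ Ts (λ T → sum (λ j → μ T * current T k j))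
        ≈⟨ *-congˡ (sum-zero {length Ts} (λ r → trans (sym (*-distribˡ-sum {n} _ (current (lookup Ts r) k)))
             (trans (*-congˡ (sum-current (lookup Ts r) k)) (zeroʳ _)))) ⟩
      τ * 0#  ≈⟨ zeroʳ τ ⟩
      0#      ∎
      where
      Ts : List (Subset m)
      Ts = spanningTreesThrough G k

    -- After exchanging the sums over edges and trees, every tree contributes the same value, and
    -- the normalised weights add up to 1.
    meanCurrent-balance : ∀ i j → sum (λ k → B i k * meanCurrent k j) ≈ ⟦ i ≟ j ⟧ - ν
    meanCurrent-balance i j = begin
      sum (λ k → B i k * meanCurrent k j)
        ≈⟨ sum-cong-≋ {m} (λ k → trans
             (solve 3 (λ b t s → b :* (t :* s) := t :* (b :* s)) refl (B i k) τ (∑ (spanningTreesThrough G k) (λ T → μ T * current T k j)))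
             (*-congˡ (through k))) ⟩
      sum (λ k → τ * ∑ Ts (λ T → μ T * (⟦ k ∈? T ⟧ * (B i k * current T k j))))
        ≈⟨ *-distribˡ-sum {m} τ (λ k → ∑ Ts (λ T → μ T * (⟦ k ∈? T ⟧ * (B i k * current T k j)))) ⟨
      τ * sum (λ k → ∑ Ts (λ T → μ T * (⟦ k ∈? T ⟧ * (B i k * current T k j))))
        ≈⟨ *-congˡ (∑-comm {m} {length Ts} (λ k r → μ (lookup Ts r) * (⟦ k ∈? lookup Ts r ⟧ * (B i k * current (lookup Ts r) k j)))) ⟩
      τ * ∑ Ts (λ T → sum (λ k → μ T * (⟦ k ∈? T ⟧ * (B i k * current T k j))))
        ≈⟨ *-congˡ (∑-filter-cong tree? (subsets m) (λ T isTree → trans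
             (sym (*-distribˡ-sum {m} (μ T) (λ k → ⟦ k ∈? T ⟧ * (B i k * current T k j))))
             (*-congˡ (current-balance (spanningTree⇒tree isTree) i j)))) ⟩
      τ * ∑ Ts (λ T → μ T * (⟦ i ≟ j ⟧ - ν))
        ≈⟨ *-congˡ (*-distribʳ-sum {length Ts} (⟦ i ≟ j ⟧ - ν) (λ r → μ (lookup Ts r))) ⟨
      τ * (∑ Ts μ * (⟦ i ≟ j ⟧ - ν))  ≈⟨ *-assoc _ _ _ ⟨
      τ * ∑ Ts μ * (⟦ i ≟ j ⟧ - ν)    ≈⟨ *-congʳ τ*∑μ≈1 ⟩
      1# * (⟦ i ≟ j ⟧ - ν)            ≈⟨ *-identityˡ _ ⟩
      ⟦ i ≟ j ⟧ - ν                   ∎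
      where
      Ts : List (Subset m)
      Ts = spanningTrees G
      through : ∀ k → B i k * ∑ (spanningTreesThrough G k) (λ T → μ T * current T k j)
                    ≈ ∑ Ts (λ T → μ T * (⟦ k ∈? T ⟧ * (B i k * current T k j)))
      through k = begin
        B i k * ∑ (spanningTreesThrough G k) (λ T → μ T * current T k j)
          ≈⟨ *-congˡ (∑-spanningTreesThrough k (λ T → μ T * current T k j)) ⟩
        B i k * ∑ Ts (λ T → ⟦ k ∈? T ⟧ * (μ T * current T k j))
          ≈⟨ *-distribˡ-sum {length Ts} (B i k) (λ r → ⟦ k ∈? lookup Ts r ⟧ * (μ (lookup Ts r) * current (lookup Ts r) k j)) ⟩
        ∑ Ts (λ T → B i k * (⟦ k ∈? T ⟧ * (μ T * current T k j)))
          ≈⟨ ∑-cong Ts {f = λ T → B i k * (⟦ k ∈? T ⟧ * (μ T * current T k j))} (λ T →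
               solve 4 (λ b t u y → b :* (t :* (u :* y)) := u :* (t :* (b :* y))) refl
                       (B i k) ⟦ k ∈? T ⟧ (μ T) (current T k j)) ⟩
        ∑ Ts (λ T → μ T * (⟦ k ∈? T ⟧ * (B i k * current T k j))) ∎

    μ-⊕ : ∀ {S k} → k ∉ S → μ (S ⊕ k) ≈ ω k * μ S
    μ-⊕ {S} {k} k∉S = Π.sum-scale {m} k
      (trans (Π.when-yes (k ∈? S ⊕ k) (∈-⊕ S k))
        (sym (trans (*-congˡ (Π.when-no (k ∈? S) k∉S)) (*-identityʳ _))))
      (λ l l≢k → Π.when-⇔ (l ∈? S ⊕ k) (l ∈? S) (∈-⊕⁻ l≢k) ⊆-⊕)

    -- The spanning forests with two components.
    Forest : Subset m → Set
    Forest F = ∃[ k ] k ∉ F × Tree (F ⊕ k)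

    forest? : Decidable Forest
    forest? F = any? (λ k → ¬? (k ∈? F) ×-dec map′ spanningTree⇒tree tree⇒spanningTree (tree? (F ⊕ k)))

    -- If `a` and `j` lie in one component, this is the fraction of vertices in the other one;
    -- otherwise it is 0. With s the share of the tail side, its difference along an edge `k` that
    -- closes `F` is 1 - s for `j` on the tail side and -s for `j` on the head side, which is the
    -- current. A current fixes a potential only up to a constant for each `j`; this choice is
    -- symmetric in `a` and `j`.
    forestPotential : Subset m → Fin n → Fin n → Carrier
    forestPotential F a j = ρ F a j * (1# - share F a)

    potential : Fin n → Fin n → Carrier
    potential a j = τ * ∑ (subsets m) (λ F → when (forest? F) (μ F * forestPotential F a j))

    -- Kirchhoff's voltage law for a single forest: if k closes F to a tree, the
    -- current in that tree is the potential difference along k, and otherwise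
    -- the ends of k have the same potential.
    forest-voltage : ∀ k j F →
      when (¬? (k ∈? F)) (when (tree? (F ⊕ k)) (μ (F ⊕ k) * current (F ⊕ k) k j)) ≈
      ω k * (when (forest? F) (μ F * forestPotential F (tail k) j)
             - when (forest? F) (μ F * forestPotential F (head k) j))
    forest-voltage k j F = by-cases (reach? F (tail k) (head k)) (forest? F)
      where
      V : Carrier
      V = when (forest? F) (μ F * forestPotential F (tail k) j)
          - when (forest? F) (μ F * forestPotential F (head k) j)

      no-tree : ¬ (k ∉ F × Tree (F ⊕ k)) → V ≈ 0# → _ ≈ ω k * V
      no-tree ¬t V≈0 = trans lhs≈0 (sym (trans (*-congˡ V≈0) (zeroʳ _)))
        where
        lhs≈0 : when (¬? (k ∈? F)) (when (tree? (F ⊕ k)) (μ (F ⊕ k) * current (F ⊕ k) k j)) ≈ 0#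
        lhs≈0 with k ∈? F
        ... | yes _  = refl
        ... | no k∉F = when-no (tree? (F ⊕ k)) (λ t → ¬t (k∉F , spanningTree⇒tree t))

      by-cases : Dec (Reach F (tail k) (head k)) → Dec (Forest F) → _ ≈ ω k * V
      -- Both ends of `k` lie in one component of `F`: closing by `k` does not give a tree, and the
      -- two potentials agree, so both sides vanish.
      by-cases (yes r) _ = no-tree
        (λ (k∉F , t) → Tree.bridge t (∈-⊕ F k)
          (≡.subst (λ S → Reach S (tail k) (head k)) (≡.sym (⊕-cancel k∉F)) r))
        (trans (+-congˡ (-‿cong (when-cong (forest? F) (λ _ → *-congˡ (sym
          (*-cong (ρ-congˡ r j) (+-congˡ (-‿cong (share-cong r)))))))))
          (-‿inverseʳ _))
      by-cases (no _) (no ¬f) = no-tree (λ t → ¬f (k , t))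
        (trans (+-cong (when-no (forest? F) ¬f) (-‿cong (when-no (forest? F) ¬f))) (-‿inverseʳ 0#))
      -- The forest is witnessed by some edge `l`; since `F` separates the ends of `k`, `exchange`
      -- shows that `k` closes it as well.
      by-cases (no t≁h) (yes f@(l , l∉F , t)) with exchange l∉F t t≁h
      ... | k∉F , t′ = begin
        _ ≈⟨ when-yes (¬? (k ∈? F)) k∉F ⟩
        _ ≈⟨ when-yes (tree? (F ⊕ k)) (tree⇒spanningTree t′) ⟩
        μ (F ⊕ k) * current (F ⊕ k) k j
          ≈⟨ *-cong (μ-⊕ k∉F) (reflexive (≡.cong (λ S → ρ S (tail k) j - share S (tail k)) (⊕-cancel k∉F))) ⟩
        ω k * μ F * (ρ F (tail k) j - share F (tail k))
          -- This is r - s = r (1 - s) - (1 - r) s, with s written as 1 - (1 - s): 1 - r and 1 - s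
          -- are the indicator and the share at the head.
          ≈⟨ solve 4 (λ w u r s → w :* u :* (r :- s) :=
                        w :* (u :* (r :* (con ℤ.1ℤ :- s)) :- u :* ((con ℤ.1ℤ :- r) :* (con ℤ.1ℤ :- (con ℤ.1ℤ :- s)))))
               refl (ω k) (μ F) (ρ F (tail k) j) (share F (tail k)) ⟩
        ω k * (μ F * forestPotential F (tail k) j
               - μ F * ((1# - ρ F (tail k) j) * (1# - (1# - share F (tail k)))))
          ≈⟨ *-congˡ (+-congˡ (-‿cong (*-congˡ (*-cong (ρ-complement t≁h cover j)
               (+-congˡ (-‿cong (share-complement t≁h cover))))))) ⟨
        ω k * (μ F * forestPotential F (tail k) j - μ F * forestPotential F (head k) j)
          ≈⟨ *-congˡ (+-cong (when-yes (forest? F) f) (-‿cong (when-yes (forest? F) f))) ⟨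
        ω k * V ∎
        where
        cover : ∀ v → Reach F (tail k) v ⊎ Reach F (head k) v
        cover = ≡.subst (λ S → ∀ v → Reach S (tail k) v ⊎ Reach S (head k) v)
                        (⊕-cancel k∉F) (component t′ (∈-⊕ F k))

    -- `potential` sums over all forests, whatever `k` is: those that `k` does not close contribute
    -- equally at its two ends. So one potential serves all edges.
    voltage : ∀ k j → meanCurrent k j ≈ ω k * (potential (tail k) j - potential (head k) j)
    voltage k j = begin
      τ * ∑ (spanningTreesThrough G k) f
        ≈⟨ *-congˡ (trans (∑-filter (k ∈?_) f (spanningTrees G)) (∑-filter tree? (λ T → when (k ∈? T) (f T)) (subsets m))) ⟩
      τ * ∑ (subsets m) (λ T → when (tree? T) (when (k ∈? T) (f T)))
        ≈⟨ *-congˡ (∑-cong (subsets m) {f = λ T → when (tree? T) (when (k ∈? T) (f T))} (λ T → when-comm (tree? T) (k ∈? T))) ⟩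
      τ * ∑ (subsets m) (λ T → when (k ∈? T) (when (tree? T) (f T)))
        ≈⟨ *-congˡ (∑-insert k (λ T → when (tree? T) (f T))) ⟩
      τ * ∑ (subsets m) (λ F → when (¬? (k ∈? F)) (when (tree? (F ⊕ k)) (f (F ⊕ k))))
        ≈⟨ *-congˡ (∑-cong (subsets m) (forest-voltage k j)) ⟩
      τ * ∑ (subsets m) (λ F → ω k * (g (tail k) F - g (head k) F))
        ≈⟨ *-congˡ (*-distribˡ-sum (ω k) (λ r → g (tail k) (lookup (subsets m) r) - g (head k) (lookup (subsets m) r))) ⟨
      τ * (ω k * ∑ (subsets m) (λ F → g (tail k) F - g (head k) F))
        ≈⟨ *-congˡ (*-congˡ (sum-minus (λ r → g (tail k) (lookup (subsets m) r)) (λ r → g (head k) (lookup (subsets m) r)))) ⟩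
      τ * (ω k * (∑ (subsets m) (g (tail k)) - ∑ (subsets m) (g (head k))))
        ≈⟨ solve 4 (λ t w a b → t :* (w :* (a :- b)) := w :* (t :* a :- t :* b)) refl
                   τ (ω k) (∑ (subsets m) (g (tail k))) (∑ (subsets m) (g (head k))) ⟩
      ω k * (potential (tail k) j - potential (head k) j) ∎
      where
      f : Subset m → Carrier
      f T = μ T * current T k j
      g : Fin n → Subset m → Carrier
      g a F = when (forest? F) (μ F * forestPotential F a j)

    -- In each forest, `a` and `b` either lie in one component and have equal shares, or both values
    -- are 0.
    potential-sym : ∀ a b → potential a b ≈ potential b a
    potential-sym a b = *-congˡ (∑-cong (subsets m) {f = λ F → when (forest? F) (μ F * forestPotential F a b)}
      (λ F → when-cong (forest? F) (λ _ → *-congˡ (symmetric F))))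
      where
      symmetric : ∀ F → forestPotential F a b ≈ forestPotential F b a
      symmetric F = by-cases (reach? F a b)
        where
        by-cases : Dec (Reach F a b) → forestPotential F a b ≈ forestPotential F b a
        by-cases (yes r) = *-cong (ρ-sym F a b) (+-congˡ (-‿cong (share-cong r)))
        by-cases (no ¬r) = trans (vanishes ¬r) (sym (vanishes (¬r ∘ Reach-sym)))
          where
          vanishes : ∀ {a b} → ¬ Reach F a b → forestPotential F a b ≈ 0#
          vanishes ¬r = trans (*-congʳ (when-no (reach? F _ _) ¬r)) (zeroˡ _)

    μ-real : ∀ S → Real (μ S)
    μ-real S = real-Π _ (λ k → real-Π-when k (k ∈? S))
      where
      real-Π-when : ∀ k {P : Set} (d : Dec P) → Real (Π.when d (ω k))
      real-Π-when k (yes _) = ω-real k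
      real-Π-when k (no _)  = real-1

    τ-real : Real τ
    τ-real = real-inverse (real-sum _ (λ r → μ-real (lookup (spanningTrees G) r))) (trans (*-comm _ _) τ*∑μ≈1)

    ν-real : Real ν
    ν-real = real-inverse (real-× n) n*ν≈1

    share-real : ∀ S a → Real (share S a)
    share-real S a = real-* ν-real (real-sum (ρ S a) (λ v → real-when (reach? S a v) real-1))

    potential-real : ∀ a j → Real (potential a j)
    potential-real a j = real-* τ-real (real-sum _ (λ r → let F = lookup (subsets m) r in
      real-when (forest? F) (real-* (μ-real F)
        (real-* (real-when (reach? F a j) real-1) (real-minus real-1 (share-real F a))))))

    -- Switching by units: the Penrose equations for the graph and its trees

    module Switched
      (x : Fin n → Carrier) (x-unit : ∀ i → x i * conj (x i) ≈ 1#)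
      (c c⁻¹ : Fin m → Carrier) (c-inverse : ∀ k → c k * c⁻¹ k ≈ 1#) (c-norm : ∀ k → conj (c k) * c k ≈ ω k)
      where

      -- The oriented incidence matrix with edge weights ω, up to phases: `x` switches the vertices,
      -- and `c` is a square root of ω up to a phase. That phase is left free so that the entries
      -- can be matched with principal roots.
      incidenceMatrix : Matrix n m
      incidenceMatrix i k = c k * x i * B i k

      inverseMatrix : Matrix m n
      inverseMatrix k j = c⁻¹ k * conj (x j) * meanCurrent k j

      treeMatrix : Subset m → Matrix m n
      treeMatrix T k j = c⁻¹ k * conj (x j) * current T k j

      -- This is I - ν x x*, the projection onto the orthogonal complement of `x`; on the diagonal
      -- the units cancel.
      projection : Matrix n n
      projection i j = x i * conj (x j) * (⟦ i ≟ j ⟧ - ν)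

      projection-hermitian : projection ᴴ ≋ projection
      projection-hermitian i j = begin
        conj (x j * conj (x i) * (⟦ j ≟ i ⟧ - ν))
          ≈⟨ trans (conj-* _ _) (*-cong (trans (conj-* _ _) (*-congˡ (conj-conj (x i))))
               (real-minus (real-when (j ≟ i) real-1) ν-real)) ⟩
        conj (x j) * x i * (⟦ j ≟ i ⟧ - ν)
          ≈⟨ *-cong (*-comm _ _) (+-congʳ (⟦≟⟧-sym j i)) ⟩
        projection i j ∎

      switch : ∀ k (f : Fin n → Carrier) l → sum (λ i → c⁻¹ k * conj (x i) * f i * incidenceMatrix i l) ≈
                   c⁻¹ k * c l * (f (tail l) - f (head l))
      switch k f l = begin
        sum (λ i → c⁻¹ k * conj (x i) * f i * (c l * x i * B i l))
          ≈⟨ sum-cong-≋ {n} (λ i → trans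
               (solve 6 (λ d c x x̄ f b → d :* x̄ :* f :* (c :* x :* b) := (x :* x̄) :* (d :* c :* (f :* b))) refl
                        (c⁻¹ k) (c l) (x i) (conj (x i)) (f i) (B i l))
               (trans (*-congʳ (x-unit i)) (*-identityˡ _))) ⟩
        sum (λ i → c⁻¹ k * c l * (f i * B i l))  ≈⟨ *-distribˡ-sum {n} (c⁻¹ k * c l) (λ i → f i * B i l) ⟨
        c⁻¹ k * c l * sum (λ i → f i * B i l)    ≈⟨ *-congˡ (sum-B f l) ⟩
        c⁻¹ k * c l * (f (tail l) - f (head l))  ∎

      projection-incidence : projection · incidenceMatrix ≋ incidenceMatrix
      projection-incidence i k = begin
        sum (λ j → x i * conj (x j) * (⟦ i ≟ j ⟧ - ν) * (c k * x j * B j k))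
          ≈⟨ sum-cong-≋ {n} (λ j → trans
               (solve 6 (λ y x̄ d c x b → y :* x̄ :* d :* (c :* x :* b) := (x :* x̄) :* ((c :* y) :* (d :* b))) refl
                        (x i) (conj (x j)) (⟦ i ≟ j ⟧ - ν) (c k) (x j) (B j k))
               (trans (*-congʳ (x-unit j)) (*-identityˡ _))) ⟩
        sum (λ j → c k * x i * ((⟦ i ≟ j ⟧ - ν) * B j k))  ≈⟨ *-distribˡ-sum {n} _ (λ j → (⟦ i ≟ j ⟧ - ν) * B j k) ⟨
        c k * x i * sum (λ j → (⟦ i ≟ j ⟧ - ν) * B j k)    ≈⟨ *-congˡ (sum-B (λ j → ⟦ i ≟ j ⟧ - ν) k) ⟩
        c k * x i * ((⟦ i ≟ tail k ⟧ - ν) - (⟦ i ≟ head k ⟧ - ν))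
          ≈⟨ *-congˡ (solve 3 (λ a b v → (a :- v) :- (b :- v) := a :- b) refl ⟦ i ≟ tail k ⟧ ⟦ i ≟ head k ⟧ ν) ⟩
        c k * x i * (⟦ i ≟ tail k ⟧ - ⟦ i ≟ head k ⟧)
          ≈⟨ *-congˡ (+-cong (⟦≟⟧-sym i (tail k)) (-‿cong (⟦≟⟧-sym i (head k)))) ⟩
        incidenceMatrix i k ∎

      -- `p` is the indicator of a tree in `tree-penrose` and constantly 1 in `incidence-inverse`,
      -- so that the phases are cancelled once for both.
      balance : ∀ i j (p : Fin m → Carrier) (y : Fin m → Carrier) →
        sum (λ k → p k * (B i k * y k)) ≈ ⟦ i ≟ j ⟧ - ν →
        sum (λ k → p k * (incidenceMatrix i k * (c⁻¹ k * conj (x j) * y k))) ≈ projection i j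
      balance i j p y h = begin
        sum (λ k → p k * (c k * x i * B i k * (c⁻¹ k * conj (x j) * y k)))
          ≈⟨ sum-cong-≋ {m} (λ k → trans
               (solve 7 (λ p c d x x̄ b y → p :* (c :* x :* b :* (d :* x̄ :* y)) := (c :* d) :* ((x :* x̄) :* (p :* (b :* y)))) refl
                        (p k) (c k) (c⁻¹ k) (x i) (conj (x j)) (B i k) (y k))
               (trans (*-congʳ (c-inverse k)) (*-identityˡ _))) ⟩
        sum (λ k → x i * conj (x j) * (p k * (B i k * y k)))
          ≈⟨ *-distribˡ-sum {m} (x i * conj (x j)) (λ k → p k * (B i k * y k)) ⟨
        x i * conj (x j) * sum (λ k → p k * (B i k * y k))  ≈⟨ *-congˡ h ⟩
        projection i j ∎

      incidence-inverse : incidenceMatrix · inverseMatrix ≋ projection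
      incidence-inverse i j = trans (sum-cong-≋ {m} (λ k → sym (*-identityˡ _)))
        (balance i j (λ _ → 1#) (λ k → meanCurrent k j)
          (trans (sum-cong-≋ {m} (λ k → *-identityˡ _)) (meanCurrent-balance i j)))

      inverse-projection : inverseMatrix · projection ≋ inverseMatrix
      inverse-projection k i = begin
        sum (λ j → c⁻¹ k * conj (x j) * y j * (x j * conj (x i) * (⟦ j ≟ i ⟧ - ν)))
          ≈⟨ sum-cong-≋ {n} (λ j → trans (*-congˡ (*-congˡ (+-congʳ (⟦≟⟧-sym j i)))) (trans
               (solve 7 (λ d x̄ y x z e v → d :* x̄ :* y :* (x :* z :* (e :- v)) := (x :* x̄) :* ((d :* z) :* (y :* e :- v :* y))) refl
                        (c⁻¹ k) (conj (x j)) (y j) (x j) (conj (x i)) ⟦ i ≟ j ⟧ ν)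
               (trans (*-congʳ (x-unit j)) (*-identityˡ _)))) ⟩
        sum (λ j → c⁻¹ k * conj (x i) * (y j * ⟦ i ≟ j ⟧ - ν * y j))
          ≈⟨ *-distribˡ-sum {n} _ (λ j → y j * ⟦ i ≟ j ⟧ - ν * y j) ⟨
        c⁻¹ k * conj (x i) * sum (λ j → y j * ⟦ i ≟ j ⟧ - ν * y j)
          ≈⟨ *-congˡ (sum-minus {n} (λ j → y j * ⟦ i ≟ j ⟧) (λ j → ν * y j)) ⟩
        c⁻¹ k * conj (x i) * (sum (λ j → y j * ⟦ i ≟ j ⟧) - sum (λ j → ν * y j))
          ≈⟨ *-congˡ (+-cong (sum-⟦≟⟧ y i) (-‿cong (trans (sym (*-distribˡ-sum {n} ν y)) (trans (*-congˡ (sum-meanCurrent k)) (zeroʳ ν))))) ⟩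
        c⁻¹ k * conj (x i) * (y i - 0#)
          ≈⟨ *-congˡ (solve 1 (λ a → a :- con ℤ.0ℤ := a) refl (y i)) ⟩
        inverseMatrix k i ∎
        where
        y : Fin n → Carrier
        y = meanCurrent k

      -- The voltage law supplies a factor ω k, which turns c⁻¹ k into the conjugate of c k. The
      -- entry becomes a mixed second difference of a real symmetric potential, and hermiticity can
      -- be read off.
      inverse-incidence : ∀ k l → (inverseMatrix · incidenceMatrix) k l ≈
        conj (c k) * c l * (potential (tail k) (tail l) - potential (head k) (tail l)
                           - (potential (tail k) (head l) - potential (head k) (head l)))
      inverse-incidence k l = begin
        (inverseMatrix · incidenceMatrix) k l  ≈⟨ switch k (meanCurrent k) l ⟩
        c⁻¹ k * c l * (meanCurrent k (tail l) - meanCurrent k (head l))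
          ≈⟨ *-congˡ (+-cong (voltage k (tail l)) (-‿cong (voltage k (head l)))) ⟩
        c⁻¹ k * c l * (ω k * p - ω k * q)
          ≈⟨ *-congˡ (+-cong (*-congʳ (c-norm k)) (-‿cong (*-congʳ (c-norm k)))) ⟨
        c⁻¹ k * c l * (conj (c k) * c k * p - conj (c k) * c k * q)
          ≈⟨ solve 6 (λ d e c̄ c p q → d :* e :* (c̄ :* c :* p :- c̄ :* c :* q) := (c :* d) :* (c̄ :* e :* (p :- q))) refl
                     (c⁻¹ k) (c l) (conj (c k)) (c k) p q ⟩
        c k * c⁻¹ k * (conj (c k) * c l * (p - q))  ≈⟨ trans (*-congʳ (c-inverse k)) (*-identityˡ _) ⟩
        conj (c k) * c l * (p - q) ∎
        where
        p q : Carrier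
        p = potential (tail k) (tail l) - potential (head k) (tail l)
        q = potential (tail k) (head l) - potential (head k) (head l)

      inverse-incidence-hermitian : (inverseMatrix · incidenceMatrix) ᴴ ≋ inverseMatrix · incidenceMatrix
      inverse-incidence-hermitian k l = begin
        conj ((inverseMatrix · incidenceMatrix) l k)
          ≈⟨ conj-cong (inverse-incidence l k) ⟩
        conj (conj (c l) * c k * (φ (tail l) (tail k) - φ (head l) (tail k) - (φ (tail l) (head k) - φ (head l) (head k))))
          ≈⟨ trans (conj-* _ _) (*-cong (trans (conj-* _ _) (*-congʳ (conj-conj (c l))))
               (real-minus (real-minus (potential-real _ _) (potential-real _ _))
                           (real-minus (potential-real _ _) (potential-real _ _)))) ⟩
        c l * conj (c k) * (φ (tail l) (tail k) - φ (head l) (tail k) - (φ (tail l) (head k) - φ (head l) (head k)))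
          ≈⟨ *-congˡ (+-cong (+-cong (potential-sym _ _) (-‿cong (potential-sym _ _)))
               (-‿cong (+-cong (potential-sym _ _) (-‿cong (potential-sym _ _))))) ⟩
        c l * conj (c k) * (φ (tail k) (tail l) - φ (tail k) (head l) - (φ (head k) (tail l) - φ (head k) (head l)))
          ≈⟨ solve 6 (λ c d p q r s → c :* d :* (p :- q :- (r :- s)) := d :* c :* (p :- r :- (q :- s))) refl
                     (c l) (conj (c k)) (φ (tail k) (tail l)) (φ (tail k) (head l)) (φ (head k) (tail l)) (φ (head k) (head l)) ⟩
        conj (c k) * c l * (φ (tail k) (tail l) - φ (head k) (tail l) - (φ (tail k) (head l) - φ (head k) (head l)))
          ≈⟨ inverse-incidence k l ⟨
        (inverseMatrix · incidenceMatrix) k l ∎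
        where
        φ : Fin n → Fin n → Carrier
        φ = potential

      graph-penrose : Penrose (incidenceMatrix · incidenceMatrix ᴴ) (inverseMatrix ᴴ · inverseMatrix)
      graph-penrose = gram-penrose incidenceMatrix inverseMatrix projection
        incidence-inverse projection-hermitian projection-incidence inverse-projection inverse-incidence-hermitian

      tree-penrose : ∀ {T} → Tree T →
        Penrose (λ i r → incidenceMatrix i (lookup (edges T) r)) (λ r → treeMatrix T (lookup (edges T) r))
      tree-penrose {T} isTree = leftInverse-penrose N M projection NM≋E projection-hermitian
        (λ i r → projection-incidence i (edge r)) (λ r s → ⟦ r ≟ s ⟧) MN≋I
        (λ r s → trans (real-when (s ≟ r) real-1) (⟦≟⟧-sym s r))
        (λ r j → trans (sum-cong-≋ {length (edges T)} (λ s → *-comm _ _)) (sum-⟦≟⟧ (λ s → M s j) r))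
        where
        edge : Fin (length (edges T)) → Fin m
        edge = lookup (edges T)

        edge∈T : ∀ r → edge r ∈ T
        edge∈T = lookup-edges T

        edge-injective : ∀ {r s} → edge r ≡ edge s → r ≡ s
        edge-injective = unique-lookup (Unique.filter⁺ (_∈? T) (Unique.allFin⁺ m))

        N : Matrix n (length (edges T))
        N i r = incidenceMatrix i (edge r)

        M : Matrix (length (edges T)) n
        M r = treeMatrix T (edge r)

        NM≋E : N · M ≋ projection
        NM≋E i j = begin
          ∑ (edges T) (λ k → incidenceMatrix i k * treeMatrix T k j)
            ≈⟨ ∑-filter-allFin (_∈? T) (λ k → incidenceMatrix i k * treeMatrix T k j) ⟩
          sum (λ k → when (k ∈? T) (incidenceMatrix i k * treeMatrix T k j))
            ≈⟨ sum-cong-≋ {m} (λ k → when-⟦⟧ (k ∈? T) _) ⟩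
          sum (λ k → ⟦ k ∈? T ⟧ * (incidenceMatrix i k * treeMatrix T k j))
            ≈⟨ balance i j (λ k → ⟦ k ∈? T ⟧) (λ k → current T k j) (current-balance isTree i j) ⟩
          projection i j ∎

        MN≋I : ∀ r s → (M · N) r s ≈ ⟦ r ≟ s ⟧
        MN≋I r s = begin
          (M · N) r s  ≈⟨ switch (edge r) (current T (edge r)) (edge s) ⟩
          c⁻¹ (edge r) * c (edge s) * (current T (edge r) (tail (edge s)) - current T (edge r) (head (edge s)))
            ≈⟨ *-congˡ (current-edge isTree (edge∈T r) (edge∈T s)) ⟩
          c⁻¹ (edge r) * c (edge s) * ⟦ edge r ≟ edge s ⟧
            ≈⟨ *-congˡ (when-⇔ (edge r ≟ edge s) (r ≟ s) edge-injective (≡.cong edge)) ⟩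
          c⁻¹ (edge r) * c (edge s) * ⟦ r ≟ s ⟧
            ≈⟨ diagonal ⟩
          ⟦ r ≟ s ⟧ ∎
          where
          diagonal : c⁻¹ (edge r) * c (edge s) * ⟦ r ≟ s ⟧ ≈ ⟦ r ≟ s ⟧
          diagonal with r ≟ s
          ... | yes ≡.refl = trans (*-identityʳ _) (trans (*-comm _ _) (c-inverse (edge r)))
          ... | no _       = zeroʳ _

-- Potentials on a tree with prescribed ratios along its edges

module TreePotential (K : CommutativeRing 0ℓ 0ℓ) (J : Involution K) {n m : ℕ} (G : OrientedGraph n m)
  where
  open CommutativeRing K hiding (zero)
  open Involution J
  open OrientedGraph G
  open Graph G
  open InvolutiveRing K J
  open IntegerSolver K
  open RawSemiringDefinitions (Semiring.rawSemiring semiring) using (_^_)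
  open SetoidReasoning setoid

  Unit : Carrier → Set
  Unit a = a * conj a ≈ 1#

  unit-* : ∀ {a b} → Unit a → Unit b → Unit (a * b)
  unit-* {a} {b} p q = begin
    a * b * conj (a * b)       ≈⟨ *-congˡ (conj-* a b) ⟩
    a * b * (conj a * conj b)  ≈⟨ solve 4 (λ a b c d → a :* b :* (c :* d) := (a :* c) :* (b :* d)) refl a b (conj a) (conj b) ⟩
    a * conj a * (b * conj b)  ≈⟨ trans (*-cong p q) (*-identityˡ 1#) ⟩
    1#                         ∎

  unit-Π : ∀ {k} (f : Fin k → Carrier) → (∀ i → Unit (f i)) → Unit (Π.sum f)
  unit-Π {zero}  f p = trans (*-identityˡ _) real-1
  unit-Π {suc k} f p = unit-* (p zero) (unit-Π (f ∘ suc) (p ∘ suc))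

  -- Removing an edge l of T separates only the ends of l, so the two values at
  -- the ends of l differ by the factor g l alone.
  treePotential : Subset m → (Fin m → Carrier) → Fin n → Carrier
  treePotential T g v = Π.sum (λ k → Π.when ((k ∈? T) ×-dec reach? (T ∖ k) (tail k) v) (g k))

  treePotential-edge : ∀ {T} → Tree T → ∀ g {l} → l ∈ T →
                       treePotential T g (tail l) ≈ g l * treePotential T g (head l)
  treePotential-edge {T} (tree _ bridge) g {l} l∈T = Π.sum-scale {m} l
    (trans (Π.when-yes ((l ∈? T) ×-dec reach? (T ∖ l) (tail l) (tail l)) (l∈T , Reach-refl))
      (sym (trans (*-congˡ (Π.when-no ((l ∈? T) ×-dec reach? (T ∖ l) (tail l) (head l)) (λ (_ , r) → bridge l∈T r)))
        (*-identityʳ _))))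
    (λ k k≢l → Π.when-⇔ ((k ∈? T) ×-dec reach? (T ∖ k) (tail k) (tail l)) ((k ∈? T) ×-dec reach? (T ∖ k) (tail k) (head l))
      (λ (k∈T , r) → k∈T , Reach-trans r (edge k≢l))
      (λ (k∈T , r) → k∈T , Reach-trans r (Reach-sym (edge k≢l))))
    where
    edge : ∀ {k} → k ≢ l → Reach (T ∖ k) (tail l) (head l)
    edge k≢l = Reach-edge (x∈p∧x≢y⇒x∈p-y l∈T (k≢l ∘ ≡.sym)) (joins-ends l)

  treePotential-unit : ∀ T g → (∀ k → Unit (g k)) → ∀ v → Unit (treePotential T g v)
  treePotential-unit T g p v = unit-Π {m} _ (λ k → unit-when k ((k ∈? T) ×-dec reach? (T ∖ k) (tail k) v))
    where
    unit-when : ∀ k {P : Set} (d : Dec P) → Unit (Π.when d (g k))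
    unit-when k (yes _) = p k
    unit-when k (no _)  = trans (*-identityˡ _) real-1

  real--1 : Real (- 1#)
  real--1 = real-neg real-1

  -- The 2-colouring of the tree by 1 and -1: the ratio is -1 along every edge.
  parity : Subset m → Fin n → Carrier
  parity T = treePotential T (λ _ → - 1#)

  parity-real : ∀ T v → Real (parity T v)
  parity-real T v = real-Π {m} _ (λ k → real-when-1 ((k ∈? T) ×-dec reach? (T ∖ k) (tail k) v))
    where
    real-when-1 : ∀ {P : Set} (d : Dec P) → Real (Π.when d (- 1#))
    real-when-1 (yes _) = real--1
    real-when-1 (no _)  = real-1

  parity-square : ∀ T v → parity T v * parity T v ≈ 1#
  parity-square T v = trans (*-congˡ (sym (parity-real T v)))
    (treePotential-unit T _ (λ _ → trans (*-congˡ real--1) (solve 0 (:- con ℤ.1ℤ :* :- con ℤ.1ℤ := con ℤ.1ℤ) refl)) v)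

  parity-edge : ∀ {T} → Tree T → ∀ {i j} → Adjacent G T i j → parity T i ≈ - 1# * parity T j
  parity-edge {T} isTree (k , k∈T , inj₁ (≡.refl , ≡.refl)) = treePotential-edge isTree _ k∈T
  parity-edge {T} isTree (k , k∈T , inj₂ (≡.refl , ≡.refl)) = begin
    parity T (head k)                    ≈⟨ solve 1 (λ p → p := :- con ℤ.1ℤ :* (:- con ℤ.1ℤ :* p)) refl _ ⟩
    - 1# * (- 1# * parity T (head k))    ≈⟨ *-congˡ (treePotential-edge isTree _ k∈T) ⟨
    - 1# * parity T (tail k)             ∎

  parity-walk : ∀ {T} → Tree T → ∀ {i j ℓ} → Walk T i j ℓ → parity T i ≈ (- 1#) ^ ℓ * parity T j
  parity-walk isTree ε       = sym (*-identityˡ _)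
  parity-walk isTree (a ◅ w) = trans (parity-edge isTree a)
    (trans (*-congˡ (parity-walk isTree w)) (sym (*-assoc _ _ _)))

  -- Each step changes the colour, so the sign depends only on the two ends and may be computed from
  -- any walk in the tree.
  sign-walk : ∀ {T} → Tree T → ∀ {i j ℓ} → Walk T i j ℓ → (- 1#) ^ ℓ ≈ parity T i * parity T j
  sign-walk {T} isTree {i} {j} {ℓ} w = begin
    (- 1#) ^ ℓ                                  ≈⟨ *-identityʳ _ ⟨
    (- 1#) ^ ℓ * 1#                             ≈⟨ *-congˡ (parity-square T j) ⟨
    (- 1#) ^ ℓ * (parity T j * parity T j)      ≈⟨ *-assoc _ _ _ ⟨
    (- 1#) ^ ℓ * parity T j * parity T j        ≈⟨ *-congʳ (parity-walk isTree w) ⟨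
    parity T i * parity T j                     ∎

-- An abstract modulus, and the formulas of the theorem over it

record Modulus (K : CommutativeRing 0ℓ 0ℓ) (J : Involution K) : Set where
  open CommutativeRing K
  open Involution J
  field
    abs         : Carrier → Carrier
    _⁻¹         : Carrier → Carrier
    abs-cong    : ∀ {a b} → a ≈ b → abs a ≈ abs b
    abs-real    : ∀ a → conj (abs a) ≈ abs a
    abs-square  : ∀ a → abs a * abs a ≈ a * conj a
    abs-*       : ∀ a b → abs (a * b) ≈ abs a * abs b
    abs-conj    : ∀ a → abs (conj a) ≈ abs a
    abs-unit    : ∀ a → a * conj a ≈ 1# → abs a ≈ 1#
    abs-0       : ∀ {a} → abs a ≈ 0# → a ≈ 0#
    abs-zero    : abs 0# ≈ 0#
    ⁻¹-inverseʳ : ∀ {a} → a ≉ 0# → a * a ⁻¹ ≈ 1#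
    1≉0         : 1# ≉ 0#

  infix 8 _⁻¹

module _ (K : CommutativeRing 0ℓ 0ℓ) {J : Involution K} (modulus : Modulus K J) where
  open CommutativeRing K
  open Modulus modulus
  open RawSemiringDefinitions (Semiring.rawSemiring semiring) using (_^_) renaming (_×_ to _×ₙ_)

  -- The expression in `treeInverse` with all graph data as arguments, so that it can be evaluated
  -- without unfolding complex arithmetic. Over ℂ the two agree by computation, see `treeFormula≡`.
  treeFormula : (n d s : ℕ) (r wt : Carrier) → Carrier
  treeFormula n d s r wt = (- 1#) ^ d * (n ×ₙ 1#) ⁻¹ * ((s ×ₙ 1#) * r ⁻¹) * (abs wt * wt ⁻¹)

module _ (K : CommutativeRing 0ℓ 0ℓ) (J : Involution K) {n m : ℕ} (G : OrientedGraph n m) where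
  open CommutativeRing K
  open Involution J
  open InvolutiveRing K J
  open RawSemiringDefinitions (Semiring.rawSemiring semiring) using (_^_)

  gramFormula : Carrier → (Subset m → Carrier) → (Subset m → Fin m → Fin n → Carrier) → Matrix n n
  gramFormula τ absW treeInv i j = τ ^ 2 * sum (λ k →
    ∑ (spanningTreesThrough G k) (λ Tr → ∑ (spanningTreesThrough G k) (λ Ts →
      absW Tr * absW Ts * conj (treeInv Tr k i) * treeInv Ts k j)))

-- Constructing the units from the cycle condition

module ModulusProperties (K : CommutativeRing 0ℓ 0ℓ) (J : Involution K) (modulus : Modulus K J) where
  open CommutativeRing K hiding (zero)
  open Involution J
  open Modulus modulus
  open InvolutiveRing K J
  open IntegerSolver K
  open RawSemiringDefinitions (Semiring.rawSemiring semiring) using (_^_)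
  open SetoidReasoning setoid

  *-cancelˡ : ∀ {z y y′} → z ≉ 0# → z * y ≈ z * y′ → y ≈ y′
  *-cancelˡ {z} {y} {y′} z≉0 e = trans (sym (undo y)) (trans (*-congˡ e) (undo y′))
    where
    undo : ∀ y → z ⁻¹ * (z * y) ≈ y
    undo y = trans (sym (*-assoc _ _ _)) (trans (*-congʳ (trans (*-comm _ _) (⁻¹-inverseʳ z≉0))) (*-identityˡ y))

  *-≉0 : ∀ {y z} → y ≉ 0# → z ≉ 0# → y * z ≉ 0#
  *-≉0 y≉0 z≉0 e = z≉0 (*-cancelˡ y≉0 (trans e (sym (zeroʳ _))))

  invertible≉0 : ∀ {z y} → z * y ≈ 1# → z ≉ 0#
  invertible≉0 e z≈0 = 1≉0 (trans (sym e) (trans (*-congʳ z≈0) (zeroˡ _)))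

  ⁻¹-unique : ∀ {z y} → z * y ≈ 1# → z ⁻¹ ≈ y
  ⁻¹-unique {z} e = *-cancelˡ (invertible≉0 e) (trans (⁻¹-inverseʳ (invertible≉0 e)) (sym e))

  abs≉0 : ∀ {z} → z ≉ 0# → abs z ≉ 0#
  abs≉0 z≉0 = z≉0 ∘ abs-0

  abs-1 : abs 1# ≈ 1#
  abs-1 = abs-unit 1# (trans (*-identityˡ _) real-1)

  conj≉0 : ∀ {z} → z ≉ 0# → conj z ≉ 0#
  conj≉0 z≉0 e = z≉0 (trans (sym (conj-conj _)) (trans (conj-cong e) real-0))

  module BalancedGraph {n m : ℕ} (G : OrientedGraph n m)
    (a : Fin n → Fin n → Carrier) (w : Fin m → Carrier) (w≉0 : ∀ k → w k ≉ 0#)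
    (a-forward  : ∀ k → a (OrientedGraph.tail G k) (OrientedGraph.head G k) ≈ w k)
    (a-backward : ∀ k → a (OrientedGraph.head G k) (OrientedGraph.tail G k) ≈ conj (w k))
    where
    open OrientedGraph G
    open Graph G
    open TreePotential K J G
    open TreeCurrents K J G
    open WeightedTrees K J G using (treeWeight)

    a-joins-≉0 : ∀ {k i j} → Joins k i j → a i j ≉ 0#
    a-joins-≉0 {k} (inj₁ (≡.refl , ≡.refl)) e = w≉0 k (trans (sym (a-forward k)) e)
    a-joins-≉0 {k} (inj₂ (≡.refl , ≡.refl)) e = conj≉0 (w≉0 k) (trans (sym (a-backward k)) e)

    weight : List (Fin n) → Carrier
    weight []          = 1#
    weight (i ∷ [])    = 1#
    weight (i ∷ j ∷ γ) = a i j * weight (j ∷ γ)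

    weight-≉0 : ∀ {S γ} → Linked (Adjacent G S) γ → weight γ ≉ 0#
    weight-≉0 []                = 1≉0
    weight-≉0 [-]               = 1≉0
    weight-≉0 ((_ , _ , J) ∷ l) = *-≉0 (a-joins-≉0 J) (weight-≉0 l)

    weight-∷ʳ : ∀ γ {i j} → List.last γ ≡ just j → weight (γ ∷ʳ i) ≈ weight γ * a j i
    weight-∷ʳ (_ ∷ [])        ≡.refl = trans (*-identityʳ _) (sym (*-identityˡ _))
    weight-∷ʳ (_ ∷ γ@(_ ∷ _)) e      = trans (*-congˡ (weight-∷ʳ γ e)) (sym (*-assoc _ _ _))

    closedWalk-head : ∀ {γ i} → List.head γ ≡ just i → closedWalk G γ ≡ γ ∷ʳ i
    closedWalk-head {_ ∷ _} ≡.refl = ≡.refl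

    -- The variant of `Balanced` without the minus sign: its factors telescope along walks with no
    -- sign to track.
    Aligned : (Fin n → Carrier) → Fin m → Set
    Aligned X k = w k ≈ abs (w k) * (X (tail k) * conj (X (head k)))

    a-aligned : ∀ {X k i j} → Aligned X k → Joins k i j → a i j ≈ abs (a i j) * (X i * conj (X j))
    a-aligned {X} {k} p (inj₁ (≡.refl , ≡.refl)) =
      trans (a-forward k) (trans p (*-congʳ (abs-cong (sym (a-forward k)))))
    a-aligned {X} {k} p (inj₂ (≡.refl , ≡.refl)) = begin
      a (head k) (tail k)                       ≈⟨ a-backward k ⟩
      conj (w k)                                ≈⟨ conj-cong p ⟩
      conj (abs (w k) * (X (tail k) * conj (X (head k))))
        ≈⟨ trans (conj-* _ _) (*-cong (abs-real _) (trans (conj-* _ _) (trans (*-congˡ (conj-conj _)) (*-comm _ _)))) ⟩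
      abs (w k) * (X (head k) * conj (X (tail k)))
        ≈⟨ *-congʳ (trans (abs-cong (a-backward k)) (abs-conj _)) ⟨
      abs (a (head k) (tail k)) * (X (head k) * conj (X (tail k))) ∎

    -- The units at inner vertices cancel in pairs, which leaves those at the two ends.
    weight-aligned : ∀ {X S} → (∀ v → Unit (X v)) → (∀ {k} → k ∈ S → Aligned X k) →
      ∀ {γ i j} → Linked (Adjacent G S) γ → List.head γ ≡ just i → List.last γ ≡ just j →
      weight γ ≈ abs (weight γ) * (X i * conj (X j))
    weight-aligned X-unit p {i = i} [-] ≡.refl ≡.refl =
      sym (trans (*-cong abs-1 (X-unit i)) (*-identityˡ 1#))
    weight-aligned {X} X-unit p {γ@(i ∷ γ′@(k ∷ _))} {j = j} ((e , e∈S , J) ∷ l) ≡.refl t = begin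
      a i k * weight γ′
        ≈⟨ *-cong (a-aligned (p e∈S) J) (weight-aligned X-unit p l ≡.refl t) ⟩
      abs (a i k) * (X i * conj (X k)) * (abs (weight γ′) * (X k * conj (X j)))
        ≈⟨ solve 6 (λ p x y q z u → p :* (x :* y) :* (q :* (z :* u)) := (z :* y) :* ((p :* q) :* (x :* u))) refl
                   (abs (a i k)) (X i) (conj (X k)) (abs (weight γ′)) (X k) (conj (X j)) ⟩
      X k * conj (X k) * (abs (a i k) * abs (weight γ′) * (X i * conj (X j)))
        ≈⟨ trans (*-congʳ (X-unit k)) (*-identityˡ _) ⟩
      abs (a i k) * abs (weight γ′) * (X i * conj (X j))
        ≈⟨ *-congʳ (abs-* _ _) ⟨
      abs (weight γ) * (X i * conj (X j)) ∎

    Balanced : (Fin n → Carrier) → Fin m → Set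
    Balanced x k = w k ≈ - (abs (w k) * (x (tail k) * conj (x (head k))))

    -- Multiplying by the parity of a tree exchanges the two conditions on the
    -- edges of the tree.
    parity-* : Subset m → (Fin n → Carrier) → Fin n → Carrier
    parity-* T x v = parity T v * x v

    parity-unit : ∀ T {x} → (∀ v → Unit (x v)) → ∀ v → Unit (parity-* T x v)
    parity-unit T x-unit v = unit-* (trans (*-congˡ (parity-real T v)) (parity-square T v)) (x-unit v)

    parity-product : ∀ T x i j → parity-* T x i * conj (parity-* T x j) ≈ parity T i * parity T j * (x i * conj (x j))
    parity-product T x i j = trans (*-congˡ (trans (conj-* _ _) (*-congʳ (parity-real T j))))
      (solve 4 (λ p x q y → p :* x :* (q :* y) := p :* q :* (x :* y)) refl (parity T i) (x i) (parity T j) (conj (x j)))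

    parity-ends : ∀ {T} → Tree T → ∀ {k} → k ∈ T → parity T (tail k) * parity T (head k) ≈ - 1#
    parity-ends {T} isTree {k} k∈T = begin
      parity T (tail k) * parity T (head k)           ≈⟨ *-congʳ (parity-edge isTree (k , k∈T , joins-ends k)) ⟩
      - 1# * parity T (head k) * parity T (head k)    ≈⟨ *-assoc _ _ _ ⟩
      - 1# * (parity T (head k) * parity T (head k))  ≈⟨ *-congˡ (parity-square T (head k)) ⟩
      - 1# * 1#                                       ≈⟨ *-identityʳ _ ⟩
      - 1#                                            ∎

    parity-flip : ∀ {T} → Tree T → ∀ x {k} → k ∈ T →
      abs (w k) * (parity-* T x (tail k) * conj (parity-* T x (head k))) ≈ - (abs (w k) * (x (tail k) * conj (x (head k))))
    parity-flip {T} isTree x {k} k∈T = begin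
      abs (w k) * (parity-* T x (tail k) * conj (parity-* T x (head k)))
        ≈⟨ *-congˡ (trans (parity-product T x (tail k) (head k)) (*-congʳ (parity-ends isTree k∈T))) ⟩
      abs (w k) * (- 1# * (x (tail k) * conj (x (head k))))
        ≈⟨ solve 2 (λ r y → r :* (:- con ℤ.1ℤ :* y) := :- (r :* y)) refl (abs (w k)) (x (tail k) * conj (x (head k))) ⟩
      - (abs (w k) * (x (tail k) * conj (x (head k)))) ∎

    balanced⇒aligned : ∀ {T} → Tree T → ∀ {x k} → k ∈ T → Balanced x k → Aligned (parity-* T x) k
    balanced⇒aligned isTree {x} k∈T p = trans p (sym (parity-flip isTree x k∈T))

    module _ {T : Subset m} (isTree : Tree T)
      (cycles : ∀ c → IsCycle G ⊤ c → (- 1#) ^ length c * weight (closedWalk G c) ≈ abs (weight (closedWalk G c)))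
      where

      private
        gain : Fin m → Carrier
        gain k = w k * (abs (w k)) ⁻¹

        abs*gain : ∀ k → abs (w k) * gain k ≈ w k
        abs*gain k = trans (solve 3 (λ r w i → r :* (w :* i) := w :* (r :* i)) refl (abs (w k)) (w k) ((abs (w k)) ⁻¹))
          (trans (*-congˡ (⁻¹-inverseʳ (abs≉0 (w≉0 k)))) (*-identityʳ _))

        gain-unit : ∀ k → Unit (gain k)
        gain-unit k = *-cancelˡ (*-≉0 (abs≉0 (w≉0 k)) (abs≉0 (w≉0 k))) (begin
          abs (w k) * abs (w k) * (gain k * conj (gain k))
            ≈⟨ solve 3 (λ r g h → r :* r :* (g :* h) := (r :* g) :* (r :* h)) refl (abs (w k)) (gain k) (conj (gain k)) ⟩
          abs (w k) * gain k * (abs (w k) * conj (gain k))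
            ≈⟨ *-congˡ (trans (conj-* _ _) (*-congʳ (abs-real _))) ⟨
          abs (w k) * gain k * conj (abs (w k) * gain k)  ≈⟨ *-cong (abs*gain k) (conj-cong (abs*gain k)) ⟩
          w k * conj (w k)                          ≈⟨ abs-square _ ⟨
          abs (w k) * abs (w k)                           ≈⟨ *-identityʳ _ ⟨
          abs (w k) * abs (w k) * 1#                      ∎)

        -- The phase w/|w| is prescribed as the ratio of `X` along each tree edge, so `X` is aligned
        -- on the tree by construction.
        X : Fin n → Carrier
        X = treePotential T gain

        X-unit : ∀ v → Unit (X v)
        X-unit = treePotential-unit T gain gain-unit

        X-aligned : ∀ {k} → k ∈ T → Aligned X k
        X-aligned {k} k∈T = begin
          w k                                          ≈⟨ abs*gain k ⟨
          abs (w k) * gain k                             ≈⟨ *-congˡ (trans (*-congˡ (X-unit (head k))) (*-identityʳ _)) ⟨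
          abs (w k) * (gain k * (X (head k) * conj (X (head k))))  ≈⟨ *-congˡ (trans (*-congʳ (treePotential-edge isTree gain k∈T)) (*-assoc _ _ _)) ⟨
          abs (w k) * (X (tail k) * conj (X (head k)))   ∎

        x : Fin n → Carrier
        x = parity-* T X

        -- Closing the tree path between the ends of k by k gives a cycle.
        non-tree-edge : ∀ {k} → k ∉ T → Balanced x k
        non-tree-edge {k} k∉T with reach⇒path (Tree.connected isTree (tail k) (head k))
        ... | γ , P@(_ , l , h , t) with path-length P
        ...   | ℓ , len = sym (begin
          - (abs (w k) * (x (tail k) * conj (x (head k))))
            ≈⟨ -‿cong (*-congˡ (trans (parity-product T X (tail k) (head k)) (*-congʳ (sym (sign-walk isTree (path⇒walk P len)))))) ⟩
          - (abs (w k) * (s * Y))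
            ≈⟨ solve 3 (λ r s y → :- (r :* (s :* y)) := (:- con ℤ.1ℤ :* s :* y) :* r) refl (abs (w k)) s Y ⟩
          (- 1# * s * Y) * abs (w k)       ≈⟨ *-congˡ conjugated ⟨
          (- 1# * s * Y) * (- 1# * s * conj Y * w k)
            ≈⟨ solve 4 (λ s y z w → (:- con ℤ.1ℤ :* s :* y) :* (:- con ℤ.1ℤ :* s :* z :* w) := (s :* s) :* (y :* z) :* w) refl s Y (conj Y) (w k) ⟩
          s * s * (Y * conj Y) * w k    ≈⟨ *-congʳ (trans (*-cong s-square Y-unit) (*-identityˡ 1#)) ⟩
          1# * w k                      ≈⟨ *-identityˡ _ ⟩
          w k ∎)
          where
          s Y : Carrier
          s = (- 1#) ^ ℓ
          Y = X (tail k) * conj (X (head k))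

          Y-unit : Unit Y
          Y-unit = unit-* (X-unit _) (trans (*-congˡ (conj-conj _)) (trans (*-comm _ _) (X-unit _)))

          s-parity : s ≈ parity T (tail k) * parity T (head k)
          s-parity = sign-walk isTree (path⇒walk P len)

          s-real : Real s
          s-real = real-resp (sym s-parity) (real-* (parity-real T _) (parity-real T _))

          s-square : s * s ≈ 1#
          s-square = trans (*-cong s-parity s-parity)
            (trans (solve 2 (λ p q → p :* q :* (p :* q) := (p :* p) :* (q :* q)) refl (parity T (tail k)) (parity T (head k)))
              (trans (*-cong (parity-square T _) (parity-square T _)) (*-identityˡ 1#)))

          closed-weight : weight (closedWalk G γ) ≈ weight γ * conj (w k)
          closed-weight = trans (reflexive (≡.cong weight (closedWalk-head h))) (trans (weight-∷ʳ γ t) (*-congˡ (a-backward k)))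

          -- `length γ` counts vertices and equals ℓ + 1; the extra factor -1 is the origin of the
          -- minus sign in `Balanced`. The closing step runs from `head k` to `tail k` and so
          -- contributes the conjugate of w k.
          cycle-condition : - 1# * s * (weight γ * conj (w k)) ≈ abs (weight γ) * abs (w k)
          cycle-condition = begin
            - 1# * s * (weight γ * conj (w k))
              ≈⟨ *-cong (reflexive (≡.cong ((- 1#) ^_) len)) closed-weight ⟨
            (- 1#) ^ length γ * weight (closedWalk G γ)
              ≈⟨ cycles γ (close-path (λ _ → ∈⊤) k∉T ∈⊤ P) ⟩
            abs (weight (closedWalk G γ))   ≈⟨ abs-cong closed-weight ⟩
            abs (weight γ * conj (w k))     ≈⟨ trans (abs-* _ _) (*-congˡ (abs-conj _)) ⟩
            abs (weight γ) * abs (w k)        ∎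

          cancelled : - 1# * s * Y * conj (w k) ≈ abs (w k)
          cancelled = *-cancelˡ (abs≉0 (weight-≉0 l)) (begin
            abs (weight γ) * (- 1# * s * Y * conj (w k))
              ≈⟨ solve 4 (λ r s y w → r :* (:- con ℤ.1ℤ :* s :* y :* w) := :- con ℤ.1ℤ :* s :* (r :* y :* w)) refl (abs (weight γ)) s Y (conj (w k)) ⟩
            - 1# * s * (abs (weight γ) * Y * conj (w k))
              ≈⟨ *-congˡ (*-congʳ (weight-aligned X-unit X-aligned l h t)) ⟨
            - 1# * s * (weight γ * conj (w k))  ≈⟨ cycle-condition ⟩
            abs (weight γ) * abs (w k) ∎)

          conjugated : - 1# * s * conj Y * w k ≈ abs (w k)
          conjugated = begin
            - 1# * s * conj Y * w k
              ≈⟨ *-cong (*-congʳ (*-cong real--1 s-real)) (conj-conj (w k)) ⟨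
            conj (- 1#) * conj s * conj Y * conj (conj (w k))
              ≈⟨ trans (conj-* _ _) (*-congʳ (trans (conj-* _ _) (*-congʳ (conj-* _ _)))) ⟨
            conj (- 1# * s * Y * conj (w k))  ≈⟨ conj-cong cancelled ⟩
            conj (abs (w k))                      ≈⟨ abs-real _ ⟩
            abs (w k)                           ∎

        tree-edge : ∀ {k} → k ∈ T → Balanced x k
        tree-edge {k} k∈T = begin
          w k                                                ≈⟨ X-aligned k∈T ⟩
          abs (w k) * (X (tail k) * conj (X (head k)))          ≈⟨ solve 1 (λ a → a := :- :- a) refl _ ⟩
          - - (abs (w k) * (X (tail k) * conj (X (head k))))    ≈⟨ -‿cong (parity-flip isTree X k∈T) ⟨
          - (abs (w k) * (x (tail k) * conj (x (head k))))      ∎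

      balancing : ∃[ x ] (∀ v → Unit (x v)) × (∀ k → Balanced x k)
      balancing = x , parity-unit T X-unit , balanced
        where
        balanced : ∀ k → Balanced x k
        balanced k with k ∈? T
        ... | yes k∈T = tree-edge k∈T
        ... | no k∉T  = non-tree-edge k∉T

    -- Identifying the switched matrices with the complex ones

    module Inverse
      (a-none : ∀ {i j} → ¬ Adjacent G ⊤ i j → a i j ≈ 0#)
      (x : Fin n → Carrier) (x-unit : ∀ v → Unit (x v)) (balanced : ∀ k → Balanced x k)
      (r : Fin m → Carrier) (r-square : ∀ k → r k * r k ≈ w k)
      (r-norm : ∀ k → r k * conj (r k) ≈ abs (w k))
      (n≉0 : n ×ₙ 1# ≉ 0#)
      (τ : Carrier) (τ*∑μ≈1 : τ * ∑ (spanningTrees G) (treeWeight (abs ∘ w)) ≈ 1#)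
      where

      private
        ν : Carrier
        ν = (n ×ₙ 1#) ⁻¹

        ω : Fin m → Carrier
        ω k = abs (w k)

        c c⁻¹ : Fin m → Carrier
        -- The phase is chosen so that the entry at the tail, c k times x (tail k), is r k. The
        -- entry at the head is then determined, and `conj-r` shows that it is the conjugate root.
        c k   = r k * conj (x (tail k))
        c⁻¹ k = x (tail k) * r k ⁻¹

        r≉0 : ∀ k → r k ≉ 0#
        r≉0 k e = w≉0 k (trans (sym (r-square k)) (trans (*-congʳ e) (zeroˡ _)))

        c-inverse : ∀ k → c k * c⁻¹ k ≈ 1#
        c-inverse k = begin
          r k * conj (x (tail k)) * (x (tail k) * r k ⁻¹)
            ≈⟨ solve 4 (λ r y x i → r :* y :* (x :* i) := (r :* i) :* (x :* y)) refl (r k) (conj (x (tail k))) (x (tail k)) (r k ⁻¹) ⟩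
          r k * r k ⁻¹ * (x (tail k) * conj (x (tail k)))
            ≈⟨ trans (*-cong (⁻¹-inverseʳ (r≉0 k)) (x-unit (tail k))) (*-identityˡ 1#) ⟩
          1# ∎

        c-norm : ∀ k → conj (c k) * c k ≈ ω k
        c-norm k = begin
          conj (r k * conj (x (tail k))) * (r k * conj (x (tail k)))
            ≈⟨ *-congʳ (trans (conj-* _ _) (*-congˡ (conj-conj _))) ⟩
          conj (r k) * x (tail k) * (r k * conj (x (tail k)))
            ≈⟨ solve 4 (λ q x r y → q :* x :* (r :* y) := (r :* q) :* (x :* y)) refl (conj (r k)) (x (tail k)) (r k) (conj (x (tail k))) ⟩
          r k * conj (r k) * (x (tail k) * conj (x (tail k)))
            ≈⟨ trans (*-cong (r-norm k) (x-unit (tail k))) (*-identityʳ _) ⟩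
          ω k ∎

      open Normalised ν (⁻¹-inverseʳ n≉0)
      open WeightedTrees.MeanCurrents K J G ν (⁻¹-inverseʳ n≉0) ω (abs-real ∘ w) τ τ*∑μ≈1
      open Switched x x-unit c c⁻¹ c-inverse c-norm public

      head≢tail : ∀ k → head k ≢ tail k
      head≢tail k e = loopless (inj₁ (≡.refl , e))

      -- With t and h for tail and head, r² = w = -|w| x_t x̄_h and |w| = r r̄. Cancelling r gives r
      -- = -r̄ x_t x̄_h, which is solved for r̄ by the unit property. Thus the minus sign of
      -- `Balanced` accounts for the opposite signs of `B` at the two ends.
      conj-r : ∀ k → conj (r k) ≈ - (r k * conj (x (tail k)) * x (head k))
      conj-r k = sym (begin
        - (r k * conj (x (tail k)) * x (head k))
          ≈⟨ -‿cong (*-congʳ (*-congʳ r≈)) ⟩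
        - (- (conj (r k) * x (tail k) * conj (x (head k))) * conj (x (tail k)) * x (head k))
          ≈⟨ solve 5 (λ q x y z u → :- (:- (q :* x :* y) :* z :* u) := q :* ((x :* z) :* (u :* y))) refl
                     (conj (r k)) (x (tail k)) (conj (x (head k))) (conj (x (tail k))) (x (head k)) ⟩
        conj (r k) * (x (tail k) * conj (x (tail k)) * (x (head k) * conj (x (head k))))
          ≈⟨ trans (*-congˡ (trans (*-cong (x-unit _) (x-unit _)) (*-identityˡ 1#))) (*-identityʳ _) ⟩
        conj (r k) ∎)
        where
        r≈ : r k ≈ - (conj (r k) * x (tail k) * conj (x (head k)))
        r≈ = *-cancelˡ (r≉0 k) (begin
          r k * r k                                              ≈⟨ trans (r-square k) (balanced k) ⟩
          - (ω k * (x (tail k) * conj (x (head k))))             ≈⟨ -‿cong (*-congʳ (r-norm k)) ⟨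
          - (r k * conj (r k) * (x (tail k) * conj (x (head k))))
            ≈⟨ solve 4 (λ r q x y → :- (r :* q :* (x :* y)) := r :* :- (q :* x :* y)) refl (r k) (conj (r k)) (x (tail k)) (conj (x (head k))) ⟩
          r k * - (conj (r k) * x (tail k) * conj (x (head k)))  ∎)

      incidence-tail : ∀ k → incidenceMatrix (tail k) k ≈ r k
      incidence-tail k = begin
        r k * conj (x (tail k)) * x (tail k) * (⟦ tail k ≟ tail k ⟧ - ⟦ head k ≟ tail k ⟧)
          ≈⟨ *-congˡ (+-cong (when-yes (tail k ≟ tail k) ≡.refl) (-‿cong (when-no (head k ≟ tail k) (head≢tail k)))) ⟩
        r k * conj (x (tail k)) * x (tail k) * (1# - 0#)
          ≈⟨ solve 3 (λ r y x → r :* y :* x :* (con ℤ.1ℤ :- con ℤ.0ℤ) := r :* (x :* y)) refl (r k) (conj (x (tail k))) (x (tail k)) ⟩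
        r k * (x (tail k) * conj (x (tail k)))  ≈⟨ trans (*-congˡ (x-unit _)) (*-identityʳ _) ⟩
        r k ∎

      incidence-head : ∀ k → incidenceMatrix (head k) k ≈ conj (r k)
      incidence-head k = begin
        r k * conj (x (tail k)) * x (head k) * (⟦ tail k ≟ head k ⟧ - ⟦ head k ≟ head k ⟧)
          ≈⟨ *-congˡ (+-cong (when-no (tail k ≟ head k) (head≢tail k ∘ ≡.sym)) (-‿cong (when-yes (head k ≟ head k) ≡.refl))) ⟩
        r k * conj (x (tail k)) * x (head k) * (0# - 1#)
          ≈⟨ solve 1 (λ z → z :* (con ℤ.0ℤ :- con ℤ.1ℤ) := :- z) refl _ ⟩
        - (r k * conj (x (tail k)) * x (head k))  ≈⟨ conj-r k ⟨
        conj (r k) ∎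

      incidence-other : ∀ i k → tail k ≢ i → head k ≢ i → incidenceMatrix i k ≈ 0#
      incidence-other i k t≢i h≢i =
        trans (*-congˡ (trans (+-cong (when-no (tail k ≟ i) t≢i) (-‿cong (when-no (head k ≟ i) h≢i))) (-‿inverseʳ 0#)))
              (zeroʳ _)

      ⟦⟧-idem : ∀ {P : Set} (d : Dec P) → ⟦ d ⟧ * ⟦ d ⟧ ≈ ⟦ d ⟧
      ⟦⟧-idem (yes _) = *-identityˡ 1#
      ⟦⟧-idem (no _)  = zeroˡ 0#

      ⟦⟧-disjoint : ∀ {P Q : Set} (d : Dec P) (e : Dec Q) → ¬ (P × Q) → ⟦ d ⟧ * ⟦ e ⟧ ≈ 0#
      ⟦⟧-disjoint (yes p) (yes q) ¬pq = contradiction (p , q) ¬pq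
      ⟦⟧-disjoint (yes p) (no _)  ¬pq = zeroʳ _
      ⟦⟧-disjoint (no _)  e       ¬pq = zeroˡ _

      ⟦⟧-cong : ∀ {P Q : Set} (d : Dec P) (e : Dec Q) {y z} → (P → Q → y ≈ z) → ⟦ d ⟧ * ⟦ e ⟧ * y ≈ ⟦ d ⟧ * ⟦ e ⟧ * z
      ⟦⟧-cong (yes p) (yes q) h = *-congˡ (h p q)
      ⟦⟧-cong (yes p) (no _)  h = trans (*-congʳ (zeroʳ _)) (trans (zeroˡ _) (sym (trans (*-congʳ (zeroʳ _)) (zeroˡ _))))
      ⟦⟧-cong (no _)  e       h = trans (*-congʳ (zeroˡ _)) (trans (zeroˡ _) (sym (trans (*-congʳ (zeroˡ _)) (zeroˡ _))))

      private
        runs : Fin m → Fin n → Fin n → Carrier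
        runs k i j = ⟦ tail k ≟ i ⟧ * ⟦ head k ≟ j ⟧

        runs-self : ∀ k → runs k (tail k) (head k) ≈ 1#
        runs-self k = trans (*-cong (when-yes (tail k ≟ tail k) ≡.refl) (when-yes (head k ≟ head k) ≡.refl)) (*-identityˡ 1#)

        runs-not : ∀ {k i j} → ¬ (tail k ≡ i × head k ≡ j) → runs k i j ≈ 0#
        runs-not {k} {i} {j} = ⟦⟧-disjoint (tail k ≟ i) (head k ≟ j)

      -- Sums over the edges between i and j, of which there is at most one.
      between : Fin n → Fin n → (f g : Fin m → Carrier) → Carrier
      between i j f g = sum (λ k → runs k i j * f k + runs k j i * g k)

      between-swap : ∀ i j f g → between i j f g ≈ between j i g f
      between-swap i j f g = sum-cong-≋ {m} (λ k → +-comm _ _)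

      between-none : ∀ {i j} f g → ¬ Adjacent G ⊤ i j → between i j f g ≈ 0#
      between-none f g ¬adj = sum-zero {m} (λ k → trans
        (+-cong (trans (*-congʳ (runs-not (λ e → ¬adj (k , ∈⊤ , inj₁ e)))) (zeroˡ _))
                (trans (*-congʳ (runs-not (λ e → ¬adj (k , ∈⊤ , inj₂ e)))) (zeroˡ _)))
        (+-identityˡ 0#))

      between-edge : ∀ k f g → between (tail k) (head k) f g ≈ f k
      between-edge k f g = begin
        between (tail k) (head k) f g
          ≈⟨ sum-single {m} k (λ l l≢k → trans
               (+-cong (trans (*-congʳ (runs-not (λ e → l≢k (simple (inj₁ e) (joins-ends k))))) (zeroˡ _))
                       (trans (*-congʳ (runs-not (λ e → l≢k (simple (inj₂ e) (joins-ends k))))) (zeroˡ _)))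
               (+-identityˡ 0#)) ⟩
        runs k (tail k) (head k) * f k + runs k (head k) (tail k) * g k
          ≈⟨ +-cong (trans (*-congʳ (runs-self k)) (*-identityˡ _))
                    (trans (*-congʳ (runs-not (λ (e , _) → head≢tail k (≡.sym e)))) (zeroˡ _)) ⟩
        f k + 0#  ≈⟨ +-identityʳ _ ⟩
        f k       ∎

      -- Puts adjacency entries into the form in which the entries of `N · N ᴴ` arise, namely sums
      -- over edges.
      a-between : ∀ i j → a i j ≈ between i j w (conj ∘ w)
      a-between i j with adjacent? G ⊤ i j
      ... | no ¬adj = trans (a-none ¬adj) (sym (between-none w (conj ∘ w) ¬adj))
      ... | yes (k , _ , inj₁ (≡.refl , ≡.refl)) = trans (a-forward k) (sym (between-edge k w (conj ∘ w)))
      ... | yes (k , _ , inj₂ (≡.refl , ≡.refl)) = trans (a-backward k)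
        (sym (trans (between-swap (head k) (tail k) w (conj ∘ w)) (between-edge k (conj ∘ w) w)))

      abs-a-between : ∀ i j → abs (a i j) ≈ between i j ω ω
      abs-a-between i j with adjacent? G ⊤ i j
      ... | no ¬adj = trans (abs-cong (a-none ¬adj)) (trans abs-zero (sym (between-none ω ω ¬adj)))
      ... | yes (k , _ , inj₁ (≡.refl , ≡.refl)) = trans (abs-cong (a-forward k)) (sym (between-edge k ω ω))
      ... | yes (k , _ , inj₂ (≡.refl , ≡.refl)) = trans (abs-cong (a-backward k)) (trans (abs-conj _)
        (sym (trans (between-swap (head k) (tail k) ω ω) (between-edge k ω ω))))

      gram-entry : ∀ i j k → incidenceMatrix i k * conj (incidenceMatrix j k) ≈ ω k * (x i * conj (x j)) * (B i k * B j k)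
      gram-entry i j k = begin
        c k * x i * B i k * conj (c k * x j * B j k)
          ≈⟨ *-congˡ (trans (conj-* _ _) (*-cong (conj-* _ _)
               (real-minus (real-when (tail k ≟ j) real-1) (real-when (head k ≟ j) real-1)))) ⟩
        c k * x i * B i k * (conj (c k) * conj (x j) * B j k)
          ≈⟨ solve 6 (λ c x b d y e → c :* x :* b :* (d :* y :* e) := (d :* c) :* (x :* y) :* (b :* e)) refl
                     (c k) (x i) (B i k) (conj (c k)) (conj (x j)) (B j k) ⟩
        conj (c k) * c k * (x i * conj (x j)) * (B i k * B j k)  ≈⟨ *-congʳ (*-congʳ (c-norm k)) ⟩
        ω k * (x i * conj (x j)) * (B i k * B j k) ∎

      -- Double counting: an edge at `i` contributes its modulus once, through the vertex at its
      -- other end.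
      gram-diagonal : ∀ i → (incidenceMatrix · incidenceMatrix ᴴ) i i ≈ sum (λ l → abs (a i l))
      gram-diagonal i = begin
        sum (λ k → incidenceMatrix i k * conj (incidenceMatrix i k))
          ≈⟨ sum-cong-≋ {m} (λ k → trans (gram-entry i i k) (*-cong (trans (*-congˡ (x-unit i)) (*-identityʳ _)) (B-square k))) ⟩
        sum (λ k → ω k * (⟦ tail k ≟ i ⟧ + ⟦ head k ≟ i ⟧))
          ≈⟨ sum-cong-≋ {m} (λ k → neighbours k) ⟨
        sum (λ k → sum (λ l → runs k i l * ω k + runs k l i * ω k))
          ≈⟨ ∑-comm {m} {n} (λ k l → runs k i l * ω k + runs k l i * ω k) ⟩
        sum (λ l → between i l ω ω)  ≈⟨ sum-cong-≋ {n} (abs-a-between i) ⟨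
        sum (λ l → abs (a i l)) ∎
        where
        B-square : ∀ k → B i k * B i k ≈ ⟦ tail k ≟ i ⟧ + ⟦ head k ≟ i ⟧
        B-square k = begin
          (t - h) * (t - h)                ≈⟨ solve 2 (λ t h → (t :- h) :* (t :- h) := t :* t :+ h :* h :- (t :* h :+ t :* h)) refl t h ⟩
          t * t + h * h - (t * h + t * h)  ≈⟨ +-cong (+-cong (⟦⟧-idem (tail k ≟ i)) (⟦⟧-idem (head k ≟ i))) (-‿cong (+-cong th≈0 th≈0)) ⟩
          t + h - (0# + 0#)                ≈⟨ solve 1 (λ z → z :- (con ℤ.0ℤ :+ con ℤ.0ℤ) := z) refl (t + h) ⟩
          t + h                            ∎
          where
          t h : Carrier
          t = ⟦ tail k ≟ i ⟧
          h = ⟦ head k ≟ i ⟧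
          th≈0 : t * h ≈ 0#
          th≈0 = runs-not {k} loopless′
            where
            loopless′ : ¬ (tail k ≡ i × head k ≡ i)
            loopless′ e = loopless (inj₁ e)
        neighbours : ∀ k → sum (λ l → runs k i l * ω k + runs k l i * ω k) ≈ ω k * (⟦ tail k ≟ i ⟧ + ⟦ head k ≟ i ⟧)
        neighbours k = begin
          sum (λ l → runs k i l * ω k + runs k l i * ω k)
            ≈⟨ sum-cong-≋ {n} (λ l → solve 5 (λ t h t′ h′ w → t :* h :* w :+ t′ :* h′ :* w := w :* t :* h :+ w :* h′ :* t′) refl
                 ⟦ tail k ≟ i ⟧ ⟦ head k ≟ l ⟧ ⟦ tail k ≟ l ⟧ ⟦ head k ≟ i ⟧ (ω k)) ⟩
          sum (λ l → ω k * ⟦ tail k ≟ i ⟧ * ⟦ head k ≟ l ⟧ + ω k * ⟦ head k ≟ i ⟧ * ⟦ tail k ≟ l ⟧)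
            ≈⟨ ∑-distrib-+ {n} (λ l → ω k * ⟦ tail k ≟ i ⟧ * ⟦ head k ≟ l ⟧) (λ l → ω k * ⟦ head k ≟ i ⟧ * ⟦ tail k ≟ l ⟧) ⟩
          _ ≈⟨ +-cong (sum-⟦≟⟧ {n} (λ _ → ω k * ⟦ tail k ≟ i ⟧) (head k)) (sum-⟦≟⟧ {n} (λ _ → ω k * ⟦ head k ≟ i ⟧) (tail k)) ⟩
          ω k * ⟦ tail k ≟ i ⟧ + ω k * ⟦ head k ≟ i ⟧  ≈⟨ distribˡ _ _ _ ⟨
          ω k * (⟦ tail k ≟ i ⟧ + ⟦ head k ≟ i ⟧)      ∎

      -- On an edge the signs of `B` at the ends multiply to -1, and `Balanced` turns -|w| x_i x̄_j
      -- into the weight or its conjugate, according to the direction.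
      gram-offDiagonal : ∀ {i j} → i ≢ j → (incidenceMatrix · incidenceMatrix ᴴ) i j ≈ a i j
      gram-offDiagonal {i} {j} i≢j = trans (sum-cong-≋ {m} entry) (sym (a-between i j))
        where
        y : Carrier
        y = x i * conj (x j)
        forward : ∀ k → tail k ≡ i → head k ≡ j → w k ≈ - (ω k * y)
        forward k ≡.refl ≡.refl = balanced k
        backward : ∀ k → tail k ≡ j → head k ≡ i → conj (w k) ≈ - (ω k * y)
        backward k ≡.refl ≡.refl = trans (conj-cong (balanced k)) (trans (conj-neg _) (-‿cong (trans (conj-* _ _)
          (*-cong (abs-real _) (trans (conj-* _ _) (trans (*-congˡ (conj-conj _)) (*-comm _ _)))))))
        entry : ∀ k → incidenceMatrix i k * conj (incidenceMatrix j k) ≈ runs k i j * w k + runs k j i * conj (w k)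
        entry k = begin
          incidenceMatrix i k * conj (incidenceMatrix j k)  ≈⟨ gram-entry i j k ⟩
          ω k * y * ((t i - h i) * (t j - h j))
            ≈⟨ solve 5 (λ z t h t′ h′ → z :* ((t :- h) :* (t′ :- h′)) :=
                          z :* (t :* t′ :+ h :* h′) :+ (t :* h′ :* :- z :+ t′ :* h :* :- z)) refl
                       (ω k * y) (t i) (h i) (t j) (h j) ⟩
          ω k * y * (t i * t j + h i * h j) + (runs k i j * - (ω k * y) + runs k j i * - (ω k * y))
            ≈⟨ +-congʳ (trans (*-congˡ (trans (+-cong
                 (⟦⟧-disjoint (tail k ≟ i) (tail k ≟ j) (λ (p , q) → i≢j (≡.trans (≡.sym p) q)))
                 (⟦⟧-disjoint (head k ≟ i) (head k ≟ j) (λ (p , q) → i≢j (≡.trans (≡.sym p) q)))) (+-identityˡ 0#))) (zeroʳ _)) ⟩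
          0# + (runs k i j * - (ω k * y) + runs k j i * - (ω k * y))
            ≈⟨ +-identityˡ _ ⟩
          runs k i j * - (ω k * y) + runs k j i * - (ω k * y)
            ≈⟨ +-cong (⟦⟧-cong (tail k ≟ i) (head k ≟ j) (forward k)) (⟦⟧-cong (tail k ≟ j) (head k ≟ i) (backward k)) ⟨
          runs k i j * w k + runs k j i * conj (w k) ∎
          where
          t h : Fin n → Carrier
          t v = ⟦ tail k ≟ v ⟧
          h v = ⟦ head k ≟ v ⟧

      phase : ∀ {z u} → z ≉ 0# → Unit u → z ≈ abs z * u → abs z * z ⁻¹ ≈ conj u
      phase {z} {u} z≉0 u-unit e = begin
        abs z * z ⁻¹                   ≈⟨ *-congʳ (trans (*-congˡ u-unit) (*-identityʳ _)) ⟨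
        abs z * (u * conj u) * z ⁻¹    ≈⟨ solve 4 (λ r u v i → r :* (u :* v) :* i := r :* u :* i :* v) refl (abs z) u (conj u) (z ⁻¹) ⟩
        abs z * u * z ⁻¹ * conj u      ≈⟨ *-congʳ (trans (*-congʳ (sym e)) (⁻¹-inverseʳ z≉0)) ⟩
        1# * conj u                    ≈⟨ *-identityˡ _ ⟩
        conj u                         ∎

      componentSize-share : ∀ S i → ν * (componentSize G S i ×ₙ 1#) ≈ share S i
      componentSize-share S i = *-congˡ (trans (sym (sum-replicate (componentSize G S i)))
        (∑-filter-allFin (path? G S i) (λ _ → 1#)))

      module _ {T : Subset m} (isTree : Tree T) {k} (k∈T : k ∈ T) where
        open Tree isTree

        private
          pathWeight : Fin n → Fin n → Carrier
          pathWeight j u = weight (path G T j u)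

          -- On the tree the aligned units are parity times `x`, so the path weight has the phase
          -- x_j x̄_u times the parities of both ends. The factor (-1)^d cancels exactly these
          -- parities.
          sign*phase : ∀ {j u d} → Walk T u j d →
            (- 1#) ^ d * (abs (pathWeight j u) * pathWeight j u ⁻¹) ≈ conj (x j) * x u
          sign*phase {j} {u} {d} walk = begin
            (- 1#) ^ d * (abs (pathWeight j u) * pathWeight j u ⁻¹)
              ≈⟨ *-cong (sign-walk isTree walk) (trans (phase (weight-≉0 l) U-unit W≈) (conj-cong (parity-product T x j u))) ⟩
            p u * p j * conj (p j * p u * (x j * conj (x u)))
              ≈⟨ *-congˡ (trans (conj-* _ _) (*-cong (real-* (parity-real T j) (parity-real T u))
                   (trans (conj-* _ _) (*-congˡ (conj-conj _))))) ⟩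
            p u * p j * (p j * p u * (conj (x j) * x u))
              ≈⟨ solve 3 (λ p q z → p :* q :* (q :* p :* z) := (p :* p) :* (q :* q) :* z) refl (p u) (p j) (conj (x j) * x u) ⟩
            p u * p u * (p j * p j) * (conj (x j) * x u)
              ≈⟨ trans (*-congʳ (trans (*-cong (parity-square T u) (parity-square T j)) (*-identityˡ 1#))) (*-identityˡ _) ⟩
            conj (x j) * x u ∎
            where
            p : Fin n → Carrier
            p = parity T
            isPath = path-isPath (connected j u)
            l = proj₁ (proj₂ isPath)
            U-unit : Unit (parity-* T x j * conj (parity-* T x u))
            U-unit = unit-* (parity-unit T x-unit j)
              (trans (*-congˡ (conj-conj _)) (trans (*-comm _ _) (parity-unit T x-unit u)))
            W≈ : pathWeight j u ≈ abs (pathWeight j u) * (parity-* T x j * conj (parity-* T x u))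
            W≈ = weight-aligned (parity-unit T x-unit) (λ {e} e∈T → balanced⇒aligned isTree {x} e∈T (balanced e))
                   l (proj₁ (proj₂ (proj₂ isPath))) (proj₂ (proj₂ (proj₂ isPath)))

        -- On this side the current is 1 minus the share of the tail component, which is |T_h|/n.
        -- `wt` and `z` are variables tied by equations, so that `treeInverse` can be supplied
        -- through its view.
        treeMatrix-tail : ∀ {j wt z} → Reach (T ∖ k) (tail k) j → wt ≡ weight (path G T j (tail k)) →
          z ≡ treeFormula K modulus n (edgeDistance G T k j) (componentSize G (T ∖ k) (head k)) (r k) wt →
          z ≈ treeMatrix T k j
        treeMatrix-tail {j} reach ≡.refl ≡.refl = begin
          s * ν * (size * r k ⁻¹) * q  ≈⟨ solve 5 (λ s v z i q → s :* v :* (z :* i) :* q := (s :* q) :* i :* (v :* z)) refl s ν size (r k ⁻¹) q ⟩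
          s * q * r k ⁻¹ * (ν * size)  ≈⟨ *-cong (*-congʳ (sign*phase (edgeDistance-tail isTree k∈T reach))) (componentSize-share (T ∖ k) (head k)) ⟩
          conj (x j) * x (tail k) * r k ⁻¹ * share (T ∖ k) (head k)
            ≈⟨ *-congˡ (share-complement (bridge k∈T) (component isTree k∈T)) ⟩
          conj (x j) * x (tail k) * r k ⁻¹ * (1# - share (T ∖ k) (tail k))
            ≈⟨ *-congˡ (+-congʳ (when-yes (reach? (T ∖ k) (tail k) j) reach)) ⟨
          conj (x j) * x (tail k) * r k ⁻¹ * current T k j
            ≈⟨ *-congʳ (trans (*-assoc _ _ _) (*-comm _ _)) ⟩
          treeMatrix T k j ∎
          where
          s q size : Carrier
          s = (- 1#) ^ edgeDistance G T k j
          q = abs (pathWeight j (tail k)) * pathWeight j (tail k) ⁻¹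
          size = componentSize G (T ∖ k) (head k) ×ₙ 1#

        -- On this side the current is -|T_t|/n. The formula shows no such sign because it is hidden
        -- in the root at the head: by `conj-r` the conjugate root is -r x̄_t x_h.
        treeMatrix-head : ∀ {j wt z r̄} → r̄ ≈ conj (r k) → ¬ Reach (T ∖ k) (tail k) j →
          wt ≡ weight (path G T j (head k)) →
          z ≡ treeFormula K modulus n (edgeDistance G T k j) (componentSize G (T ∖ k) (tail k)) r̄ wt →
          z ≈ treeMatrix T k j
        treeMatrix-head {j} {r̄ = r̄} r̄≈ unreach ≡.refl ≡.refl = begin
          s * ν * (size * r̄ ⁻¹) * q  ≈⟨ solve 5 (λ s v z i q → s :* v :* (z :* i) :* q := (s :* q) :* i :* (v :* z)) refl s ν size (r̄ ⁻¹) q ⟩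
          s * q * r̄ ⁻¹ * (ν * size)
            ≈⟨ *-cong (*-cong (sign*phase (edgeDistance-head isTree k∈T reach)) r̄⁻¹≈) (componentSize-share (T ∖ k) (tail k)) ⟩
          conj (x j) * x (head k) * - (x (tail k) * r k ⁻¹ * conj (x (head k))) * share (T ∖ k) (tail k)
            ≈⟨ solve 6 (λ y h t i z s → y :* h :* :- (t :* i :* z) :* s := (h :* z) :* (t :* i :* y :* (con ℤ.0ℤ :- s))) refl
                       (conj (x j)) (x (head k)) (x (tail k)) (r k ⁻¹) (conj (x (head k))) (share (T ∖ k) (tail k)) ⟩
          x (head k) * conj (x (head k)) * (x (tail k) * r k ⁻¹ * conj (x j) * (0# - share (T ∖ k) (tail k)))
            ≈⟨ trans (*-congʳ (x-unit (head k))) (*-identityˡ _) ⟩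
          x (tail k) * r k ⁻¹ * conj (x j) * (0# - share (T ∖ k) (tail k))
            ≈⟨ *-congˡ (+-congʳ (when-no (reach? (T ∖ k) (tail k) j) unreach)) ⟨
          treeMatrix T k j ∎
          where
          s q size : Carrier
          s = (- 1#) ^ edgeDistance G T k j
          q = abs (pathWeight j (head k)) * pathWeight j (head k) ⁻¹
          size = componentSize G (T ∖ k) (tail k) ×ₙ 1#
          reach : Reach (T ∖ k) (head k) j
          reach = [ (λ p → contradiction p unreach) , id ]′ (component isTree k∈T j)
          r̄⁻¹≈ : r̄ ⁻¹ ≈ - (x (tail k) * r k ⁻¹ * conj (x (head k)))
          r̄⁻¹≈ = ⁻¹-unique (begin
            r̄ * - (x (tail k) * r k ⁻¹ * conj (x (head k)))
              ≈⟨ *-congʳ (trans r̄≈ (conj-r k)) ⟩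
            - (r k * conj (x (tail k)) * x (head k)) * - (x (tail k) * r k ⁻¹ * conj (x (head k)))
              ≈⟨ solve 6 (λ r y h t i z → :- (r :* y :* h) :* :- (t :* i :* z) := (r :* i) :* ((t :* y) :* (h :* z))) refl
                         (r k) (conj (x (tail k))) (x (head k)) (x (tail k)) (r k ⁻¹) (conj (x (head k))) ⟩
            r k * r k ⁻¹ * (x (tail k) * conj (x (tail k)) * (x (head k) * conj (x (head k))))
              ≈⟨ *-cong (⁻¹-inverseʳ (r≉0 k)) (trans (*-cong (x-unit _) (x-unit _)) (*-identityˡ 1#)) ⟩
            1# * 1#  ≈⟨ *-identityˡ 1# ⟩
            1#       ∎)

      module _ (treeInv : Subset m → Fin m → Fin n → Carrier) (absW : Subset m → Carrier)
        (treeInv≈ : ∀ {T} → Tree T → ∀ {k} → k ∈ T → ∀ j → treeInv T k j ≈ treeMatrix T k j)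
        (absW≈ : ∀ T → absW T ≈ μ T) where

        private
          M : Fin m → Fin n → Carrier
          M k j = ∑ (spanningTreesThrough G k) (λ T → absW T * treeInv T k j)

          inverse≈ : ∀ k j → inverseMatrix k j ≈ τ * M k j
          inverse≈ k j = begin
            c⁻¹ k * conj (x j) * (τ * ∑ Ts (λ T → μ T * current T k j))
              ≈⟨ solve 3 (λ p t s → p :* (t :* s) := t :* (p :* s)) refl (c⁻¹ k * conj (x j)) τ (∑ Ts (λ T → μ T * current T k j)) ⟩
            τ * (c⁻¹ k * conj (x j) * ∑ Ts (λ T → μ T * current T k j))
              ≈⟨ *-congˡ (*-distribˡ-sum {length Ts} (c⁻¹ k * conj (x j)) (λ r → μ (lookup Ts r) * current (lookup Ts r) k j)) ⟩
            τ * ∑ Ts (λ T → c⁻¹ k * conj (x j) * (μ T * current T k j))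
              ≈⟨ *-congˡ (sum-cong-≋ {length Ts} (λ r → let T = lookup Ts r in
                   trans (solve 3 (λ p u y → p :* (u :* y) := u :* (p :* y)) refl (c⁻¹ k * conj (x j)) (μ T) (current T k j))
                         (*-cong (sym (absW≈ T)) (sym (treeInv≈ (trees r) (through r) j))))) ⟩
            τ * M k j ∎
            where
            Ts : List (Subset m)
            Ts = spanningTreesThrough G k
            membership : ∀ r → _
            membership r = ∈-filter⁻ (k ∈?_) {xs = spanningTrees G} (∈-lookup r)
            through : ∀ r → k ∈ lookup Ts r
            through r = proj₂ (membership r)
            trees : ∀ r → Tree (lookup Ts r)
            trees r = spanningTree⇒tree (proj₂ (∈-filter⁻ tree? {xs = subsets m} (proj₁ (membership r))))

        gram-inverse : ∀ i j → (inverseMatrix ᴴ · inverseMatrix) i j ≈ gramFormula K J G τ absW treeInv i j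
        gram-inverse i j = begin
          sum (λ k → conj (inverseMatrix k i) * inverseMatrix k j)
            ≈⟨ sum-cong-≋ {m} (λ k → trans (*-cong (trans (conj-cong (inverse≈ k i)) (conj-* _ _)) (inverse≈ k j))
                 (trans (*-cong (*-congʳ τ-real) refl)
                   -- `t :* (t :* con ℤ.1ℤ)` is the shape to which `τ ^ 2` unfolds.
                   (trans (solve 3 (λ t p q → t :* p :* (t :* q) := t :* (t :* con ℤ.1ℤ) :* (p :* q)) refl τ (conj (M k i)) (M k j))
                          (*-congˡ (double k))))) ⟩
          sum (λ k → τ ^ 2 * D k)  ≈⟨ *-distribˡ-sum {m} (τ ^ 2) D ⟨
          τ ^ 2 * sum D ∎
          where
          entry : Fin m → Subset m → Subset m → Carrier
          entry k Tr Ts = absW Tr * absW Ts * conj (treeInv Tr k i) * treeInv Ts k j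
          D : Fin m → Carrier
          D k = ∑ (spanningTreesThrough G k) (λ Tr → ∑ (spanningTreesThrough G k) (entry k Tr))
          absW-real : ∀ T → Real (absW T)
          absW-real T = real-resp (sym (absW≈ T)) (μ-real T)
          double : ∀ k → conj (M k i) * M k j ≈ D k
          double k = begin
            conj (M k i) * M k j
              ≈⟨ *-congʳ (trans (conj-sum {length Ts} _) (sum-cong-≋ {length Ts} (λ r → trans (conj-* _ _) (*-congʳ (absW-real (lookup Ts r)))))) ⟩
            ∑ Ts (λ Tr → absW Tr * conj (treeInv Tr k i)) * M k j
              ≈⟨ *-distribʳ-sum {length Ts} (M k j) (λ r → absW (lookup Ts r) * conj (treeInv (lookup Ts r) k i)) ⟩
            ∑ Ts (λ Tr → absW Tr * conj (treeInv Tr k i) * M k j)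
              ≈⟨ sum-cong-≋ {length Ts} (λ r → let Tr = lookup Ts r in trans
                   (*-distribˡ-sum {length Ts} (absW Tr * conj (treeInv Tr k i)) (λ s → absW (lookup Ts s) * treeInv (lookup Ts s) k j))
                   (sum-cong-≋ {length Ts} (λ s → let Ts′ = lookup Ts s in
                     solve 4 (λ u p v q → u :* p :* (v :* q) := u :* v :* p :* q) refl
                             (absW Tr) (conj (treeInv Tr k i)) (absW Ts′) (treeInv Ts′ k j)))) ⟩
            D k ∎
            where
            Ts : List (Subset m)
            Ts = spanningTreesThrough G k

-- Order and square roots of real numbers

module RealProperties (ℛ : Reals) where
  open Reals ℛ
  open RingProperties ring using (-‿involutive; -0#≈0#)
  open IntegerSolver commutativeRing
  open SetoidReasoning setoid

  0≤-neg : ∀ {x} → x ≤ 0# → 0# ≤ - x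
  0≤-neg {x} p = ≤-resp (-‿inverseˡ x) (+-identityʳ (- x)) (+-monoʳ-≤ (- x) p)

  0≤-square : ∀ x → 0# ≤ x * x
  0≤-square x with Order.total 0# x
  ... | inj₁ p = *-nonneg p p
  ... | inj₂ p = ≤-resp refl (solve 1 (λ x → :- x :* :- x := x :* x) refl x) (*-nonneg (0≤-neg p) (0≤-neg p))

  ⁻¹-inverseʳ : ∀ {x} → x ≉ 0# → x * x ⁻¹ ≈ 1#
  ⁻¹-inverseʳ {x} x≉0 with x Order.≟ 0#
  ... | yes x≈0 = contradiction x≈0 x≉0
  ... | no x≉0′ = proj₂ (inverse x x≉0′)

  *-cancel-0 : ∀ {x y} → x ≉ 0# → x * y ≈ 0# → y ≈ 0#
  *-cancel-0 {x} {y} x≉0 xy≈0 = begin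
    y               ≈⟨ *-identityˡ y ⟨
    1# * y          ≈⟨ *-congʳ (⁻¹-inverseʳ x≉0) ⟨
    x * x ⁻¹ * y    ≈⟨ solve 3 (λ x i y → x :* i :* y := i :* (x :* y)) refl x (x ⁻¹) y ⟩
    x ⁻¹ * (x * y)  ≈⟨ *-congˡ xy≈0 ⟩
    x ⁻¹ * 0#       ≈⟨ zeroʳ _ ⟩
    0#              ∎

  square-0 : ∀ {x} → x * x ≈ 0# → x ≈ 0#
  square-0 {x} xx≈0 with x Order.≟ 0#
  ... | yes x≈0 = x≈0
  ... | no x≉0  = *-cancel-0 x≉0 xx≈0

  +-nonneg-0 : ∀ {x y} → 0# ≤ x → 0# ≤ y → x + y ≈ 0# → x ≈ 0#
  +-nonneg-0 0≤x 0≤y x+y≈0 = Order.antisym (from-difference 0≤y x+y≈0) 0≤x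

  square-injective : ∀ {x y} → 0# ≤ x → 0# ≤ y → x * x ≈ y * y → x ≈ y
  square-injective 0≤x 0≤y e = Order.antisym
    (square-cancel-≤ 0≤x 0≤y (Order.reflexive e))
    (square-cancel-≤ 0≤y 0≤x (Order.reflexive (sym e)))

  sqrt-nonneg : ∀ x → 0# ≤ sqrt x
  sqrt-nonneg x with 0# Order.≤? x
  ... | yes 0≤x = proj₁ (proj₂ (sqrt-exists x 0≤x))
  ... | no _    = Order.refl

  sqrt-square : ∀ {x} → 0# ≤ x → sqrt x * sqrt x ≈ x
  sqrt-square {x} 0≤x with 0# Order.≤? x
  ... | yes 0≤x′ = proj₂ (proj₂ (sqrt-exists x 0≤x′))
  ... | no ¬0≤x  = contradiction 0≤x ¬0≤x

  sqrt-unique : ∀ {x r} → 0# ≤ r → r * r ≈ x → sqrt x ≈ r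
  sqrt-unique 0≤r rr≈x = square-injective (sqrt-nonneg _) 0≤r
    (trans (sqrt-square (≤-resp refl rr≈x (0≤-square _))) (sym rr≈x))

  sqrt-cong : ∀ {x y} → 0# ≤ x → x ≈ y → sqrt x ≈ sqrt y
  sqrt-cong 0≤x x≈y =
    sqrt-unique (sqrt-nonneg _) (trans (sqrt-square (≤-resp refl x≈y 0≤x)) (sym x≈y))

  ≤-of-square : ∀ {x t} → 0# ≤ t → x * x ≤ t * t → x ≤ t
  ≤-of-square {x} 0≤t p with Order.total 0# x
  ... | inj₁ 0≤x = square-cancel-≤ 0≤x 0≤t p
  ... | inj₂ x≤0 = Order.trans x≤0 0≤t

  0≤-difference : ∀ {x y} → x ≤ y → 0# ≤ y - x
  0≤-difference {x} {y} p = ≤-resp (-‿inverseˡ x) (+-comm _ _) (+-monoʳ-≤ (- x) p)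

  positive≉0 : ∀ {x} → 0# ≤ x → 1# + x ≉ 0#
  positive≉0 0≤x e = 1≉0 (+-nonneg-0 0≤1 0≤x e)

-- The complex field, its modulus and principal square root

module ComplexProperties (ℛ : Reals) where
  open Complex ℛ
  open RealProperties ℛ
  private
    module R = Reals ℛ
    open R using (ℝ; module Order; _≤_; ≤-resp)
    open IntegerSolver R.commutativeRing
    open SetoidReasoning R.setoid

  ℂ-commutativeRing : CommutativeRing 0ℓ 0ℓ
  ℂ-commutativeRing = record
    { Carrier = ℂ
    ; _≈_ = _≈_
    ; _+_ = _+_
    ; _*_ = _*_
    ; -_  = -_
    ; 0#  = 0#
    ; 1#  = 1#
    ; isCommutativeRing = record
      { isRing = record
        { +-isAbelianGroup = record
          { isGroup = record
            { isMonoid = record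
              { isSemigroup = record
                { isMagma = record
                  { isEquivalence = record
                    { refl  = R.refl , R.refl
                    ; sym   = λ (p , q) → R.sym p , R.sym q
                    ; trans = λ (p , q) (p′ , q′) → R.trans p p′ , R.trans q q′
                    }
                  ; ∙-cong = λ (p , q) (p′ , q′) → R.+-cong p p′ , R.+-cong q q′
                  }
                ; assoc = λ _ _ _ → R.+-assoc _ _ _ , R.+-assoc _ _ _
                }
              ; identity = (λ _ → R.+-identityˡ _ , R.+-identityˡ _) , (λ _ → R.+-identityʳ _ , R.+-identityʳ _)
              }
            ; inverse = (λ _ → R.-‿inverseˡ _ , R.-‿inverseˡ _) , (λ _ → R.-‿inverseʳ _ , R.-‿inverseʳ _)
            ; ⁻¹-cong = λ (p , q) → R.-‿cong p , R.-‿cong q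
            }
          ; comm = λ _ _ → R.+-comm _ _ , R.+-comm _ _
          }
        ; *-cong = λ (p , q) (p′ , q′) →
            R.+-cong (R.*-cong p p′) (R.-‿cong (R.*-cong q q′)) , R.+-cong (R.*-cong p q′) (R.*-cong q p′)
        ; *-assoc = λ (a +i b) (c +i d) (e +i f) →
            solve 6 (λ a b c d e f → (a :* c :- b :* d) :* e :- (a :* d :+ b :* c) :* f :=
                                     a :* (c :* e :- d :* f) :- b :* (c :* f :+ d :* e)) R.refl a b c d e f ,
            solve 6 (λ a b c d e f → (a :* c :- b :* d) :* f :+ (a :* d :+ b :* c) :* e :=
                                     a :* (c :* f :+ d :* e) :+ b :* (c :* e :- d :* f)) R.refl a b c d e f
        ; *-identity =
            (λ (a +i b) → solve 2 (λ a b → con ℤ.1ℤ :* a :- con ℤ.0ℤ :* b := a) R.refl a b ,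
                          solve 2 (λ a b → con ℤ.1ℤ :* b :+ con ℤ.0ℤ :* a := b) R.refl a b) ,
            (λ (a +i b) → solve 2 (λ a b → a :* con ℤ.1ℤ :- b :* con ℤ.0ℤ := a) R.refl a b ,
                          solve 2 (λ a b → a :* con ℤ.0ℤ :+ b :* con ℤ.1ℤ := b) R.refl a b)
        ; distrib =
            (λ (a +i b) (c +i d) (e +i f) →
              solve 6 (λ a b c d e f → a :* (c :+ e) :- b :* (d :+ f) :=
                                       (a :* c :- b :* d) :+ (a :* e :- b :* f)) R.refl a b c d e f ,
              solve 6 (λ a b c d e f → a :* (d :+ f) :+ b :* (c :+ e) :=
                                       (a :* d :+ b :* c) :+ (a :* f :+ b :* e)) R.refl a b c d e f) ,
            (λ (a +i b) (c +i d) (e +i f) →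
              solve 6 (λ a b c d e f → (c :+ e) :* a :- (d :+ f) :* b :=
                                       (c :* a :- d :* b) :+ (e :* a :- f :* b)) R.refl a b c d e f ,
              solve 6 (λ a b c d e f → (c :+ e) :* b :+ (d :+ f) :* a :=
                                       (c :* b :+ d :* a) :+ (e :* b :+ f :* a)) R.refl a b c d e f)
        }
      ; *-comm = λ (a +i b) (c +i d) →
          solve 4 (λ a b c d → a :* c :- b :* d := c :* a :- d :* b) R.refl a b c d ,
          solve 4 (λ a b c d → a :* d :+ b :* c := c :* b :+ d :* a) R.refl a b c d
      }
    }

  conjugation : Involution ℂ-commutativeRing
  conjugation = record
    { conj      = conj
    ; conj-cong = λ (p , q) → p , R.-‿cong q
    ; conj-+    = λ (a +i b) (c +i d) → R.refl , solve 2 (λ b d → :- (b :+ d) := :- b :+ :- d) R.refl b d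
    ; conj-*    = λ (a +i b) (c +i d) →
        solve 4 (λ a b c d → a :* c :- b :* d := a :* c :- :- b :* :- d) R.refl a b c d ,
        solve 4 (λ a b c d → :- (a :* d :+ b :* c) := a :* :- d :+ :- b :* c) R.refl a b c d
    ; conj-conj = λ (a +i b) → R.refl , solve 1 (λ b → :- :- b := b) R.refl b
    }

  module C = CommutativeRing ℂ-commutativeRing
  module CS = IntegerSolver ℂ-commutativeRing
  open InvolutiveRing ℂ-commutativeRing conjugation using (Real; real-*)

  *-conj : ∀ z → z * conj z ≈ ↑ (normSq z)
  *-conj (a +i b) =
    solve 2 (λ a b → a :* a :- b :* :- b := a :* a :+ b :* b) R.refl a b ,
    solve 2 (λ a b → a :* :- b :+ b :* a := con ℤ.0ℤ) R.refl a b

  ↑-* : ∀ x y → ↑ (x R.* y) ≈ ↑ x * ↑ y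
  ↑-* x y = solve 2 (λ x y → x :* y := x :* y :- con ℤ.0ℤ :* con ℤ.0ℤ) R.refl x y ,
            solve 2 (λ x y → con ℤ.0ℤ := x :* con ℤ.0ℤ :+ con ℤ.0ℤ :* y) R.refl x y

  0≤-normSq : ∀ z → R.0# ≤ normSq z
  0≤-normSq z = R.+-nonneg (0≤-square (re z)) (0≤-square (im z))

  normSq-0 : ∀ {z} → normSq z R.≈ R.0# → z ≈ 0#
  normSq-0 {z} e =
    square-0 (+-nonneg-0 (0≤-square (re z)) (0≤-square (im z)) e) ,
    square-0 (+-nonneg-0 (0≤-square (im z)) (0≤-square (re z)) (R.trans (R.+-comm _ _) e))

  *-inverseʳ : ∀ {z} → z ≉ 0# → z * z ⁻¹ ≈ 1#
  *-inverseʳ {z@(a +i b)} z≉0 =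
    R.trans (solve 3 (λ a b i → a :* (a :* i) :- b :* (:- b :* i) := (a :* a :+ b :* b) :* i) R.refl a b (normSq z R.⁻¹))
            (⁻¹-inverseʳ (z≉0 ∘ normSq-0)) ,
    solve 3 (λ a b i → a :* (:- b :* i) :+ b :* (a :* i) := con ℤ.0ℤ) R.refl a b (normSq z R.⁻¹)

  NonNeg : ℂ → Set
  NonNeg z = R.0# ≤ re z × im z R.≈ R.0#

  nonNeg-real : ∀ {z} → NonNeg z → Real z
  nonNeg-real (_ , im≈0) = R.refl ,
    R.trans (R.-‿cong im≈0) (R.trans (solve 0 (:- con ℤ.0ℤ := con ℤ.0ℤ) R.refl) (R.sym im≈0))

  nonNeg-+ : ∀ {z w} → NonNeg z → NonNeg w → NonNeg (z + w)
  nonNeg-+ (p , q) (p′ , q′) = R.+-nonneg p p′ , R.trans (R.+-cong q q′) (R.+-identityˡ _)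

  nonNeg-0 : NonNeg 0#
  nonNeg-0 = Order.refl , R.refl

  nonNeg-resp : ∀ {z w} → z ≈ w → NonNeg z → NonNeg w
  nonNeg-resp (p , q) (r , s) = ≤-resp R.refl p r , R.trans (R.sym q) s

  nonNeg-* : ∀ {z w} → NonNeg z → NonNeg w → NonNeg (z * w)
  nonNeg-* {a +i b} {c +i d} (p , q) (p′ , q′) =
    ≤-resp R.refl (R.sym (R.trans (R.+-congˡ (R.-‿cong (R.*-cong q q′)))
                    (solve 2 (λ a c → a :* c :- con ℤ.0ℤ :* con ℤ.0ℤ := a :* c) R.refl a c)))
      (R.*-nonneg p p′) ,
    R.trans (R.+-cong (R.*-congˡ q′) (R.*-congʳ q))
      (solve 2 (λ a c → a :* con ℤ.0ℤ :+ con ℤ.0ℤ :* c := con ℤ.0ℤ) R.refl a c)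

  nonNeg-sum : ∀ {k} (f : Fin k → ℂ) → (∀ i → NonNeg (f i)) → NonNeg (sum f)
  nonNeg-sum {zero}  f p = nonNeg-0
  nonNeg-sum {suc k} f p = nonNeg-+ (p zero) (nonNeg-sum (f ∘ suc) (p ∘ suc))

  nonNeg-sum-0 : ∀ {k} (f : Fin k → ℂ) → (∀ i → NonNeg (f i)) → sum f ≈ 0# → ∀ i → f i ≈ 0#
  nonNeg-sum-0 f p (e , _) zero    =
    +-nonneg-0 (proj₁ (p zero)) (proj₁ (nonNeg-sum (f ∘ suc) (p ∘ suc))) e , proj₂ (p zero)
  nonNeg-sum-0 f p (e , _) (suc i) = nonNeg-sum-0 (f ∘ suc) (p ∘ suc)
    (+-nonneg-0 (proj₁ rest) (proj₁ (p zero)) (R.trans (R.+-comm _ _) e) , proj₂ rest) i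
    where rest = nonNeg-sum (f ∘ suc) (p ∘ suc)

  nonNeg-square-injective : ∀ {z w} → NonNeg z → NonNeg w → z * z ≈ w * w → z ≈ w
  nonNeg-square-injective {a +i b} {c +i d} (p , q) (p′ , q′) (e , _) =
    square-injective p p′ (begin
      a R.* a                  ≈⟨ solve 1 (λ a → a :* a := a :* a :- con ℤ.0ℤ :* con ℤ.0ℤ) R.refl a ⟩
      a R.* a R.- R.0# R.* R.0#  ≈⟨ R.+-congˡ (R.-‿cong (R.*-cong q q)) ⟨
      a R.* a R.- b R.* b      ≈⟨ e ⟩
      c R.* c R.- d R.* d      ≈⟨ R.+-congˡ (R.-‿cong (R.*-cong q′ q′)) ⟩
      c R.* c R.- R.0# R.* R.0#  ≈⟨ solve 1 (λ a → a :* a := a :* a :- con ℤ.0ℤ :* con ℤ.0ℤ) R.refl c ⟨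
      c R.* c                  ∎) ,
    R.trans q (R.sym q′)

  abs-nonNeg : ∀ z → NonNeg ∣ z ∣
  abs-nonNeg z = sqrt-nonneg (normSq z) , R.refl

  abs-real : ∀ z → Real ∣ z ∣
  abs-real z = nonNeg-real {∣ z ∣} (abs-nonNeg z)

  abs-square : ∀ z → ∣ z ∣ * ∣ z ∣ ≈ z * conj z
  abs-square z = C.trans (C.sym (↑-* (R.sqrt (normSq z)) (R.sqrt (normSq z))))
    (C.trans (sqrt-square (0≤-normSq z) , R.refl) (C.sym (*-conj z)))

  -- Nonnegative numbers are determined by their squares. Most of the laws in `modulus` follow from
  -- this by multiplying out.
  abs-unique : ∀ {z r} → NonNeg r → r * r ≈ z * conj z → ∣ z ∣ ≈ r
  abs-unique {z} p e = nonNeg-square-injective (abs-nonNeg z) p (C.trans (abs-square z) (C.sym e))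

  abs-0 : ∀ {z} → ∣ z ∣ ≈ 0# → z ≈ 0#
  abs-0 {z} (e , _) = normSq-0 (R.trans (R.sym (sqrt-square (0≤-normSq z))) (R.trans (R.*-congʳ e) (R.zeroˡ _)))

  private
    2≉0 : R.1# R.+ R.1# R.≉ R.0#
    2≉0 = positive≉0 R.0≤1

    half-double : ∀ x → half x R.+ half x R.≈ x
    half-double x = begin
      half x R.+ half x   ≈⟨ solve 2 (λ x i → x :* i :+ x :* i := ((con ℤ.1ℤ :+ con ℤ.1ℤ) :* i) :* x) R.refl x _ ⟩
      _ R.* x             ≈⟨ R.*-congʳ (⁻¹-inverseʳ 2≉0) ⟩
      R.1# R.* x          ≈⟨ R.*-identityˡ x ⟩
      x                   ∎

    half-nonneg : ∀ {x} → R.0# ≤ x → R.0# ≤ half x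
    half-nonneg {x} 0≤x with Order.total R.0# (half x)
    ... | inj₁ p = p
    ... | inj₂ p = Order.reflexive (R.sym (Order.antisym p
      (≤-resp R.refl (R.trans (R.sym (half-double _)) (R.trans (R.+-cong h≈0 h≈0) (R.trans (R.+-identityˡ _) (R.sym h≈0)))) 0≤x)))
      where
      -- If h = x/2 were nonpositive, then x = h + h would be at most h, so 0 ≤ x ≤ h ≤ 0.
      h≈0 : half x R.≈ R.0#
      h≈0 = Order.antisym p (Order.trans 0≤x
        (R.from-difference (0≤-neg p) (R.trans (R.+-congʳ (R.sym (half-double x)))
          (solve 1 (λ h → h :+ h :+ :- h := h) R.refl (half x)))))

    sign-square : ∀ y → sign y R.* sign y R.≈ R.1#
    sign-square y with R.0# Order.≤? y
    ... | yes _ = R.*-identityˡ _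
    ... | no _  = solve 0 (:- con ℤ.1ℤ :* :- con ℤ.1ℤ := con ℤ.1ℤ) R.refl

    sign-abs : ∀ {t} y → R.0# ≤ t → t R.* t R.≈ y R.* y → sign y R.* t R.≈ y
    sign-abs {t} y 0≤t e with R.0# Order.≤? y
    ... | yes 0≤y = R.trans (R.*-identityˡ t) (square-injective 0≤t 0≤y e)
    ... | no y<0  = begin
      R.- R.1# R.* t    ≈⟨ R.*-congˡ (square-injective 0≤t (0≤-neg y≤0)
                            (R.trans e (solve 1 (λ y → y :* y := :- y :* :- y) R.refl y))) ⟩
      R.- R.1# R.* R.- y  ≈⟨ solve 1 (λ y → :- con ℤ.1ℤ :* :- y := y) R.refl y ⟩
      y                 ∎
      where
      y≤0 : y ≤ R.0#
      y≤0 = [ id , (λ p → contradiction p y<0) ]′ (Order.total y R.0#)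

    -- At y = 0 both signs are 1, so `√-conj` treats real numbers separately.
    sign-neg : ∀ y → y R.≉ R.0# → sign (R.- y) R.≈ R.- sign y
    sign-neg y y≉0 with R.0# Order.≤? y | R.0# Order.≤? (R.- y)
    ... | yes p | yes q = contradiction (+-nonneg-0 p q (R.-‿inverseʳ y)) y≉0
    ... | yes p | no q  = R.refl
    ... | no p  | yes q = solve 0 (con ℤ.1ℤ := :- :- con ℤ.1ℤ) R.refl
    ... | no p  | no q with Order.total R.0# y
    ...   | inj₁ p′ = contradiction p′ p
    ...   | inj₂ p′ = contradiction (0≤-neg p′) q

    module Root (z : ℂ) where
      r p q : ℝ
      r = R.sqrt (normSq z)
      p = half (r R.+ re z)
      q = half (r R.- re z)

      rr : r R.* r R.≈ re z R.* re z R.+ im z R.* im z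
      rr = sqrt-square (0≤-normSq z)

      re≤r : re z ≤ r
      re≤r = ≤-of-square (sqrt-nonneg _) (R.from-difference (0≤-square (im z)) (R.sym rr))

      -re≤r : R.- re z ≤ r
      -re≤r = ≤-of-square (sqrt-nonneg _) (R.from-difference (0≤-square (im z))
        (R.trans (R.+-congʳ (solve 1 (λ a → :- a :* :- a := a :* a) R.refl (re z))) (R.sym rr)))

      0≤r+re : R.0# ≤ r R.+ re z
      0≤r+re = ≤-resp R.refl (solve 2 (λ r a → r :- :- a := r :+ a) R.refl r (re z)) (0≤-difference -re≤r)

      0≤p : R.0# ≤ p
      0≤p = half-nonneg 0≤r+re

      0≤q : R.0# ≤ q
      0≤q = half-nonneg (0≤-difference re≤r)

      u v s : ℝ
      u = R.sqrt p
      v = R.sqrt q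
      s = sign (im z)

      vs : (s R.* v) R.* (s R.* v) R.≈ q
      vs = begin
        (s R.* v) R.* (s R.* v)  ≈⟨ solve 2 (λ s v → (s :* v) :* (s :* v) := (s :* s) :* (v :* v)) R.refl s v ⟩
        (s R.* s) R.* (v R.* v)  ≈⟨ R.*-cong (sign-square (im z)) (sqrt-square 0≤q) ⟩
        R.1# R.* q               ≈⟨ R.*-identityˡ q ⟩
        q                        ∎

      -- Since (r + re z)(r - re z) = (im z)², the nonnegative number 2uv is the absolute value of
      -- im z; the factor `sign` in the root restores the sign.
      2uv : (u R.* v R.+ u R.* v) R.* (u R.* v R.+ u R.* v) R.≈ im z R.* im z
      2uv = begin
        (u R.* v R.+ u R.* v) R.* (u R.* v R.+ u R.* v)
          ≈⟨ solve 2 (λ u v → (u :* v :+ u :* v) :* (u :* v :+ u :* v) := (u :* u :+ u :* u) :* (v :* v :+ v :* v)) R.refl u v ⟩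
        (u R.* u R.+ u R.* u) R.* (v R.* v R.+ v R.* v)
          ≈⟨ R.*-cong (R.+-cong (sqrt-square 0≤p) (sqrt-square 0≤p)) (R.+-cong (sqrt-square 0≤q) (sqrt-square 0≤q)) ⟩
        (p R.+ p) R.* (q R.+ q)  ≈⟨ R.*-cong (half-double _) (half-double _) ⟩
        (r R.+ re z) R.* (r R.- re z)  ≈⟨ solve 2 (λ r a → (r :+ a) :* (r :- a) := r :* r :- a :* a) R.refl r (re z) ⟩
        r R.* r R.- re z R.* re z      ≈⟨ R.+-congʳ rr ⟩
        re z R.* re z R.+ im z R.* im z R.- re z R.* re z  ≈⟨ solve 2 (λ a b → a :+ b :- a := b) R.refl _ _ ⟩
        im z R.* im z            ∎

  √-square : ∀ z → √ z * √ z ≈ z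
  √-square z = (begin
      u R.* u R.- (s R.* v) R.* (s R.* v)  ≈⟨ R.+-cong (sqrt-square 0≤p) (R.-‿cong vs) ⟩
      p R.- q                            ≈⟨ solve 3 (λ r a i → (r :+ a) :* i :- (r :- a) :* i := a :* i :+ a :* i) R.refl r (re z) _ ⟩
      half (re z) R.+ half (re z)        ≈⟨ half-double (re z) ⟩
      re z                               ∎) ,
    (begin
      u R.* (s R.* v) R.+ (s R.* v) R.* u  ≈⟨ solve 3 (λ u s v → u :* (s :* v) :+ (s :* v) :* u := s :* (u :* v :+ u :* v)) R.refl u s v ⟩
      s R.* (u R.* v R.+ u R.* v)        ≈⟨ sign-abs (im z) (R.+-nonneg 0≤uv 0≤uv) 2uv ⟩
      im z                               ∎)
    where
    open Root z
    0≤uv : R.0# ≤ u R.* v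
    0≤uv = R.*-nonneg (sqrt-nonneg p) (sqrt-nonneg q)

  √-norm : ∀ z → √ z * conj (√ z) ≈ ∣ z ∣
  √-norm z = C.trans (*-conj (√ z))
    ((begin
      u R.* u R.+ (s R.* v) R.* (s R.* v)  ≈⟨ R.+-cong (sqrt-square 0≤p) vs ⟩
      p R.+ q                            ≈⟨ solve 3 (λ r a i → (r :+ a) :* i :+ (r :- a) :* i := r :* i :+ r :* i) R.refl r (re z) _ ⟩
      half r R.+ half r                  ≈⟨ half-double r ⟩
      r                                  ∎) , R.refl)
    where open Root z

  -- For im z ≠ 0 the sign factor changes, and for z ≥ 0 the root is real. On the negative axis it
  -- fails: z is its own conjugate there, but its root is imaginary. The formulas take the root of
  -- the conjugate weight at the head, whereas the switched matrices have the conjugate of the root.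
  √-conj : ∀ {z} → ¬ ℝ⁻ z → √ (conj z) ≈ conj (√ z)
  √-conj {z} z∉ℝ⁻ =
    sqrt-cong Z̄.0≤p (R.*-congʳ (R.+-congʳ r̄≈r)) ,
    R.trans (R.*-congˡ v̄≈v) (imaginary (im z Order.≟ R.0#))
    where
    module Z = Root z
    module Z̄ = Root (conj z)
    r̄≈r : Z̄.r R.≈ Z.r
    r̄≈r = sqrt-cong (0≤-normSq (conj z)) (R.+-congˡ (solve 1 (λ b → :- b :* :- b := b :* b) R.refl (im z)))
    v̄≈v : Z̄.v R.≈ Z.v
    v̄≈v = sqrt-cong Z̄.0≤q (R.*-congʳ (R.+-congʳ r̄≈r))
    imaginary : Dec (im z R.≈ R.0#) → sign (R.- im z) R.* Z.v R.≈ R.- (Z.s R.* Z.v)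
    imaginary (no im≉0) = R.trans (R.*-congʳ (sign-neg (im z) im≉0))
      (solve 2 (λ s v → :- s :* v := :- (s :* v)) R.refl Z.s Z.v)
    imaginary (yes im≈0) = R.trans (R.*-congˡ v≈0) (R.trans (R.zeroʳ _)
      (R.sym (R.trans (R.-‿cong (R.trans (R.*-congˡ v≈0) (R.zeroʳ _))) (solve 0 (:- con ℤ.0ℤ := con ℤ.0ℤ) R.refl))))
      where
      0≤re : R.0# ≤ re z
      0≤re with Order.total R.0# (re z) | re z Order.≟ R.0#
      ... | inj₁ p | _      = p
      ... | inj₂ p | yes e  = Order.reflexive (R.sym e)
      ... | inj₂ p | no ne  = contradiction ((p , ne) , im≈0) z∉ℝ⁻
      r≈re : Z.r R.≈ re z
      r≈re = sqrt-unique 0≤re (R.sym (R.trans (R.+-congˡ (R.trans (R.*-congʳ im≈0) (R.zeroˡ _))) (R.+-identityʳ _)))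
      v≈0 : Z.v R.≈ R.0#
      v≈0 = sqrt-unique Order.refl (R.trans (R.zeroˡ _) (R.sym
        (R.trans (R.*-congʳ (R.trans (R.+-congʳ r≈re) (R.-‿inverseʳ _))) (R.zeroˡ _))))

-- The complex instance of the modulus, and the entries of the given matrices

∈-subsets : ∀ {m} (S : Subset m) → S List∈.∈ subsets m
∈-subsets []            = here ≡.refl
∈-subsets (inside ∷ S)  = ∈-++⁺ˡ (∈-map⁺ (inside ∷_) (∈-subsets S))
∈-subsets (outside ∷ S) = ∈-++⁺ʳ _ (∈-map⁺ (outside ∷_) (∈-subsets S))

module ComplexModulus (ℛ : Reals) where
  open Complex ℛ
  open ComplexProperties ℛ
  open RealProperties ℛ using (positive≉0; 0≤-neg)
  private module R = Reals ℛ
  open CS using (solve; _:=_; _:*_)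

  nonNeg-1 : NonNeg 1#
  nonNeg-1 = R.0≤1 , R.refl

  nonNeg-abs : ∀ {z} → NonNeg z → ∣ z ∣ ≈ z
  nonNeg-abs {z} p = abs-unique {z} p (C.*-congˡ {z} (C.sym {conj z} (nonNeg-real {z} p)))

  modulus : Modulus ℂ-commutativeRing conjugation
  modulus = record
    { abs         = ∣_∣
    ; _⁻¹         = _⁻¹
    ; abs-cong    = λ {a} {b} e → abs-unique {a} (abs-nonNeg b)
        (C.trans (abs-square b) (C.sym {a * conj a} (C.*-cong {a} {b} e (Involution.conj-cong conjugation {a} {b} e))))
    ; abs-real    = abs-real
    ; abs-square  = abs-square
    ; abs-*       = λ a b → abs-unique {a * b} (nonNeg-* {∣ a ∣} {∣ b ∣} (abs-nonNeg a) (abs-nonNeg b))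
        (C.trans {_} {∣ a ∣ * ∣ a ∣ * (∣ b ∣ * ∣ b ∣)}
          (solve 2 (λ p q → p :* q :* (p :* q) := p :* p :* (q :* q)) C.refl ∣ a ∣ ∣ b ∣)
          (C.trans {_} {a * conj a * (b * conj b)} (C.*-cong {∣ a ∣ * ∣ a ∣} (abs-square a) (abs-square b))
            (C.trans {_} {a * b * (conj a * conj b)}
              (solve 4 (λ a b c d → a :* c :* (b :* d) := a :* b :* (c :* d)) C.refl a b (conj a) (conj b))
              (C.*-congˡ {a * b} (C.sym {conj (a * b)} (Involution.conj-* conjugation a b))))))
    ; abs-conj    = λ a → abs-unique {conj a} (abs-nonNeg a) (C.trans (abs-square a)
        (C.trans (C.*-comm a (conj a)) (C.*-congˡ {conj a} (C.sym (Involution.conj-conj conjugation a)))))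
    ; abs-unit    = λ a e → abs-unique {a} nonNeg-1 (C.trans (C.*-identityˡ 1#) (C.sym {a * conj a} e))
    ; abs-0       = abs-0
    ; abs-zero    = abs-unique {0#} nonNeg-0 (C.trans (C.zeroˡ 0#) (C.sym (C.zeroˡ (conj 0#))))
    ; ⁻¹-inverseʳ = *-inverseʳ
    ; 1≉0         = λ (e , _) → R.1≉0 e
    }

  ×1≉0 : ∀ {k l} → suc l ℕ.≤ k → k ×ₙ 1# ≉ 0#
  ×1≉0 {suc k} (s≤s _) (e , _) = positive≉0 (proj₁ (nonNeg-× k)) e
    where
    nonNeg-× : ∀ k → NonNeg (k ×ₙ 1#)
    nonNeg-× zero    = nonNeg-0
    nonNeg-× (suc k) = nonNeg-+ {1#} nonNeg-1 (nonNeg-× k)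

  open InvolutiveRing ℂ-commutativeRing conjugation using (∑; ⟦_⟧; when; when-yes; when-no; Penrose; module Π)

  -- Couples the sign with divisibility, so that one case split selects the applicable cycle
  -- hypothesis.
  -1^-parity : ∀ ℓ → (2 ∣ ℓ × (- 1#) ^ ℓ ≈ 1#) ⊎ (¬ 2 ∣ ℓ × (- 1#) ^ ℓ ≈ - 1#)
  -1^-parity 0 = inj₁ (2 ∣0 , C.refl)
  -1^-parity 1 = inj₂ ((λ p → contradiction (∣1⇒≡1 p) λ ()) , C.*-identityʳ (- 1#))
  -1^-parity (suc (suc ℓ)) = Sum.map
    (λ (p , e) → ∣m∣n⇒∣m+n ∣-refl p , C.trans (double ((- 1#) ^ ℓ)) e)
    (λ (¬p , e) → (λ p → ¬p (∣m+n∣m⇒∣n p ∣-refl)) , C.trans (double ((- 1#) ^ ℓ)) e)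
    (-1^-parity ℓ)
    where
    double : ∀ z → - 1# * (- 1# * z) ≈ z
    double = CS.solve 1 (λ z → CS.:- CS.con ℤ.1ℤ CS.:* (CS.:- CS.con ℤ.1ℤ CS.:* z) CS.:= z) C.refl

  treeFormula≡ : ∀ n d s r v →
    (- 1#) ^ d / (n ×ₙ 1#) * ((s ×ₙ 1#) / r) * (∣ v ∣ / v) ≡ treeFormula ℂ-commutativeRing modulus n d s r v
  treeFormula≡ n d s r v = ≡.refl

  gramFormula≡ : ∀ {n m} (G : OrientedGraph n m) τ (u : Subset m → ℂ) (v : Subset m → Fin m → Fin n → ℂ) i j →
    gramFormula ℂ-commutativeRing conjugation G τ u v i j ≡
    τ ^ 2 * sum (λ k → ∑[ Tr ∈ spanningTreesThrough G k ] ∑[ Ts ∈ spanningTreesThrough G k ]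
      (u Tr * u Ts * conj (v Tr k i) * v Ts k j))
  gramFormula≡ G τ u v i j = ≡.refl

  penrose⇒moorePenrose : ∀ {r c} {M : Matrix r c} {X : Matrix c r} → Penrose M X → IsMoorePenroseInverse M X
  penrose⇒moorePenrose P = record
    { MXM≋M        = Penrose.MXM≋M P
    ; XMX≋X        = Penrose.XMX≋X P
    ; MX-hermitian = Penrose.MX-hermitian P
    ; XM-hermitian = Penrose.XM-hermitian P
    }

  module _ {n m : ℕ} (G : OrientedGraph n m) (w : Fin m → ℂ) where
    open OrientedGraph G
    open Graph G

    adjacency-forward : ∀ k → adjacency G w (tail k) (head k) ≈ w k
    adjacency-forward k with any? (λ l → tail l ≟ tail k ×-dec head l ≟ head k)
    ... | yes (l , e) = C.reflexive (≡.cong w (simple (inj₁ e) (joins-ends k)))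
    ... | no ¬e       = contradiction (k , ≡.refl , ≡.refl) ¬e

    -- `adjacency` first looks for an edge from `head k` to `tail k`. By simplicity that edge would
    -- be `k`, which would then be a loop.
    adjacency-backward : ∀ k → adjacency G w (head k) (tail k) ≈ conj (w k)
    adjacency-backward k with any? (λ l → tail l ≟ head k ×-dec head l ≟ tail k)
    ... | yes (l , t , h) with simple {l} {k} (inj₂ (t , h)) (joins-ends k)
    ...   | ≡.refl = contradiction (inj₁ (≡.refl , h)) loopless
    adjacency-backward k | no _ with any? (λ l → tail l ≟ tail k ×-dec head l ≟ head k)
    ...   | yes (l , e) = C.reflexive (≡.cong (conj ∘ w) (simple (inj₁ e) (joins-ends k)))
    ...   | no ¬e       = contradiction (k , ≡.refl , ≡.refl) ¬e

    adjacency-none : ∀ {i j} → ¬ Adjacent G ⊤ i j → adjacency G w i j ≈ 0#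
    adjacency-none {i} {j} ¬adj with any? (λ l → tail l ≟ i ×-dec head l ≟ j)
    ... | yes (l , e) = contradiction (l , ∈⊤ , inj₁ e) ¬adj
    ... | no _ with any? (λ l → tail l ≟ j ×-dec head l ≟ i)
    ...   | yes (l , e) = contradiction (l , ∈⊤ , inj₂ e) ¬adj
    ...   | no _        = C.refl

    incidenceEntry-tail : ∀ k → incidenceEntry G w (tail k) k ≈ √ (w k)
    incidenceEntry-tail k with tail k ≟ tail k | tail k ≟ head k
    ... | yes _ | _ = C.refl
    ... | no ¬e | _ = contradiction ≡.refl ¬e

    incidenceEntry-head : ∀ k → incidenceEntry G w (head k) k ≈ √ (conj (w k))
    incidenceEntry-head k with head k ≟ tail k | head k ≟ head k
    ... | yes e | _     = contradiction (inj₁ (≡.refl , e)) loopless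
    ... | no _  | yes _ = C.refl
    ... | no _  | no ¬e = contradiction ≡.refl ¬e

    incidenceEntry-other : ∀ i k → tail k ≢ i → head k ≢ i → incidenceEntry G w i k ≈ 0#
    incidenceEntry-other i k t≢i h≢i with i ≟ tail k | i ≟ head k
    ... | yes e | _     = contradiction (≡.sym e) t≢i
    ... | no _  | yes e = contradiction (≡.sym e) h≢i
    ... | no _  | no _  = C.refl

    degree-diagonal : ∀ i → degree G w i i ≈ ∑ (filter (λ l → ¬? (l ≟ i)) (allFin n)) (λ l → ∣ adjacency G w i l ∣)
    degree-diagonal i with i ≟ i
    ... | yes _ = C.refl
    ... | no ¬e = contradiction ≡.refl ¬e

    degree-offDiagonal : ∀ {i j} → i ≢ j → degree G w i j ≈ 0#
    degree-offDiagonal {i} {j} i≢j with i ≟ j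
    ... | yes e = contradiction e i≢j
    ... | no _  = C.refl

    -- Records which branch `treeInverse` took together with its value, so that later proofs can
    -- split on the branch without unfolding the path search.
    data TreeInverseView (T : Subset m) (k : Fin m) (j : Fin n) (z : ℂ) : Set where
      in-tail : Reach (T ∖ k) (tail k) j →
        z ≡ (- 1#) ^ edgeDistance G T k j / (n ×ₙ 1#)
          * ((componentSize G (T ∖ k) (head k) ×ₙ 1#) / √ (w k))
          * (∣ wt G w (path G T j (tail k)) ∣ / wt G w (path G T j (tail k))) → TreeInverseView T k j z
      in-head : ¬ Reach (T ∖ k) (tail k) j →
        z ≡ (- 1#) ^ edgeDistance G T k j / (n ×ₙ 1#)
          * ((componentSize G (T ∖ k) (tail k) ×ₙ 1#) / √ (conj (w k)))
          * (∣ wt G w (path G T j (head k)) ∣ / wt G w (path G T j (head k))) → TreeInverseView T k j z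

    treeInverse-view : ∀ T k j → TreeInverseView T k j (treeInverse G w T k j)
    treeInverse-view T k j with path? G (T ∖ k) (tail k) j
    ... | yes p = in-tail (path⇒reach p) ≡.refl
    ... | no ¬p = in-head (¬p ∘ reach⇒path) ≡.refl

-- Assembling the two inverses over the complex numbers

module ComplexGraph (ℛ : Reals) where
  open Complex ℛ
  open ComplexProperties ℛ
  open ComplexModulus ℛ
  open RealProperties ℛ using (0≤-neg)
  open InvolutiveRing ℂ-commutativeRing conjugation
    using (∑; ∑-cong; ∑-filter-allFin; sum-cong-≋; when; Penrose; Penrose-cong; module Π)
  open ModulusProperties ℂ-commutativeRing conjugation modulus using (*-≉0)
  private
    module R = Reals ℛ
    module Abs = Modulus modulus

  module Inverses {n m : ℕ} (G : OrientedGraph n m) (w : Fin m → ℂ)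
    (2≤n : 2 ℕ.≤ n) (connected : Connected G ⊤)
    (w≉0 : ∀ k → w k ≉ 0#) (w∉ℝ⁻ : ∀ k → ¬ ℝ⁻ (w k))
    (odd  : ∀ c → IsCycle G ⊤ c → ¬ (2 ∣ length c) → ℝ⁻ (wt G w (closedWalk G c)))
    (even : ∀ c → IsCycle G ⊤ c → 2 ∣ length c → ℝ⁺ (wt G w (closedWalk G c)))
    where
    open OrientedGraph G
    open Graph G
    open WeightedTrees ℂ-commutativeRing conjugation G using (treeWeight)
    open ModulusProperties.BalancedGraph ℂ-commutativeRing conjugation modulus G (adjacency G w) w w≉0
      (adjacency-forward G w) (adjacency-backward G w)
      using (weight; balancing)

    wt≡weight : ∀ γ → wt G w γ ≡ weight γ
    wt≡weight []          = ≡.refl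
    wt≡weight (_ ∷ [])    = ≡.refl
    wt≡weight (i ∷ j ∷ γ) = ≡.cong (adjacency G w i j *_) (wt≡weight (j ∷ γ))

    n≉0 : n ×ₙ 1# ≉ 0#
    n≉0 = ×1≉0 2≤n

    -- Merges the hypotheses on odd and even cycles into the single equation that `balancing`
    -- consumes: an odd length changes the sign of a negative weight, an even length keeps a
    -- positive one.
    signed-cycle : ∀ c → IsCycle G ⊤ c → (- 1#) ^ length c * wt G w (closedWalk G c) ≈ ∣ wt G w (closedWalk G c) ∣
    signed-cycle c isCycle = by-parity (-1^-parity (length c))
      where
      z : ℂ
      z = wt G w (closedWalk G c)
      by-parity : (2 ∣ length c × (- 1#) ^ length c ≈ 1#) ⊎ (¬ 2 ∣ length c × (- 1#) ^ length c ≈ - 1#) →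
                  (- 1#) ^ length c * z ≈ ∣ z ∣
      by-parity (inj₁ (p , e)) = C.trans (C.*-congʳ {z} e) (C.trans (C.*-identityˡ z) (C.sym (nonNeg-abs z≥0)))
        where
        z≥0 : NonNeg z
        z≥0 = let ((q , _) , im≈0) = even c isCycle p in q , im≈0
      by-parity (inj₂ (¬p , e)) = C.trans (C.*-congʳ {z} e) (C.sym (abs-unique {z} -z≥0 squares))
        where
        z<0 : ℝ⁻ z
        z<0 = odd c isCycle ¬p
        -z≥0 : NonNeg (- 1# * z)
        -z≥0 = nonNeg-resp (CS.solve 1 (λ z → CS.:- z CS.:= CS.:- CS.con ℤ.1ℤ CS.:* z) C.refl z)
          (0≤-neg (proj₁ (proj₁ z<0)) , R.trans (R.-‿cong (proj₂ z<0)) (proj₂ (CS.solve 0 (CS.:- CS.con ℤ.0ℤ CS.:= CS.con ℤ.0ℤ) C.refl)))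
        z-real : conj z ≈ z
        z-real = R.refl , R.trans (R.-‿cong (proj₂ z<0)) (R.trans (proj₂ (CS.solve 0 (CS.:- CS.con ℤ.0ℤ CS.:= CS.con ℤ.0ℤ) C.refl)) (R.sym (proj₂ z<0)))
        squares : - 1# * z * (- 1# * z) ≈ z * conj z
        squares = C.trans (CS.solve 1 (λ z → CS.:- CS.con ℤ.1ℤ CS.:* z CS.:* (CS.:- CS.con ℤ.1ℤ CS.:* z) CS.:= z CS.:* z) C.refl z)
          (C.*-congˡ {z} (C.sym z-real))

    abs-product : ∀ {k} (f : Fin k → ℂ) → ∣ product f ∣ ≈ Π.sum (∣_∣ ∘ f)
    abs-product {zero}  f = nonNeg-abs nonNeg-1
    abs-product {suc k} f = C.trans (Abs.abs-* (f zero) (product (f ∘ suc)))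
      (C.*-congˡ {∣ f zero ∣} (abs-product (f ∘ suc)))

    absWeight : ∀ T → ∣ W G w T ∣ ≈ treeWeight (∣_∣ ∘ w) T
    absWeight T = C.trans (abs-product (w ∘ lookup (edges T))) (Π.∑-filter-allFin (_∈? T) (∣_∣ ∘ w))

    product-≉0 : ∀ {k} (f : Fin k → ℂ) → (∀ i → f i ≉ 0#) → product f ≉ 0#
    product-≉0 {zero}  f p = Abs.1≉0
    product-≉0 {suc k} f p = *-≉0 {f zero} {product (f ∘ suc)} (p zero) (product-≉0 (f ∘ suc) (p ∘ suc))

    aTree : ∃ Tree
    aTree = tree-exists connected

    σ : ℂ
    σ = ∑[ T ∈ spanningTrees G ] ∣ W G w T ∣

    -- A vanishing sum of nonnegative terms has only zero terms, but the term of the tree from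
    -- `tree-exists` is the modulus of a product of non-zero weights.
    σ≉0 : σ ≉ 0#
    σ≉0 σ≈0 = product-≉0 (w ∘ lookup (edges T)) (w≉0 ∘ lookup (edges T)) (abs-0 (≡.subst (λ S → ∣ W G w S ∣ ≈ 0#)
      (≡.sym (lookup-index T∈)) (nonNeg-sum-0 (λ r → ∣ W G w (lookup (spanningTrees G) r) ∣)
        (λ r → abs-nonNeg (W G w (lookup (spanningTrees G) r))) σ≈0 (index T∈))))
      where
      T : Subset m
      T = proj₁ aTree
      T∈ = ∈-filter⁺ (isSpanningTree? G) (∈-subsets T) (tree⇒spanningTree (proj₂ aTree))

    τ : ℂ
    τ = 1# / σ

    τ*∑μ≈1 : τ * ∑ (spanningTrees G) (treeWeight (∣_∣ ∘ w)) ≈ 1#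
    τ*∑μ≈1 = C.trans (C.*-congˡ {τ} (C.sym (∑-cong (spanningTrees G) {λ T → ∣ W G w T ∣} absWeight)))
      (C.trans (C.*-congʳ {σ} (C.*-identityˡ (σ ⁻¹))) (C.trans (C.*-comm (σ ⁻¹) σ) (*-inverseʳ σ≉0)))

    theBalancing = balancing (proj₂ aTree) (λ c isCycle → ≡.subst (λ z → (- 1#) ^ length c * z ≈ ∣ z ∣)
      (wt≡weight (closedWalk G c)) (signed-cycle c isCycle))

    open ModulusProperties.BalancedGraph.Inverse ℂ-commutativeRing conjugation modulus G (adjacency G w) w w≉0
      (adjacency-forward G w) (adjacency-backward G w) (adjacency-none G w)
      (proj₁ theBalancing) (proj₁ (proj₂ theBalancing)) (proj₂ (proj₂ theBalancing))
      (√ ∘ w) (√-square ∘ w) (√-norm ∘ w) n≉0 τ τ*∑μ≈1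
      using (incidenceMatrix; inverseMatrix; treeMatrix; treeMatrix-tail; treeMatrix-head; tree-penrose; graph-penrose;
             incidence-tail; incidence-head; incidence-other; gram-diagonal; gram-offDiagonal; gram-inverse)

    incidence≈ : ∀ i k → incidenceMatrix i k ≈ incidenceEntry G w i k
    incidence≈ i k = by-cases (tail k ≟ i) (head k ≟ i)
      where
      by-cases : Dec (tail k ≡ i) → Dec (head k ≡ i) → incidenceMatrix i k ≈ incidenceEntry G w i k
      by-cases (yes ≡.refl) _ = C.trans (incidence-tail k) (C.sym (incidenceEntry-tail G w k))
      by-cases (no _) (yes ≡.refl) = C.trans (incidence-head k)
        (C.sym (C.trans (incidenceEntry-head G w k) (√-conj (w∉ℝ⁻ k))))
      by-cases (no t≢i) (no h≢i) = C.trans (incidence-other i k t≢i h≢i) (C.sym (incidenceEntry-other G w i k t≢i h≢i))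

    laplacian≈ : incidenceMatrix · incidenceMatrix ᴴ ≋ signlessLaplacian G w
    laplacian≈ i j = by-cases (i ≟ j)
      where
      a : Fin n → Fin n → ℂ
      a = adjacency G w
      a-diagonal : ∀ i → a i i ≈ 0#
      a-diagonal i = adjacency-none G w (λ (_ , _ , J) → loopless J)
      by-cases : Dec (i ≡ j) → (incidenceMatrix · incidenceMatrix ᴴ) i j ≈ signlessLaplacian G w i j
      by-cases (no i≢j) = C.trans (gram-offDiagonal i≢j)
        (C.sym (C.trans (C.+-congʳ {a i j} (degree-offDiagonal G w i≢j)) (C.+-identityˡ (a i j))))
      by-cases (yes ≡.refl) = C.trans (gram-diagonal i) (C.sym (C.trans
        (C.+-cong {degree G w i i} (C.trans (degree-diagonal G w i) (∑-filter-allFin (λ l → ¬? (l ≟ i)) (λ l → ∣ a i l ∣))) (a-diagonal i))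
        (C.trans (C.+-identityʳ _) (sum-cong-≋ {n} (λ l → off-diagonal l (l ≟ i))))))
        where
        -- The degree leaves out `l = i`, while `gram-diagonal` sums over all `l`; the extra term is
        -- 0 because there are no loops.
        off-diagonal : ∀ l (d : Dec (l ≡ i)) → when (¬? d) ∣ a i l ∣ ≈ ∣ a i l ∣
        off-diagonal l (no _)       = C.refl
        off-diagonal l (yes ≡.refl) = C.sym (C.trans (Abs.abs-cong (a-diagonal i)) Abs.abs-zero)

    treeInverse≈ : ∀ {T} → Tree T → ∀ {k} → k ∈ T → ∀ j → treeInverse G w T k j ≈ treeMatrix T k j
    treeInverse≈ {T} isTree {k} k∈T j = by-view (treeInverse-view G w T k j)
      where
      by-view : ∀ {z} → TreeInverseView G w T k j z → z ≈ treeMatrix T k j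
      by-view (in-tail r e)  = treeMatrix-tail isTree k∈T r (wt≡weight (path G T j (tail k))) (≡.trans e
        (treeFormula≡ n (edgeDistance G T k j) (componentSize G (T ∖ k) (head k)) (√ (w k)) (wt G w (path G T j (tail k)))))
      by-view (in-head ¬r e) = treeMatrix-head isTree k∈T (√-conj (w∉ℝ⁻ k)) ¬r (wt≡weight (path G T j (head k))) (≡.trans e
        (treeFormula≡ n (edgeDistance G T k j) (componentSize G (T ∖ k) (tail k)) (√ (conj (w k))) (wt G w (path G T j (head k)))))

    tree-inverse : ∀ T → IsSpanningTree G T →
      IsMoorePenroseInverse (incidence G w T) (λ r j → treeInverse G w T (lookup (edges T) r) j)
    tree-inverse T isSpanningTree = penrose⇒moorePenrose (Penrose-cong
      (λ i r → incidence≈ i (lookup (edges T) r))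
      (λ r j → C.sym (treeInverse≈ isTree (lookup-edges T r) j))
      (tree-penrose isTree))
      where
      isTree : Tree T
      isTree = spanningTree⇒tree isSpanningTree

    graph-inverse : IsMoorePenroseInverse (signlessLaplacian G w)
      (λ i j → τ ^ 2 * sum (λ k → ∑[ Tr ∈ spanningTreesThrough G k ] ∑[ Ts ∈ spanningTreesThrough G k ]
        (∣ W G w Tr ∣ * ∣ W G w Ts ∣ * conj (treeInverse G w Tr k i) * treeInverse G w Ts k j)))
    graph-inverse = penrose⇒moorePenrose (Penrose-cong laplacian≈
      (λ i j → C.trans (gram-inverse (treeInverse G w) (λ T → ∣ W G w T ∣) treeInverse≈ absWeight i j)
        (C.reflexive (gramFormula≡ G τ (λ T → ∣ W G w T ∣) (treeInverse G w) i j)))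
      graph-penrose)

open import Data.Nat.Base using (_≤_)

theorem5p2 : (ℛ : Reals) → let open Complex ℛ in
    ∀ {n m} (G : OrientedGraph n m) (w : Fin m → ℂ) →
    2 ≤ n → 1 ≤ m →
    Connected G ⊤ →
    (∀ k → w k ≉ 0#) →
    (∀ k → ¬ ℝ⁻ (w k)) →
    ∃ (IsCycle G ⊤) →
    (∀ c → IsCycle G ⊤ c → ¬ (2 ∣ length c) → ℝ⁻ (wt G w (closedWalk G c))) →
    (∀ c → IsCycle G ⊤ c → 2 ∣ length c → ℝ⁺ (wt G w (closedWalk G c))) →
    (∀ T → IsSpanningTree G T →
    IsMoorePenroseInverse (incidence G w T)
    (λ r j → treeInverse G w T (lookup (edges T) r) j))
    ×
    IsMoorePenroseInverse (signlessLaplacian G w)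
    (λ i j →
    (1# / (∑[ T ∈ spanningTrees G ] ∣ W G w T ∣)) ^ 2
    * sum (λ k →
    ∑[ Tr ∈ spanningTreesThrough G k ]
    ∑[ Ts ∈ spanningTreesThrough G k ]
    (∣ W G w Tr ∣ * ∣ W G w Ts ∣
    * conj (treeInverse G w Tr k i) * treeInverse G w Ts k j)))
theorem5p2 ℛ G w 2≤n _ connected w≉0 w∉ℝ⁻ _ odd even = tree-inverse , graph-inverse
  where open ComplexGraph.Inverses ℛ G w 2≤n connected w≉0 w∉ℝ⁻ odd even
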